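{- Let $q,r\geq 2$ be integers with $q$ even. Then there exists $n_0=n_0(q,r)$ such that for all $n\geq n_0$, up to isomorphism, $${\rm EX}_{3}(n,\theta(1,q,r))=\begin{cases} \mathcal{G}(n) & \text{if } q=r=2,\\ \{K_{\lceil\frac{n-1}{2}\rceil,\lfloor\frac{n-1}{2}\rfloor}\bullet K_3\} & \text{if } r\geq 4 \text{ is even},\\ \mathcal{H}(n) & \text{if } q=2 \text{ and } r \text{ is odd},\\ \{K_{\lceil\frac{n-2}{2}\rceil,\lfloor\frac{n-2}{2}\rfloor}\circ K_3,\ K_{\lfloor\frac{n-2}{2}\rfloor,\lceil\frac{n-2}{2}\rceil}\circ K_3\} & \text{if } q\geq 4 \text{ and } r \text{ is odd}. \end{cases}$$
   Context: All graphs are finite and simple. A graph is $H$-free if it contains no subgraph isomorphic to $H$. The generalized theta graph $\theta(\ell_1,\ell_2,\dots,\ell_t)$ is the graph formed by $t$ internally vertex-disjoint paths of lengths $\ell_1,\dots,\ell_t$ sharing the same two endpoints; in particular $\theta(1,q,r)$ consists of an edge $uv$ together with two further internally disjoint $(u,v)$-paths of lengths $q$ and $r$. ${\rm EX}_3(n,H)$ denotes the family of all $n$-vertex $H$-free non-bipartite graphs having the maximum number of edges among all $n$-vertex $H$-free non-bipartite graphs. $K_{a,b}$ is the complete bipartite graph with parts of sizes $a$ and $b$. $K_{a,b}\circ K_3$ is the graph obtained by identifying a vertex of $K_{a,b}$ lying in the part of size $b$ with a vertex of a triangle $K_3$. $K_{a,b}\bullet K_3$ is the graph obtained by identifying an edge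 of $K_{a,b}$ with an edge of a triangle $K_3$. $T_{m,2}$ is the complete bipartite graph on $m$ vertices with part sizes $\lceil m/2\rceil,\lfloor m/2\rfloor$. $\mathcal{H}(n)$: let $b=0$ if $n$ is odd and $b\in\{0,1\}$ if $n$ is even; let $X,Y$ be the parts of $K_{\lceil n/2\rceil+b,\lfloor n/2\rfloor-b}$ with $|Y|=\lceil n/2\rceil+b$, and let $u_1,u_2\in Y$ be distinct. $\mathcal{H}(n)$ is the family of all graphs obtained from this complete bipartite graph by adding the edge $u_1u_2$, deleting all edges from $u_1$ to $X\setminus X_1$ and all edges from $u_2$ to $X_1$, where $X_1$ ranges over non-empty proper subsets of $X$ (and $b$ over its allowed values). $\mathcal{G}(n)$: let $X,Y$ be the two parts of $T_{n-3,2}$ and let $w_1w_2w_3$ be a triangle on three new vertices. $\mathcal{G}(n)$ is the family of all graphs obtained from $T_{n-3,2}$ and this triangle by joining $w_1$ to every vertex of $X\setminus X_1$, $w_2$ to every vertex of $Y\setminus Y_1$, and $w_3$ to every vertex of $X_1\cup Y_1$, where $X_1\subseteq X$, $Y_1\subseteq Y$ range over subsets with $|X_1|\cdot|Y_1|\leq 1$. -}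

module Defs where

open import Data.Nat.Base using (ℕ; zero; suc; _+_; _*_; _∸_; _≤_; ⌈_/2⌉; ⌊_/2⌋; _≡ᵇ_; _<ᵇ_)
open import Data.Nat.Divisibility using (_∣_)
open import Data.Bool.Base using (Bool; true; false; _∧_; _∨_; not; if_then_else_)
open import Data.Fin.Base using (Fin; toℕ)
open import Data.Fin.Properties using (_≟_)
open import Data.Fin.Permutation using (Permutation′; _⟨$⟩ʳ_)
open import Data.List.Base using (List; map; allFin)
open import Data.Nat.ListAction using (sum)
open import Data.Product.Base using (Σ; ∃; ∃-syntax; _×_; _,_)
open import Data.Sum.Base using (_⊎_)
open import Function.Definitions using (Injective)
open import Relation.Binary.PropositionalEquality using (_≡_; _≢_)
open import Relation.Nullary using (¬_; does)

record Graph (n : ℕ) : Set where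
  field
    adj    : Fin n → Fin n → Bool
    sym    : ∀ i j → adj i j ≡ adj j i
    irrefl : ∀ i → adj i i ≡ false
open Graph public

_==_ : ∀ {n} → Fin n → Fin n → Bool
i == j = does (i ≟ j)

card : ∀ {n} → (Fin n → Bool) → ℕ
card {n} p = sum (map (λ i → if p i then 1 else 0) (allFin n))

edges : ∀ {n} → Graph n → ℕ
edges {n} G = sum (map (λ i → card (λ j → (toℕ i <ᵇ toℕ j) ∧ adj G i j)) (allFin n))

Contains : ∀ {n} → Graph n → (k : ℕ) → (Fin k → Fin k → Bool) → Set
Contains {n} G k A =
  Σ (Fin k → Fin n) λ f → Injective _≡_ _≡_ f ×
    (∀ i j → A i j ≡ true → adj G (f i) (f j) ≡ true)

Free : ∀ {n} → Graph n → (k : ℕ) → (Fin k → Fin k → Bool) → Set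
Free G k A = ¬ Contains G k A

Bipartite : ∀ {n} → Graph n → Set
Bipartite {n} G = Σ (Fin n → Bool) λ c → ∀ i j → adj G i j ≡ true → c i ≢ c j

_≅_ : ∀ {n} → Graph n → Graph n → Set
_≅_ {n} G H = Σ (Permutation′ n) λ π →
  ∀ i j → adj H (π ⟨$⟩ʳ i) (π ⟨$⟩ʳ j) ≡ adj G i j

-- The theta graph θ(1,q,r) (for q,r ≥ 2) on vertex set Fin (q + r):
-- the cycle 0 - 1 - ... - (q+r-1) - 0 of length q + r, plus the chord 0q.
-- The paths 0,1,...,q (length q) and q,q+1,...,q+r-1,0 (length r) and the
-- edge 0q are three internally disjoint (0,q)-paths of lengths 1, q, r.

thetaAdj : (q r : ℕ) → Fin (q + r) → Fin (q + r) → Bool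
thetaAdj q r i j =
     (suc a ≡ᵇ b) ∨ (suc b ≡ᵇ a)
   ∨ ((a ≡ᵇ 0) ∧ (suc b ≡ᵇ q + r)) ∨ ((b ≡ᵇ 0) ∧ (suc a ≡ᵇ q + r))
   ∨ ((a ≡ᵇ 0) ∧ (b ≡ᵇ q)) ∨ ((b ≡ᵇ 0) ∧ (a ≡ᵇ q))
  where
    a = toℕ i
    b = toℕ j

InEX3θ : (n q r : ℕ) → Graph n → Set
InEX3θ n q r G =
  Free G (q + r) (thetaAdj q r) × ¬ Bipartite G ×
  (∀ (G' : Graph n) → Free G' (q + r) (thetaAdj q r) → ¬ Bipartite G' →
     edges G' ≤ edges G)

EX3θ-is : (n q r : ℕ) → (Graph n → Set) → Set
EX3θ-is n q r P =
  (∀ G → InEX3θ n q r G → ∃[ F ] P F × G ≅ F) ×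
  (∀ F → P F → ∃[ G ] InEX3θ n q r G × G ≅ F)

-- Vertex roles used to describe the extremal constructions (a graph is a
-- member of a family iff some labelling of its vertices realises the
-- construction exactly).

data Side : Set where
  sA sB sW : Side

isA isB isW : Side → Bool
isA sA = true
isA _  = false
isB sB = true
isB _  = false
isW sW = true
isW _  = false

crossAB : Side → Side → Bool
crossAB s t = (isA s ∧ isB t) ∨ (isB s ∧ isA t)

-- K_{a,b} • K₃ : parts A (size a), B (size b); the triangle's third vertex w
-- (role W) is joined to the endpoints x ∈ A, y ∈ B of an edge xy.
IsBullet : ∀ {n} → (a b : ℕ) → Graph n → Set
IsBullet {n} a b G =
  Σ (Fin n → Side) λ role → Σ (Fin n) λ x → Σ (Fin n) λ y →
    card (λ i → isA (role i)) ≡ a × card (λ i → isB (role i)) ≡ b ×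
    card (λ i → isW (role i)) ≡ 1 ×
    role x ≡ sA × role y ≡ sB ×
    (∀ i j → adj G i j ≡
       (crossAB (role i) (role j)
        ∨ (isW (role i) ∧ ((j == x) ∨ (j == y)))
        ∨ (isW (role j) ∧ ((i == x) ∨ (i == y)))))

-- K_{a,b} ∘ K₃ : parts A (size a), B (size b); the two further triangle
-- vertices (role W) are adjacent to each other and to z ∈ B.
IsCirc : ∀ {n} → (a b : ℕ) → Graph n → Set
IsCirc {n} a b G =
  Σ (Fin n → Side) λ role → Σ (Fin n) λ z →
    card (λ i → isA (role i)) ≡ a × card (λ i → isB (role i)) ≡ b ×
    card (λ i → isW (role i)) ≡ 2 ×
    role z ≡ sB ×
    (∀ i j → adj G i j ≡
       (crossAB (role i) (role j)
        ∨ (isW (role i) ∧ isW (role j) ∧ not (i == j))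
        ∨ (isW (role i) ∧ (j == z))
        ∨ (isW (role j) ∧ (i == z))))

InBullet : (n : ℕ) → Graph n → Set
InBullet n G = IsBullet ⌈ (n ∸ 1) /2⌉ ⌊ (n ∸ 1) /2⌋ G

InCirc : (n : ℕ) → Graph n → Set
InCirc n G = IsCirc ⌈ (n ∸ 2) /2⌉ ⌊ (n ∸ 2) /2⌋ G ⊎ IsCirc ⌊ (n ∸ 2) /2⌋ ⌈ (n ∸ 2) /2⌉ G

edgeXY : ∀ {n} → (u₁ u₂ : Fin n) → (X₁ : Fin n → Bool) → Fin n → Fin n → Bool
edgeXY u₁ u₂ X₁ x y =
  if y == u₁ then X₁ x else if y == u₂ then not (X₁ x) else true

-- 𝓗(n): parts X (role A) and Y (role B) of K_{⌈n/2⌉+b, ⌊n/2⌋-b} with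
-- |Y| = ⌈n/2⌉ + b, where b = 0, or b = 1 and n even; u₁ ≠ u₂ ∈ Y;
-- X₁ a non-empty proper subset of X.  The edge u₁u₂ is added, and u₁ keeps
-- only its edges to X₁, u₂ only its edges to X ∖ X₁.
InH : (n : ℕ) → Graph n → Set
InH n G =
  Σ ℕ λ b → (b ≡ 0 ⊎ (b ≡ 1 × 2 ∣ n)) ×
  Σ (Fin n → Side) λ role → Σ (Fin n) λ u₁ → Σ (Fin n) λ u₂ →
  Σ (Fin n → Bool) λ X₁ →
    card (λ i → isB (role i)) ≡ ⌈ n /2⌉ + b ×
    card (λ i → isA (role i)) ≡ ⌊ n /2⌋ ∸ b ×
    card (λ i → isW (role i)) ≡ 0 ×
    role u₁ ≡ sB × role u₂ ≡ sB × u₁ ≢ u₂ ×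
    (∀ i → X₁ i ≡ true → role i ≡ sA) ×
    (∃[ i ] X₁ i ≡ true) × (∃[ i ] (role i ≡ sA × X₁ i ≡ false)) ×
    (∀ i j → adj G i j ≡
       ((isA (role i) ∧ isB (role j) ∧ edgeXY u₁ u₂ X₁ i j)
        ∨ (isA (role j) ∧ isB (role i) ∧ edgeXY u₁ u₂ X₁ j i)
        ∨ ((i == u₁) ∧ (j == u₂)) ∨ ((i == u₂) ∧ (j == u₁))))

-- 𝓖(n): parts X (role A) and Y (role B) of T_{n-3,2} (sizes ⌈(n-3)/2⌉ and
-- ⌊(n-3)/2⌋, in either order), a triangle w₁w₂w₃ (role W), subsets
-- X₁ ⊆ X, Y₁ ⊆ Y with |X₁|·|Y₁| ≤ 1; w₁ ~ X ∖ X₁, w₂ ~ Y ∖ Y₁, w₃ ~ X₁ ∪ Y₁.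
InG : (n : ℕ) → Graph n → Set
InG n G =
  Σ (Fin n → Side) λ role → Σ (Fin n) λ w₁ → Σ (Fin n) λ w₂ → Σ (Fin n) λ w₃ →
  Σ (Fin n → Bool) λ X₁ → Σ (Fin n → Bool) λ Y₁ →
    ((card (λ i → isA (role i)) ≡ ⌈ (n ∸ 3) /2⌉ × card (λ i → isB (role i)) ≡ ⌊ (n ∸ 3) /2⌋)
     ⊎ (card (λ i → isA (role i)) ≡ ⌊ (n ∸ 3) /2⌋ × card (λ i → isB (role i)) ≡ ⌈ (n ∸ 3) /2⌉)) ×
    card (λ i → isW (role i)) ≡ 3 ×
    role w₁ ≡ sW × role w₂ ≡ sW × role w₃ ≡ sW ×
    w₁ ≢ w₂ × w₁ ≢ w₃ × w₂ ≢ w₃ ×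
    (∀ i → X₁ i ≡ true → role i ≡ sA) × (∀ i → Y₁ i ≡ true → role i ≡ sB) ×
    card X₁ * card Y₁ ≤ 1 ×
    (∀ i j → adj G i j ≡
       (crossAB (role i) (role j)
        ∨ (isW (role i) ∧ isW (role j) ∧ not (i == j))
        ∨ ((i == w₁) ∧ isA (role j) ∧ not (X₁ j)) ∨ ((j == w₁) ∧ isA (role i) ∧ not (X₁ i))
        ∨ ((i == w₂) ∧ isB (role j) ∧ not (Y₁ j)) ∨ ((j == w₂) ∧ isB (role i) ∧ not (Y₁ i))
        ∨ ((i == w₃) ∧ (X₁ j ∨ Y₁ j)) ∨ ((j == w₃) ∧ (X₁ i ∨ Y₁ i))))

{-# OPTIONS --safe #-}
module Submission where

-- Deleting a vertex of degree below 39/80 of the current order increases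
-- 4e − n².  A θ(1,q,r)-free graph in which no such vertex is left is bipartite:
-- a triangle would contain an edge with linearly many common neighbours, among
-- which a Ramsey argument finds many that pairwise have many common neighbours,
-- and paths through these complete a theta graph; without triangles the
-- neighbourhoods of the ends of one edge determine the sides.  Hence 4e ≤ n² for
-- large n, and a graph with 4e ≥ n² − 4n keeps a bipartite core after boundedly
-- many deletions.
--
-- A vertex with at least n/32 neighbours on one side of the core has none on the
-- other, since paths through the core would give a theta graph.  Counting edges
-- then leaves one vertex w outside a bipartition (A , B), or, for q ≥ 4 and r odd,
-- two adjacent vertices of small degree with a single further common neighbour.
-- In e + |missing edges of A × B| = |A| |B| + deg w, theta-freeness forces enough
-- missing edges to give the maximum, and equality determines the missing edges,
-- hence the graph.

-- Since q is even, the chord and the q-path close an odd cycle, so bipartite graphs are theta-free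
-- and n²/4 is the right scale. The value 39/80 lies just below 1/2: deleting a vertex of smaller
-- degree gains about 1/20 of the order in 4e - n², while a vertex that survives misses at most 1/40
-- of the order on the opposite side. The bound 4e ≥ n² - 4n holds for every candidate, the sparsest
-- having ⌊(n-2)²/4⌋ + 3 edges.
--
-- The obstacle is to find disjoint paths of prescribed lengths without following them through the
-- graph. A connection is therefore a promise, `Conn`: a path of the given length exists whatever
-- set F must be avoided, as long as |F| plus the length is at most K. Parity then decides
-- everything. In the core, paths between opposite sides are odd and paths within a side are even; a
-- configuration is forbidden exactly when it supplies a detour of the other parity.
--
-- No two families are ever compared. Each case has a number N such that all members have exactly N
-- edges and every admissible graph with at least N edges is a member.

open import Defs renaming (sym to adj-sym; irrefl to adj-irrefl)
open import Data.Nat.Base using (ℕ; zero; suc; _+_; _*_; _∸_; _^_; _≤_; _<_; z≤n; s≤s; _%_; _/_; ⌈_/2⌉; ⌊_/2⌋; _≡ᵇ_; _<ᵇ_; _≤ᵇ_)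
import Data.Nat.Properties as ℕₚ
open import Data.Integer.Base as ℤ using (ℤ; -[1+_]) renaming (+_ to pos)
open import Data.Bool.Base using (Bool; true; false; _∧_; _∨_; not; if_then_else_; T)
open import Data.Fin.Base as Fin using (Fin; zero; suc; toℕ)
import Data.Fin.Properties as Finₚ
open import Data.List.Base as List using (List; []; _∷_; _++_; map; foldr; length; filterᵇ; concatMap; allFin; upTo)
import Data.List.Properties as Listₚ
open import Data.Vec.Base as Vec using (Vec; []; _∷_)
open import Data.Vec.N-ary using (N-ary; _$ⁿ_)
open import Data.Maybe.Base using (Maybe; just; nothing)
open import Data.Product.Base using (Σ; ∃-syntax; _×_; _,_; proj₁; proj₂)
open import Data.Sum.Base using (_⊎_; inj₁; inj₂)
open import Data.Empty using (⊥; ⊥-elim)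
open import Data.Unit.Base using (⊤; tt)
open import Function.Base using (_∘_; id; case_of_)
open import Relation.Nullary using (¬_; Dec; yes; no; does)
open import Relation.Binary.PropositionalEquality using (_≡_; _≢_; refl; sym; trans; cong; cong₂; subst; subst₂; module ≡-Reasoning)
import Data.Product.Properties as Productₚ
open import Relation.Nullary.Decidable using (True; toWitness)
open import Data.Nat.ListAction using (sum)
import Data.Bool.Properties as Boolₚ
open import Data.List.Membership.Propositional using (_∈_; _∉_)
open import Data.List.Relation.Unary.Any using (here; there)
open import Relation.Binary.Definitions using (tri<; tri≈; tri>)
open import Data.Nat.Divisibility using (_∣_; divides)
import Data.Fin.Permutation as Perm

-- Linear arithmetic over ℕ

infixl 6 _:+_
infixl 7 _:*_
infix 5.5 _:≤_ _:<_ _:≡_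
infix 2 _⊢_

data Expr (k : ℕ) : Set where
  var : Fin k → Expr k
  #_ : ℕ → Expr k
  _:+_ _:*_ : Expr k → Expr k → Expr k

data Formula (k : ℕ) : Set where
  _:≤_ _:<_ _:≡_ : Expr k → Expr k → Formula k
  absurd : Formula k

record Sequent (k : ℕ) : Set where
  constructor _⊢_
  field
    hyps : List (Formula k)
    goal : Formula k

module _ {k : ℕ} where

  ⟦_⟧ : Expr k → Vec ℕ k → ℕ
  ⟦ var i ⟧ ρ = Vec.lookup ρ i
  ⟦ # c ⟧ ρ = c
  ⟦ e :+ f ⟧ ρ = ⟦ e ⟧ ρ + ⟦ f ⟧ ρ
  ⟦ e :* f ⟧ ρ = ⟦ e ⟧ ρ * ⟦ f ⟧ ρ

  ⟦_⟧ᶠ : Formula k → Vec ℕ k → Set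
  ⟦ e :≤ f ⟧ᶠ ρ = ⟦ e ⟧ ρ ≤ ⟦ f ⟧ ρ
  ⟦ e :< f ⟧ᶠ ρ = ⟦ e ⟧ ρ < ⟦ f ⟧ ρ
  ⟦ e :≡ f ⟧ᶠ ρ = ⟦ e ⟧ ρ ≡ ⟦ f ⟧ ρ
  ⟦ absurd ⟧ᶠ ρ = ⊥

  _⇒_ : List (Formula k) → (Vec ℕ k → Set) → Vec ℕ k → Set
  ([] ⇒ A) ρ = A ρ
  ((h ∷ hs) ⇒ A) ρ = ⟦ h ⟧ᶠ ρ → (hs ⇒ A) ρ

  Mono Poly : Set
  Mono = List (Fin k)
  Poly = List (Mono × ℕ)

  ⟦_⟧ᵐ : Mono → Vec ℕ k → ℕ
  ⟦ [] ⟧ᵐ ρ = 1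
  ⟦ i ∷ m ⟧ᵐ ρ = Vec.lookup ρ i * ⟦ m ⟧ᵐ ρ

  ⟦_⟧ᵖ : Poly → Vec ℕ k → ℕ
  ⟦ [] ⟧ᵖ ρ = 0
  ⟦ (m , c) ∷ p ⟧ᵖ ρ = c * ⟦ m ⟧ᵐ ρ + ⟦ p ⟧ᵖ ρ

  insertVar : Fin k → Mono → Mono
  insertVar i [] = i ∷ []
  insertVar i (j ∷ m) = if toℕ i <ᵇ toℕ j then i ∷ j ∷ m else j ∷ insertVar i m

  mulMono : Mono → Mono → Mono
  mulMono [] m = m
  mulMono (i ∷ l) m = insertVar i (mulMono l m)

  ltMono : Mono → Mono → Bool
  ltMono [] [] = false
  ltMono [] (_ ∷ _) = true
  ltMono (_ ∷ _) [] = false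
  ltMono (i ∷ l) (j ∷ m) = (toℕ i <ᵇ toℕ j) ∨ ((toℕ i ≡ᵇ toℕ j) ∧ ltMono l m)

  _≟ᵐ_ : (l m : Mono) → Dec (l ≡ m)
  _≟ᵐ_ = Listₚ.≡-dec Finₚ._≟_

  insertTerm : Mono → ℕ → Poly → Poly
  insertTerm m zero p = p
  insertTerm m c@(suc _) [] = (m , c) ∷ []
  insertTerm m c@(suc _) ((l , d) ∷ p) with m ≟ᵐ l
  ... | yes _ = (l , c + d) ∷ p
  ... | no _ = if ltMono m l then (m , c) ∷ (l , d) ∷ p else (l , d) ∷ insertTerm m c p

  addPoly : Poly → Poly → Poly
  addPoly [] q = q
  addPoly ((m , c) ∷ p) q = insertTerm m c (addPoly p q)

  mulTerm : Mono → ℕ → Poly → Poly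
  mulTerm m c [] = []
  mulTerm m c ((l , d) ∷ q) = insertTerm (mulMono m l) (c * d) (mulTerm m c q)

  mulPoly : Poly → Poly → Poly
  mulPoly [] q = []
  mulPoly ((m , c) ∷ p) q = addPoly (mulTerm m c q) (mulPoly p q)

  norm : Expr k → Poly
  norm (var i) = (i ∷ [] , 1) ∷ []
  norm (# c) = insertTerm [] c []
  norm (e :+ f) = addPoly (norm e) (norm f)
  norm (e :* f) = mulPoly (norm e) (norm f)

  module _ (ρ : Vec ℕ k) where

    insertVar-sound : ∀ i m → ⟦ insertVar i m ⟧ᵐ ρ ≡ Vec.lookup ρ i * ⟦ m ⟧ᵐ ρ
    insertVar-sound i [] = refl
    insertVar-sound i (j ∷ m) with toℕ i <ᵇ toℕ j
    ... | true = refl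
    ... | false = trans (cong (Vec.lookup ρ j *_) (insertVar-sound i m)) (swap (Vec.lookup ρ j) (Vec.lookup ρ i) (⟦ m ⟧ᵐ ρ))
      where
      swap : ∀ a b c → a * (b * c) ≡ b * (a * c)
      swap a b c = trans (sym (ℕₚ.*-assoc a b c)) (trans (cong (_* c) (ℕₚ.*-comm a b)) (ℕₚ.*-assoc b a c))

    mulMono-sound : ∀ l m → ⟦ mulMono l m ⟧ᵐ ρ ≡ ⟦ l ⟧ᵐ ρ * ⟦ m ⟧ᵐ ρ
    mulMono-sound [] m = sym (ℕₚ.+-identityʳ _)
    mulMono-sound (i ∷ l) m = trans (insertVar-sound i (mulMono l m))
      (trans (cong (Vec.lookup ρ i *_) (mulMono-sound l m)) (sym (ℕₚ.*-assoc (Vec.lookup ρ i) _ _)))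

    insertTerm-sound : ∀ m c p → ⟦ insertTerm m c p ⟧ᵖ ρ ≡ c * ⟦ m ⟧ᵐ ρ + ⟦ p ⟧ᵖ ρ
    insertTerm-sound m zero p = refl
    insertTerm-sound m (suc c) [] = refl
    insertTerm-sound m (suc c) ((l , d) ∷ p) with m ≟ᵐ l
    ... | yes refl = merge (suc c) d (⟦ m ⟧ᵐ ρ) (⟦ p ⟧ᵖ ρ)
      where
      merge : ∀ a b x y → (a + b) * x + y ≡ a * x + (b * x + y)
      merge a b x y = trans (cong (_+ y) (ℕₚ.*-distribʳ-+ x a b)) (ℕₚ.+-assoc (a * x) (b * x) y)
    ... | no _ with ltMono m l
    ...   | true = refl
    ...   | false = trans (cong (λ x → d * ⟦ l ⟧ᵐ ρ + x) (insertTerm-sound m (suc c) p)) (swap (d * ⟦ l ⟧ᵐ ρ) (suc c * ⟦ m ⟧ᵐ ρ) (⟦ p ⟧ᵖ ρ))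
      where
      swap : ∀ a b c → a + (b + c) ≡ b + (a + c)
      swap a b c = trans (sym (ℕₚ.+-assoc a b c)) (trans (cong (_+ c) (ℕₚ.+-comm a b)) (ℕₚ.+-assoc b a c))

    addPoly-sound : ∀ p q → ⟦ addPoly p q ⟧ᵖ ρ ≡ ⟦ p ⟧ᵖ ρ + ⟦ q ⟧ᵖ ρ
    addPoly-sound [] q = refl
    addPoly-sound ((m , c) ∷ p) q = trans (insertTerm-sound m c (addPoly p q))
      (trans (cong (λ x → c * ⟦ m ⟧ᵐ ρ + x) (addPoly-sound p q)) (sym (ℕₚ.+-assoc (c * ⟦ m ⟧ᵐ ρ) _ _)))

    mulTerm-sound : ∀ m c q → ⟦ mulTerm m c q ⟧ᵖ ρ ≡ c * ⟦ m ⟧ᵐ ρ * ⟦ q ⟧ᵖ ρ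
    mulTerm-sound m c [] = sym (ℕₚ.*-zeroʳ (c * ⟦ m ⟧ᵐ ρ))
    mulTerm-sound m c ((l , d) ∷ q) = trans (insertTerm-sound (mulMono m l) (c * d) (mulTerm m c q))
      (trans (cong₂ (λ x y → c * d * x + y) (mulMono-sound m l) (mulTerm-sound m c q))
        (distr c d (⟦ m ⟧ᵐ ρ) (⟦ l ⟧ᵐ ρ) (⟦ q ⟧ᵖ ρ)))
      where
      distr : ∀ c d x y z → c * d * (x * y) + c * x * z ≡ c * x * (d * y + z)
      distr c d x y z = trans (cong (_+ c * x * z) (ℕₚ.[m*n]*[o*p]≡[m*o]*[n*p] c d x y))
        (sym (ℕₚ.*-distribˡ-+ (c * x) (d * y) z))

    mulPoly-sound : ∀ p q → ⟦ mulPoly p q ⟧ᵖ ρ ≡ ⟦ p ⟧ᵖ ρ * ⟦ q ⟧ᵖ ρ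
    mulPoly-sound [] q = refl
    mulPoly-sound ((m , c) ∷ p) q = trans (addPoly-sound (mulTerm m c q) (mulPoly p q))
      (trans (cong₂ _+_ (mulTerm-sound m c q) (mulPoly-sound p q))
        (sym (ℕₚ.*-distribʳ-+ (⟦ q ⟧ᵖ ρ) (c * ⟦ m ⟧ᵐ ρ) (⟦ p ⟧ᵖ ρ))))

    norm-sound : ∀ e → ⟦ norm e ⟧ᵖ ρ ≡ ⟦ e ⟧ ρ
    norm-sound (var i) = trans (ℕₚ.+-identityʳ _) (trans (ℕₚ.+-identityʳ _) (ℕₚ.*-identityʳ _))
    norm-sound (# c) = trans (insertTerm-sound [] c []) (trans (ℕₚ.+-identityʳ _) (ℕₚ.*-identityʳ c))
    norm-sound (e :+ f) = trans (addPoly-sound (norm e) (norm f)) (cong₂ _+_ (norm-sound e) (norm-sound f))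
    norm-sound (e :* f) = trans (mulPoly-sound (norm e) (norm f)) (cong₂ _*_ (norm-sound e) (norm-sound f))

  Ineq : Set
  Ineq = Expr k × Expr k

  holds : Ineq → Vec ℕ k → Set
  holds (l , r) ρ = ⟦ l ⟧ ρ ≤ ⟦ r ⟧ ρ

  ineqs : List (Formula k) → List Ineq
  ineqs [] = []
  ineqs ((e :≤ f) ∷ hs) = (e , f) ∷ ineqs hs
  ineqs ((e :< f) ∷ hs) = (# 1 :+ e , f) ∷ ineqs hs
  ineqs ((e :≡ f) ∷ hs) = (e , f) ∷ (f , e) ∷ ineqs hs
  ineqs (absurd ∷ hs) = (# 1 , # 0) ∷ ineqs hs

  data All≤ (ρ : Vec ℕ k) : List Ineq → Set where
    [] : All≤ ρ []
    _∷_ : ∀ {h hs} → holds h ρ → All≤ ρ hs → All≤ ρ (h ∷ hs)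

  combine : List Ineq → List ℕ → Ineq
  combine ((l , r) ∷ hs) (c ∷ cs) with combine hs cs
  ... | L , R = # c :* l :+ L , # c :* r :+ R
  combine _ _ = # 0 , # 0

  combine-sound : ∀ {ρ hs} cs → All≤ ρ hs → holds (combine hs cs) ρ
  combine-sound [] [] = z≤n
  combine-sound (_ ∷ _) [] = z≤n
  combine-sound [] (_ ∷ _) = z≤n
  combine-sound (c ∷ cs) (h ∷ hs) = ℕₚ.+-mono-≤ (ℕₚ.*-monoʳ-≤ c h) (combine-sound cs hs)

  polyExpr : Poly → Expr k
  polyExpr [] = # 0
  polyExpr ((m , c) ∷ p) = # c :* foldr (λ i e → var i :* e) (# 1) m :+ polyExpr p

  -- A Farkas certificate: the multiplier of the negated goal, those of the
  -- hypotheses, and the nonnegative polynomial left over.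
  Certificate : Set
  Certificate = ℕ × List ℕ × Poly

  -- The combined hypotheses and μ times the negated goal `1 + b ≤ a` add up to left ≤ right, while
  -- the identity of normal forms makes the left side exceed the right by the leftover polynomial
  -- plus 1.
  Refutes : List Ineq → Ineq → Certificate → Set
  Refutes hs (a , b) (μ , cs , s) with combine hs cs
  ... | L , R = norm (L :+ # μ :* (# 1 :+ b)) ≡ norm (R :+ # μ :* a :+ polyExpr s :+ # 1)

  refutes-sound : ∀ ρ hs g w → Refutes hs g w → All≤ ρ hs → holds g ρ
  refutes-sound ρ hs (a , b) (μ , cs , s) eq all
    with combine hs cs | combine-sound cs all | ⟦ a ⟧ ρ ℕₚ.≤? ⟦ b ⟧ ρ
  ... | L , R | L≤R | yes a≤b = a≤b
  ... | L , R | L≤R | no a≰b = ⊥-elim (ℕₚ.1+n≰n {⟦ R ⟧ ρ + μ * ⟦ a ⟧ ρ} (begin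
    1 + (⟦ R ⟧ ρ + μ * ⟦ a ⟧ ρ)                             ≡⟨ ℕₚ.+-comm 1 _ ⟩
    ⟦ R ⟧ ρ + μ * ⟦ a ⟧ ρ + 1                               ≤⟨ ℕₚ.+-monoˡ-≤ 1 (ℕₚ.m≤m+n _ _) ⟩
    ⟦ R ⟧ ρ + μ * ⟦ a ⟧ ρ + ⟦ polyExpr s ⟧ ρ + 1            ≡⟨ norm-sound ρ (R :+ # μ :* a :+ polyExpr s :+ # 1) ⟨
    ⟦ norm (R :+ # μ :* a :+ polyExpr s :+ # 1) ⟧ᵖ ρ        ≡⟨ cong (λ p → ⟦ p ⟧ᵖ ρ) eq ⟨
    ⟦ norm (L :+ # μ :* (# 1 :+ b)) ⟧ᵖ ρ                    ≡⟨ norm-sound ρ (L :+ # μ :* (# 1 :+ b)) ⟩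
    ⟦ L ⟧ ρ + μ * (1 + ⟦ b ⟧ ρ)                             ≤⟨ ℕₚ.+-mono-≤ L≤R (ℕₚ.*-monoʳ-≤ μ (ℕₚ.≰⇒> a≰b)) ⟩
    ⟦ R ⟧ ρ + μ * ⟦ a ⟧ ρ                                   ∎))
    where open ℕₚ.≤-Reasoning

-- Fourier–Motzkin elimination: a row lists the coefficients of the monomials,
-- the constant, and the multipliers of the original rows; it stands for the
-- assertion that coefficients and constant add up to a value ≤ 0.

Row : Set
Row = List ℤ

entry : ℕ → Row → ℤ
entry _ [] = pos 0
entry zero (x ∷ _) = x
entry (suc i) (_ ∷ r) = entry i r

gcdFuel : ℕ → ℕ → ℕ → ℕ
gcdFuel zero a b = a
gcdFuel (suc f) a zero = a
gcdFuel (suc f) a (suc b) = gcdFuel f (suc b) (a % suc b)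

divExact : ℕ → ℤ → ℤ
divExact zero x = x
divExact (suc d) (pos a) = pos (a / suc d)
divExact (suc d) -[1+ a ] = ℤ.- pos (suc a / suc d)

-- Keeps the coefficients small. Should the fuel for the gcd run out, the resulting certificate is
-- merely rejected by the final check.
reduceRow : Row → Row
reduceRow r = map (divExact (foldr (λ x g → gcdFuel 60 g ℤ.∣ x ∣) 0 r)) r

positive negative : ℤ → Bool
positive (pos zero) = false
positive (pos (suc _)) = true
positive -[1+ _ ] = false
negative (pos _) = false
negative -[1+ _ ] = true

addScaled : ℤ → Row → ℤ → Row → Row
addScaled c (x ∷ r) d (y ∷ s) = (c ℤ.* x ℤ.+ d ℤ.* y) ∷ addScaled c r d s
addScaled _ _ _ _ = []

support : ℕ → Row → ℕ
support zero r = length (filterᵇ positive r)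
support (suc i) [] = 0
support (suc i) (_ ∷ r) = support i r

-- By Chernikov's rule a row combining more than k + 1 original rows is
-- redundant after k eliminations.
eliminate : ℕ → ℕ → ℕ → List Row → List Row
eliminate width done i rows =
  filterᵇ (λ r → support width r ≤ᵇ (2 + done))
    (filterᵇ (λ r → not (positive (entry i r) ∨ negative (entry i r))) rows
      ++ concatMap (λ p → map (λ n → reduceRow (addScaled (ℤ.- entry i n) p (entry i p) n))
           (filterᵇ (negative ∘ entry i) rows)) (filterᵇ (positive ∘ entry i) rows))

cost : List Row → ℕ → ℕ
cost rows i = length (filterᵇ (positive ∘ entry i) rows) * length (filterᵇ (negative ∘ entry i) rows)

extractMin : (ℕ → ℕ) → List ℕ → Maybe (ℕ × List ℕ)
extractMin f [] = nothing
extractMin f (x ∷ xs) with extractMin f xs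
... | nothing = just (x , [])
... | just (y , ys) = if f x <ᵇ f y then just (x , xs) else just (y , x ∷ ys)

contradictory : ℕ → List Row → Maybe Row
contradictory c rows with filterᵇ (positive ∘ entry c) rows
... | [] = nothing
... | r ∷ _ = just r

eliminateAll : ℕ → ℕ → ℕ → List ℕ → List Row → List Row
eliminateAll zero _ _ _ rows = rows
eliminateAll (suc f) width done vars rows with extractMin (cost rows) vars
... | nothing = rows
... | just (i , rest) = eliminateAll f width (suc done) rest (eliminate width done i rows)

unit : ℕ → ℕ → List ℤ
unit width i = map (λ j → if i ≡ᵇ j then pos 1 else pos 0) (upTo width)

coefficient : ∀ {k} → Mono {k} → Poly {k} → ℕ
coefficient m [] = 0
coefficient m ((l , c) ∷ p) = if does (m ≟ᵐ l) then c else coefficient m p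

monomials : ∀ {k} → Poly {k} → List (Mono {k})
monomials = concatMap (λ where ([] , _) → []
                               (m@(_ ∷ _) , _) → m ∷ [])

toℕs : List ℤ → List ℕ
toℕs = map ℤ.∣_∣

-- Nothing is proved about the search. `Checks` compares the normal forms for whatever certificate
-- it returns, so a faulty search could only make a call of `linear` fail to type-check.
search : ∀ {k} → List (Ineq {k}) → Ineq {k} → Certificate {k}
search {k} hs (a , b) = certificate (contradictory A (eliminateAll A (suc A) 0 (upTo A) rows))
  where
  all : List (Expr k × Expr k)
  all = (# 1 :+ b , a) ∷ hs
  polys : List (Poly {k} × Poly {k})
  polys = map (λ (l , r) → norm l , norm r) all
  ms : List (Mono {k})
  ms = map proj₁ (foldr (λ m p → insertTerm m 1 p) [] (concatMap (λ (l , r) → monomials l ++ monomials r) polys))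
  A width : ℕ
  A = length ms
  width = length all + A
  rows : List Row
  rows = List.zipWith (λ i (l , r) → map (λ m → pos (coefficient m l) ℤ.- pos (coefficient m r)) (ms ++ [] ∷ []) ++ unit width i)
           (upTo (length all)) polys
    -- Monomials take natural values, so each contributes a row -m ≤ 0.
    ++ map (λ i → map ℤ.-_ (unit (suc A) i) ++ unit width (length all + i)) (upTo A)
  certificate : Maybe Row → Certificate {k}
  certificate nothing = 0 , [] , []
  certificate (just r) with toℕs (List.drop (suc A) r)
  ... | [] = 0 , [] , []
  -- The multipliers of the rows -m ≤ 0 become the leftover polynomial. The positive constant of the
  -- contradictory row enters it less 1, because the identity to be checked already contains `# 1`.
  ... | μ ∷ cs = μ , cs , List.zip ms (List.drop (length hs) cs) ++ ([] , ℤ.∣ entry A r ∣ ∸ 1) ∷ []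

_≟ᵖ_ : ∀ {k} (p q : Poly {k}) → Dec (p ≡ q)
_≟ᵖ_ = Listₚ.≡-dec (Productₚ.≡-dec _≟ᵐ_ ℕₚ._≟_)

Checks : ∀ {k} → List (Ineq {k}) → Ineq {k} → Set
Checks hs (a , b) with search hs (a , b)
... | μ , cs , s with combine hs cs
...   | L , R = True (norm (L :+ # μ :* (# 1 :+ b)) ≟ᵖ norm (R :+ # μ :* a :+ polyExpr s :+ # 1))

checks-sound : ∀ {k} ρ (hs : List (Ineq {k})) g → Checks hs g → All≤ ρ hs → holds g ρ
checks-sound ρ hs (a , b) ok all with search hs (a , b)
... | w@(μ , cs , s) = refutes-sound ρ hs (a , b) w (toWitness ok) all

Checksᶠ : ∀ {k} → List (Formula k) → Formula k → Set
Checksᶠ hs (e :≤ f) = Checks (ineqs hs) (e , f)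
Checksᶠ hs (e :< f) = Checks (ineqs hs) (# 1 :+ e , f)
Checksᶠ hs (e :≡ f) = Checks (ineqs hs) (e , f) × Checks (ineqs hs) (f , e)
Checksᶠ hs absurd = Checks (ineqs hs) (# 1 , # 0)

checksᶠ-sound : ∀ {k} ρ (hs : List (Formula k)) g → Checksᶠ hs g → All≤ ρ (ineqs hs) → ⟦ g ⟧ᶠ ρ
checksᶠ-sound ρ hs (e :≤ f) ok all = checks-sound ρ (ineqs hs) (e , f) ok all
checksᶠ-sound ρ hs (e :< f) ok all = checks-sound ρ (ineqs hs) (# 1 :+ e , f) ok all
checksᶠ-sound ρ hs (e :≡ f) (ok , ok′) all =
  ℕₚ.≤-antisym (checks-sound ρ (ineqs hs) (e , f) ok all) (checks-sound ρ (ineqs hs) (f , e) ok′ all)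
checksᶠ-sound ρ hs absurd ok all = case checks-sound ρ (ineqs hs) (# 1 , # 0) ok all of λ ()

introduce : ∀ {k} ρ (hs : List (Formula k)) {A : Vec ℕ k → Set} → (All≤ ρ (ineqs hs) → A ρ) → (hs ⇒ A) ρ
introduce ρ [] k = k []
introduce ρ ((e :≤ f) ∷ hs) k p = introduce ρ hs λ all → k (p ∷ all)
introduce ρ ((e :< f) ∷ hs) k p = introduce ρ hs λ all → k (p ∷ all)
introduce ρ ((e :≡ f) ∷ hs) k p = introduce ρ hs λ all → k (ℕₚ.≤-reflexive p ∷ ℕₚ.≤-reflexive (sym p) ∷ all)
introduce ρ (absurd ∷ hs) k ()

vars : ∀ k → Vec (Expr k) k
vars k = Vec.tabulate var

-- Monomials are atoms: an equation among the hypotheses is not substituted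
-- into products.
abstract
  linear : ∀ k (f : N-ary k (Expr k) (Sequent k)) → let s = f $ⁿ vars k in
    {_ : Checksᶠ (Sequent.hyps s) (Sequent.goal s)} → ∀ ρ → (Sequent.hyps s ⇒ ⟦ Sequent.goal s ⟧ᶠ) ρ
  linear k f {ok} ρ = introduce ρ hyps {⟦ goal ⟧ᶠ} (checksᶠ-sound ρ hyps goal ok)
    where open Sequent (f $ⁿ vars k)

-- Finite sums and cardinalities

tautology : ∀ k → N-ary k Bool Bool → Bool
tautology zero b = b
tautology (suc k) f = tautology k (f true) ∧ tautology k (f false)

∧-T : ∀ {a b} → T (a ∧ b) → T a × T b
∧-T {true} t = tt , t

apply : ∀ {A B : Set} k → N-ary k A B → Vec A k → B
apply zero b [] = b
apply (suc k) f (x ∷ xs) = apply k (f x) xs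

tautology-sound : ∀ k (f : N-ary k Bool Bool) → T (tautology k f) → (bs : Vec Bool k) → T (apply k f bs)
tautology-sound zero f t [] = t
tautology-sound (suc k) f t (true ∷ bs) = tautology-sound k (f true) (proj₁ (∧-T t)) bs
tautology-sound (suc k) f t (false ∷ bs) = tautology-sound k (f false) (proj₂ (∧-T {tautology k (f true)} t)) bs

T⇒≡ : ∀ {b} → T b → b ≡ true
T⇒≡ {true} _ = refl

lift₂ : ∀ {A B C : Set} k → (A → B → C) → N-ary k Bool A → N-ary k Bool B → N-ary k Bool C
lift₂ zero _∙_ a b = a ∙ b
lift₂ (suc k) _∙_ f g x = lift₂ k _∙_ (f x) (g x)

lift₂-$ : ∀ {A B C : Set} k (_∙_ : A → B → C) (f : N-ary k Bool A) (g : N-ary k Bool B) (bs : Vec Bool k) →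
  apply k (lift₂ k _∙_ f g) bs ≡ (apply k f bs) ∙ (apply k g bs)
lift₂-$ zero _∙_ f g [] = refl
lift₂-$ (suc k) _∙_ f g (b ∷ bs) = lift₂-$ k _∙_ (f b) (g b) bs

_⊃_ : Bool → Bool → Bool
a ⊃ b = not a ∨ b

eqᵇ : Bool → Bool → Bool
eqᵇ a b = (a ∧ b) ∨ (not a ∧ not b)

eqᵇ-sound : ∀ {a b} → T (eqᵇ a b) → a ≡ b
eqᵇ-sound {true} {true} _ = refl
eqᵇ-sound {false} {false} _ = refl

abstract
  -- The truth table is evaluated in the type of the implicit argument, which reduces to `⊤` and is
  -- solved silently. A caller displays two functions of k bits and the bits at which they are read.
  bool≤ : ∀ k (f g : N-ary k Bool ℕ) {_ : T (tautology k (lift₂ k _≤ᵇ_ f g))} (bs : Vec Bool k) → (apply k f bs) ≤ (apply k g bs)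
  bool≤ k f g {t} bs = ℕₚ.≤ᵇ⇒≤ _ _ (subst T (lift₂-$ k _≤ᵇ_ f g bs) (tautology-sound k _ t bs))

  bool≡ : ∀ k (f g : N-ary k Bool Bool) {_ : T (tautology k (lift₂ k eqᵇ f g))} (bs : Vec Bool k) → (apply k f bs) ≡ (apply k g bs)
  bool≡ k f g {t} bs = eqᵇ-sound (subst T (lift₂-$ k eqᵇ f g bs) (tautology-sound k _ t bs))

  bool⇒ : ∀ k (f g : N-ary k Bool Bool) {_ : T (tautology k (lift₂ k _⊃_ f g))} (bs : Vec Bool k) →
    (apply k f bs) ≡ true → (apply k g bs) ≡ true
  bool⇒ k f g {t} bs eq with (apply k f bs) | subst T (lift₂-$ k _⊃_ f g bs) (tautology-sound k _ t bs)
  bool⇒ k f g bs refl | true | t = T⇒≡ t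

true≢false : true ≢ false
true≢false ()

eqᵇ-refl : ∀ b → eqᵇ b b ≡ true
eqᵇ-refl true = refl
eqᵇ-refl false = refl

not-eqᵇ : ∀ {a b} → not (eqᵇ a b) ≡ true → a ≢ b
not-eqᵇ {true} () refl
not-eqᵇ {false} () refl

≢-≢⇒≡ : ∀ {a b d : Bool} → a ≢ b → b ≢ d → a ≡ d
≢-≢⇒≡ {true} {true} h _ = ⊥-elim (h refl)
≢-≢⇒≡ {false} {false} h _ = ⊥-elim (h refl)
≢-≢⇒≡ {true} {false} {true} _ _ = refl
≢-≢⇒≡ {true} {false} {false} _ h = ⊥-elim (h refl)
≢-≢⇒≡ {false} {true} {true} _ h = ⊥-elim (h refl)
≢-≢⇒≡ {false} {true} {false} _ _ = refl

≢true : ∀ {b} → b ≢ true → b ≡ false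
≢true {true} h = ⊥-elim (h refl)
≢true {false} h = refl

≢false : ∀ {b} → b ≢ false → b ≡ true
≢false {true} h = refl
≢false {false} h = ⊥-elim (h refl)

∧-left : ∀ {a b} → a ∧ b ≡ true → a ≡ true
∧-left {true} _ = refl

∧-right : ∀ {a b} → a ∧ b ≡ true → b ≡ true
∧-right {true} h = h

∧-intro : ∀ {a b} → a ≡ true → b ≡ true → a ∧ b ≡ true
∧-intro refl h = h

∨-case : ∀ {a b} → a ∨ b ≡ true → a ≡ true ⊎ b ≡ true
∨-case {true} _ = inj₁ refl
∨-case {false} h = inj₂ h

not-true : ∀ {b} → not b ≡ true → b ≡ false
not-true {false} _ = refl

bit : Bool → ℕ
bit b = if b then 1 else 0

bit-split : ∀ a b → bit (a ∧ b) + bit (a ∧ not b) ≡ bit a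
bit-split false b = refl
bit-split true false = refl
bit-split true true = refl

module _ {n : ℕ} where

  ==-refl : (v : Fin n) → (v == v) ≡ true
  ==-refl v with v Finₚ.≟ v
  ... | yes _ = refl
  ... | no h = ⊥-elim (h refl)

  ==⇒≡ : {i v : Fin n} → (i == v) ≡ true → i ≡ v
  ==⇒≡ {i} {v} h with i Finₚ.≟ v
  ... | yes e = e

  ≢⇒== : {i v : Fin n} → i ≢ v → (i == v) ≡ false
  ≢⇒== {i} {v} h with i Finₚ.≟ v
  ... | yes e = ⊥-elim (h e)
  ... | no _ = refl

  ==⇒≢ : {i v : Fin n} → (i == v) ≡ false → i ≢ v
  ==⇒≢ {i} {v} h with i Finₚ.≟ v
  ... | no ne = ne

  ==-sym : (i v : Fin n) → (i == v) ≡ (v == i)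
  ==-sym i v with i Finₚ.≟ v
  ... | yes refl = sym (==-refl v)
  ... | no ne = sym (≢⇒== (ne ∘ sym))

-- Sums over `Fin n`, and vertex sets as Boolean predicates

∑ : ∀ {n} → (Fin n → ℕ) → ℕ
∑ {n} f = sum (map f (allFin n))

∑-suc : ∀ {n} (f : Fin (suc n) → ℕ) → ∑ f ≡ f zero + ∑ (f ∘ suc)
∑-suc f = cong (λ l → f zero + sum l) (trans (Listₚ.map-tabulate suc f) (sym (Listₚ.map-tabulate id (f ∘ suc))))

∑-cong : ∀ {n} {f g : Fin n → ℕ} → (∀ i → f i ≡ g i) → ∑ f ≡ ∑ g
∑-cong {n} h = cong sum (Listₚ.map-cong h (allFin n))

∑-mono : ∀ {n} {f g : Fin n → ℕ} → (∀ i → f i ≤ g i) → ∑ f ≤ ∑ g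
∑-mono {zero} h = z≤n
∑-mono {suc n} {f} {g} h = subst₂ _≤_ (sym (∑-suc f)) (sym (∑-suc g)) (ℕₚ.+-mono-≤ (h zero) (∑-mono (h ∘ suc)))

∑-+ : ∀ {n} (f g : Fin n → ℕ) → ∑ (λ i → f i + g i) ≡ ∑ f + ∑ g
∑-+ {zero} f g = refl
∑-+ {suc n} f g = trans (∑-suc (λ i → f i + g i)) (trans (cong (λ z → f zero + g zero + z) (∑-+ (f ∘ suc) (g ∘ suc)))
  (trans (linear 4 (λ a b c d → [] ⊢ a :+ b :+ (c :+ d) :≡ (a :+ c) :+ (b :+ d)) (f zero ∷ g zero ∷ ∑ (f ∘ suc) ∷ ∑ (g ∘ suc) ∷ []))
    (sym (cong₂ _+_ (∑-suc f) (∑-suc g)))))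

∑-zero : ∀ n → ∑ {n} (λ _ → 0) ≡ 0
∑-zero zero = refl
∑-zero (suc n) = trans (∑-suc {n} (λ _ → 0)) (∑-zero n)

∑-one : ∀ n → ∑ {n} (λ _ → 1) ≡ n
∑-one zero = refl
∑-one (suc n) = trans (∑-suc {n} (λ _ → 1)) (cong suc (∑-one n))

∑-comm : ∀ {m n} (f : Fin m → Fin n → ℕ) → ∑ (λ i → ∑ (λ j → f i j)) ≡ ∑ (λ j → ∑ (λ i → f i j))
∑-comm {zero} {n} f = sym (∑-zero n)
∑-comm {suc m} f = trans (∑-suc (λ i → ∑ (f i))) (trans (cong (λ z → ∑ (f zero) + z) (∑-comm (f ∘ suc)))
  (trans (sym (∑-+ (f zero) (λ j → ∑ (λ i → f (suc i) j)))) (∑-cong (λ j → sym (∑-suc (λ i → f i j))))))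

∑-* : ∀ {n} c (f : Fin n → ℕ) → ∑ (λ i → c * f i) ≡ c * ∑ f
∑-* {zero} c f = sym (ℕₚ.*-zeroʳ c)
∑-* {suc n} c f = trans (∑-suc (λ i → c * f i)) (trans (cong (λ z → c * f zero + z) (∑-* c (f ∘ suc)))
  (trans (sym (ℕₚ.*-distribˡ-+ c (f zero) _)) (cong (c *_) (sym (∑-suc f)))))

∑-at : ∀ {n} (v : Fin n) (f : Fin n → ℕ) → ∑ (λ i → if i == v then f i else 0) ≡ f v
∑-at {suc n} zero f = trans (∑-suc (λ i → if i == zero then f i else 0)) (trans (cong (λ z → f zero + z) (∑-zero n)) (ℕₚ.+-identityʳ _))
∑-at {suc n} (suc v) f = trans (∑-suc (λ i → if i == suc v then f i else 0)) (∑-at v (f ∘ suc))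

-- Termwise domination with no gain in the total leaves no slack in any term. This turns an extremal
-- edge count into an exact list of the missing edges.
∑-pointwise : ∀ {n} {f g : Fin n → ℕ} → (∀ i → f i ≤ g i) → ∑ g ≤ ∑ f → ∀ i → f i ≡ g i
∑-pointwise {suc n} {f} {g} h le i = aux (subst₂ _≤_ (∑-suc g) (∑-suc f) le) i
  where
  aux : g zero + ∑ (g ∘ suc) ≤ f zero + ∑ (f ∘ suc) → ∀ i → f i ≡ g i
  aux le zero = linear 4 (λ a b c d → a :+ b :≤ c :+ d ∷ c :≤ a ∷ d :≤ b ∷ [] ⊢ c :≡ a)
    (g zero ∷ ∑ (g ∘ suc) ∷ f zero ∷ ∑ (f ∘ suc) ∷ []) le (h zero) (∑-mono (h ∘ suc))
  aux le (suc i) = ∑-pointwise (h ∘ suc) (linear 4 (λ a b c d → a :+ b :≤ c :+ d ∷ c :≤ a ∷ [] ⊢ b :≤ d)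
    (g zero ∷ ∑ (g ∘ suc) ∷ f zero ∷ ∑ (f ∘ suc) ∷ []) le (h zero)) i

∑∑-pointwise : ∀ {m n} {f g : Fin m → Fin n → ℕ} → (∀ i j → f i j ≤ g i j) →
  ∑ (λ i → ∑ (g i)) ≤ ∑ (λ i → ∑ (f i)) → ∀ i j → f i j ≡ g i j
∑∑-pointwise h le i = ∑-pointwise (h i) (ℕₚ.≤-reflexive (sym (∑-pointwise (λ i → ∑-mono (h i)) le i)))

Pred : ℕ → Set
Pred n = Fin n → Bool

infixl 6 _∖_
_∖_ : ∀ {n} → Pred n → Fin n → Pred n
(p ∖ v) i = p i ∧ not (i == v)

all : ∀ {n} → Pred n
all _ = true

module _ {n : ℕ} where

  card-cong : {p q : Pred n} → (∀ i → p i ≡ q i) → card p ≡ card q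
  card-cong h = ∑-cong (λ i → cong bit (h i))

  bit-mono : ∀ {a b} → (a ≡ true → b ≡ true) → bit a ≤ bit b
  bit-mono {false} h = z≤n
  bit-mono {true} h = ℕₚ.≤-reflexive (cong bit (sym (h refl)))

  card-mono : {p q : Pred n} → (∀ i → p i ≡ true → q i ≡ true) → card p ≤ card q
  card-mono h = ∑-mono (λ i → bit-mono (h i))

  card-all : card (all {n}) ≡ n
  card-all = ∑-one n

  bits : List (Pred n) → Fin n → ℕ
  bits [] i = 0
  bits (p ∷ []) i = bit (p i)
  bits (p ∷ ps@(_ ∷ _)) i = bit (p i) + bits ps i

  cards : List (Pred n) → ℕ
  cards [] = 0
  cards (p ∷ []) = card p
  cards (p ∷ ps@(_ ∷ _)) = card p + cards ps

  ∑-bits : ∀ ps → ∑ (bits ps) ≡ cards ps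
  ∑-bits [] = ∑-zero n
  ∑-bits (p ∷ []) = refl
  ∑-bits (p ∷ ps@(_ ∷ _)) = trans (∑-+ (bit ∘ p) (bits ps)) (cong (λ z → card p + z) (∑-bits ps))

  cards≤ : ∀ ps qs → (∀ i → bits ps i ≤ bits qs i) → cards ps ≤ cards qs
  cards≤ ps qs h = subst₂ _≤_ (∑-bits ps) (∑-bits qs) (∑-mono h)

  cards≡ : ∀ ps qs → (∀ i → bits ps i ≡ bits qs i) → cards ps ≡ cards qs
  cards≡ ps qs h = trans (sym (∑-bits ps)) (trans (∑-cong h) (∑-bits qs))

  ∖-intro : (p : Pred n) {v i : Fin n} → p i ≡ true → i ≢ v → (p ∖ v) i ≡ true
  ∖-intro p {v} {i} pi ne rewrite pi | ≢⇒== ne = refl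

  ∖-elim : (p : Pred n) {v i : Fin n} → (p ∖ v) i ≡ true → i ≢ v
  ∖-elim p {v} {i} h = ==⇒≢ (not-true (∧-right {p i} h))

  ∖-absent : (p : Pred n) {v : Fin n} → p v ≡ false → ∀ i → (p ∖ v) i ≡ p i
  ∖-absent p {v} pv i with i Finₚ.≟ v
  ... | yes refl rewrite pv = refl
  ... | no _ = Boolₚ.∧-identityʳ (p i)

  card-∖ : (p : Pred n) (v : Fin n) → p v ≡ true → card p ≡ suc (card (p ∖ v))
  card-∖ p v pv = trans (∑-cong pt) (trans (∑-+ (λ i → if i == v then 1 else 0) (bit ∘ (p ∖ v)))
      (cong (_+ card (p ∖ v)) (∑-at v (λ _ → 1))))
    where
    pt : ∀ i → bit (p i) ≡ (if i == v then 1 else 0) + bit ((p ∖ v) i)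
    pt i with i Finₚ.≟ v
    ... | yes refl rewrite pv = refl
    ... | no _ = cong bit (sym (Boolₚ.∧-identityʳ (p i)))

  card-∖≤ : (p : Pred n) (v : Fin n) → card p ≤ suc (card (p ∖ v))
  card-∖≤ p v with p v Boolₚ.≟ true
  ... | yes pv = ℕₚ.≤-reflexive (card-∖ p v pv)
  ... | no npv = ℕₚ.≤-trans (ℕₚ.≤-reflexive (card-cong (λ i → sym (∖-absent p (≢true npv) i)))) (ℕₚ.n≤1+n _)

  search-pred : (p : Pred n) → (∃[ i ] p i ≡ true) ⊎ (∀ i → p i ≡ false)
  search-pred p with Finₚ.any? (λ i → p i Boolₚ.≟ true)
  ... | yes h = inj₁ h
  ... | no h = inj₂ (λ i → ≢true (λ e → h (i , e)))

  card-empty : {p : Pred n} → (∀ i → p i ≡ false) → card p ≡ 0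
  card-empty h = trans (∑-cong (λ i → cong bit (h i))) (∑-zero n)

  card-pos⁻¹ : (p : Pred n) → 0 < card p → ∃[ i ] p i ≡ true
  card-pos⁻¹ p h with search-pred p
  ... | inj₁ w = w
  ... | inj₂ none = ⊥-elim (ℕₚ.<-irrefl (sym (card-empty none)) h)

  card-pos : (p : Pred n) {v : Fin n} → p v ≡ true → 0 < card p
  card-pos p {v} pv = subst (0 <_) (sym (card-∖ p v pv)) (s≤s z≤n)

  card-0 : (p : Pred n) → card p ≡ 0 → ∀ i → p i ≡ false
  card-0 p eq i = ≢true (λ pi → ℕₚ.<-irrefl (sym eq) (card-pos p pi))

  -- Each forbidden vertex lowers the cardinality by at most one. Every fresh vertex of every path
  -- comes from here.
  pick : (F : List (Fin n)) (p : Pred n) → length F < card p → ∃[ i ] p i ≡ true × i ∉ F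
  pick [] p h with card-pos⁻¹ p h
  ... | i , pi = i , pi , λ ()
  pick (v ∷ F) p h with pick F (p ∖ v) (ℕₚ.≤-pred (ℕₚ.≤-trans h (card-∖≤ p v)))
  ... | i , pi , i∉F = i , ∧-left pi , λ where
    (here e) → ∖-elim p pi e
    (there m) → i∉F m

  card≤1-unique : (p : Pred n) → card p ≤ 1 → ∀ {i j} → p i ≡ true → p j ≡ true → i ≡ j
  card≤1-unique p le {i} {j} pi pj with i Finₚ.≟ j
  ... | yes e = e
  ... | no ne = ⊥-elim (ℕₚ.<⇒≱ (s≤s (card-pos (p ∖ i) (∖-intro p pj (ne ∘ sym)))) (subst (_≤ 1) (card-∖ p i pi) le))

  card-single : (v : Fin n) → card (_== v) ≡ 1
  card-single v = ∑-at v (λ _ → 1)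

-- Degrees and edge counts

module Counting {n : ℕ} (G : Graph n) where

  _~_ : Fin n → Fin n → Set
  u ~ v = adj G u v ≡ true

  ~-sym : ∀ {u v} → u ~ v → v ~ u
  ~-sym {u} {v} e = trans (adj-sym G v u) e

  ~⇒≢ : ∀ {u v} → u ~ v → u ≢ v
  ~⇒≢ {u} e refl = true≢false (trans (sym e) (adj-irrefl G u))

  deg : Pred n → Fin n → ℕ
  deg p v = card (λ j → p j ∧ adj G v j)

  common : Pred n → Fin n → Fin n → ℕ
  common p u v = card (λ j → p j ∧ (adj G u j ∧ adj G v j))

  -- Ordered pairs are counted, so this is twice the number of edges inside `p`, and
  -- `2 * E p ≤ card p * card p` is the bound 4e ≤ |p|².
  E : Pred n → ℕ
  E p = ∑ (λ i → ∑ (λ j → bit (p i ∧ (p j ∧ adj G i j))))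

  E-cong : ∀ {p q} → (∀ i → p i ≡ q i) → E p ≡ E q
  E-cong h = ∑-cong (λ i → ∑-cong (λ j → cong₂ (λ a b → bit (a ∧ (b ∧ adj G i j))) (h i) (h j)))

  deg-mono : ∀ {p q} v → (∀ i → p i ≡ true → q i ≡ true) → deg p v ≤ deg q v
  deg-mono {p} v h = card-mono (λ j e → ∧-intro (h j (∧-left e)) (∧-right {p j} e))

  E-remove : ∀ p v → p v ≡ true → E p ≡ E (p ∖ v) + 2 * deg p v
  E-remove p v pv = begin
    E p
      ≡⟨ ∑-cong (λ i → trans (∑-cong (split i)) (trans (∑-+ (a i) (λ j → b i j + c i j)) (cong (λ z → ∑ (a i) + z) (∑-+ (b i) (c i))))) ⟩
    ∑ (λ i → ∑ (a i) + (∑ (b i) + ∑ (c i)))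
      ≡⟨ trans (∑-+ (∑ ∘ a) (λ i → ∑ (b i) + ∑ (c i))) (cong (λ z → ∑ (∑ ∘ a) + z) (∑-+ (∑ ∘ b) (∑ ∘ c))) ⟩
    E (p ∖ v) + (∑ (∑ ∘ b) + ∑ (∑ ∘ c))
      ≡⟨ cong (λ z → E (p ∖ v) + z) (cong₂ _+_ eqb (trans eqc (sym (ℕₚ.+-identityʳ _)))) ⟩
    E (p ∖ v) + 2 * deg p v ∎
    where
    open ≡-Reasoning
    a b c : Fin n → Fin n → ℕ
    a i j = bit ((p ∖ v) i ∧ ((p ∖ v) j ∧ adj G i j))
    b i j = if i == v then bit (p j ∧ adj G v j) else 0
    c i j = if j == v then bit (p i ∧ adj G v i) else 0
    split : ∀ i j → bit (p i ∧ (p j ∧ adj G i j)) ≡ a i j + (b i j + c i j)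
    split i j with i Finₚ.≟ v | j Finₚ.≟ v
    ... | yes refl | yes refl rewrite pv | adj-irrefl G v = refl
    ... | yes refl | no _ rewrite pv = sym (ℕₚ.+-identityʳ _)
    ... | no _ | yes refl rewrite pv | Boolₚ.∧-identityʳ (p i) | Boolₚ.∧-zeroʳ (p i) | adj-sym G i v = refl
    ... | no _ | no _ rewrite Boolₚ.∧-identityʳ (p i) | Boolₚ.∧-identityʳ (p j) = sym (ℕₚ.+-identityʳ _)
    eqb : ∑ (∑ ∘ b) ≡ deg p v
    eqb = trans (∑-cong pull) (∑-at v (λ _ → deg p v))
      where
      pull : ∀ i → ∑ (b i) ≡ (if i == v then deg p v else 0)
      pull i with i == v
      ... | true = refl
      ... | false = ∑-zero n
    eqc : ∑ (∑ ∘ c) ≡ deg p v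
    eqc = ∑-cong (λ i → ∑-at v (λ _ → bit (p i ∧ adj G v i)))

  E-remove≤ : ∀ p v → E p ≤ E (p ∖ v) + 2 * deg all v
  E-remove≤ p v with p v Boolₚ.≟ true
  ... | yes pv = ℕₚ.≤-trans (ℕₚ.≤-reflexive (E-remove p v pv))
    (ℕₚ.+-monoʳ-≤ (E (p ∖ v)) (ℕₚ.*-monoʳ-≤ 2 (deg-mono v (λ _ _ → refl))))
  ... | no npv = ℕₚ.≤-trans (ℕₚ.≤-reflexive (E-cong (λ i → sym (∖-absent p (≢true npv) i)))) (ℕₚ.m≤m+n _ _)

  E-trivial : ∀ p → E p ≤ card p * card p
  E-trivial p = ℕₚ.≤-trans (∑-mono (λ i → ℕₚ.≤-trans (∑-mono (λ j → bool≤ 3 (λ x y z → bit (x ∧ (y ∧ z))) (λ x y z → bit x * bit y) (p i ∷ p j ∷ adj G i j ∷ [])))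
      (ℕₚ.≤-reflexive (∑-* (bit (p i)) (bit ∘ p)))))
    (ℕₚ.≤-reflexive (trans (∑-cong (λ i → ℕₚ.*-comm (bit (p i)) (card p))) (∑-* (card p) (bit ∘ p))))

  E-all : E all ≡ 2 * edges G
  E-all = begin
    E all                                              ≡⟨ ∑-cong (λ i → trans (∑-cong (split i)) (∑-+ (a i) (λ j → a j i))) ⟩
    ∑ (λ i → ∑ (a i) + ∑ (λ j → a j i))                ≡⟨ ∑-+ (∑ ∘ a) (λ i → ∑ (λ j → a j i)) ⟩
    edges G + ∑ (λ i → ∑ (λ j → a j i))                ≡⟨ cong (λ z → edges G + z) (∑-comm (λ i j → a j i)) ⟩
    edges G + edges G                                  ≡⟨ cong (λ z → edges G + z) (sym (ℕₚ.+-identityʳ _)) ⟩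
    2 * edges G                                        ∎
    where
    open ≡-Reasoning
    a : Fin n → Fin n → ℕ
    a i j = bit ((toℕ i <ᵇ toℕ j) ∧ adj G i j)
    lt : ∀ {x y} → x < y → (x <ᵇ y) ≡ true
    lt h = T⇒≡ (ℕₚ.<⇒<ᵇ h)
    nlt : ∀ {x y} → ¬ x < y → (x <ᵇ y) ≡ false
    nlt {x} {y} h = ≢true (λ e → h (ℕₚ.<ᵇ⇒< x y (subst T (sym e) tt)))
    split : ∀ i j → bit (adj G i j) ≡ a i j + a j i
    split i j with ℕₚ.<-cmp (toℕ i) (toℕ j)
    ... | tri< l _ g rewrite lt l | nlt g = sym (ℕₚ.+-identityʳ _)
    ... | tri> g _ l rewrite lt l | nlt g = cong bit (adj-sym G i j)
    ... | tri≈ _ e _ with Finₚ.toℕ-injective e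
    ...   | refl rewrite adj-irrefl G i | Boolₚ.∧-zeroʳ (toℕ i <ᵇ toℕ i) = refl

  cross : Pred n → Pred n → ℕ
  cross A B = ∑ (λ i → ∑ (λ j → bit (A i ∧ (B j ∧ adj G i j))))

  missing : Pred n → Pred n → ℕ
  missing A B = ∑ (λ i → ∑ (λ j → bit (A i ∧ (B j ∧ not (adj G i j)))))

  ∑∑-product : (A B : Pred n) → ∑ (λ i → ∑ (λ j → bit (A i ∧ B j))) ≡ card A * card B
  ∑∑-product A B = trans (∑-cong (λ i → trans (∑-cong (λ j → bit-∧ (A i) (B j))) (∑-* (bit (A i)) (bit ∘ B))))
    (trans (∑-cong (λ i → ℕₚ.*-comm (bit (A i)) (card B))) (trans (∑-* (card B) (bit ∘ A)) (ℕₚ.*-comm (card B) (card A))))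
    where
    bit-∧ : ∀ a b → bit (a ∧ b) ≡ bit a * bit b
    bit-∧ true b = sym (ℕₚ.+-identityʳ _)
    bit-∧ false b = refl

  cross+missing : ∀ A B → cross A B + missing A B ≡ card A * card B
  cross+missing A B = trans (sym (∑-+ (∑ ∘ a) (∑ ∘ b)))
    (trans (∑-cong (λ i → trans (sym (∑-+ (a i) (b i))) (∑-cong (λ j → pt (A i) (B j) (adj G i j))))) (∑∑-product A B))
    where
    a b : Fin n → Fin n → ℕ
    a i j = bit (A i ∧ (B j ∧ adj G i j))
    b i j = bit (A i ∧ (B j ∧ not (adj G i j)))
    pt : ∀ x y z → bit (x ∧ (y ∧ z)) + bit (x ∧ (y ∧ not z)) ≡ bit (x ∧ y)
    pt false y z = refl
    pt true false z = refl
    pt true true false = refl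
    pt true true true = refl

  E-bipartite : ∀ p (c : Fin n → Bool) → (∀ i j → p i ≡ true → p j ≡ true → i ~ j → c i ≢ c j) →
    E p ≡ 2 * cross (λ i → p i ∧ c i) (λ i → p i ∧ not (c i))
  E-bipartite p c ok = trans (∑-cong (λ i → trans (∑-cong (pt i)) (∑-+ (a i) (λ j → a j i))))
    (trans (∑-+ (∑ ∘ a) (λ i → ∑ (λ j → a j i))) (cong (λ z → ∑ (∑ ∘ a) + z) (trans (∑-comm (λ i j → a j i)) (sym (ℕₚ.+-identityʳ _)))))
    where
    a : Fin n → Fin n → ℕ
    a i j = bit ((p i ∧ c i) ∧ ((p j ∧ not (c j)) ∧ adj G i j))
    pt : ∀ i j → bit (p i ∧ (p j ∧ adj G i j)) ≡ a i j + a j i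
    pt i j rewrite adj-sym G j i with p i in pi | p j in pj | adj G i j in e
    ... | false | false | _ = refl
    ... | false | true | _ rewrite Boolₚ.∧-zeroʳ (c j) = refl
    ... | true | false | _ rewrite Boolₚ.∧-zeroʳ (c i) = refl
    ... | true | true | false rewrite Boolₚ.∧-zeroʳ (not (c i)) | Boolₚ.∧-zeroʳ (not (c j)) | Boolₚ.∧-zeroʳ (c i) | Boolₚ.∧-zeroʳ (c j) = refl
    ... | true | true | true with c i in ci | c j in cj
    ...   | true | false = refl
    ...   | false | true = refl
    ...   | true | true = ⊥-elim (ok i j pi pj e (trans ci (sym cj)))
    ...   | false | false = ⊥-elim (ok i j pi pj e (trans ci (sym cj)))

-- Paths and theta graphs

module Paths {n : ℕ} (G : Graph n) where
  open Counting G

  -- The list holds the interior vertices only, so a path has length one more than its list.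
  Link : Fin n → List (Fin n) → Fin n → Set
  Link u [] v = u ~ v
  Link u (x ∷ l) v = (u ~ x) × Link x l v

  Link-++ : ∀ {u} l {v m w} → Link u l v → Link v m w → Link u (l ++ v ∷ m) w
  Link-++ [] e k = e , k
  Link-++ (x ∷ l) (e , h) k = e , Link-++ l h k

  rev : List (Fin n) → List (Fin n)
  rev [] = []
  rev (x ∷ l) = rev l ++ x ∷ []

  length-snoc : ∀ (l : List (Fin n)) x → length (l ++ x ∷ []) ≡ suc (length l)
  length-snoc [] x = refl
  length-snoc (_ ∷ l) x = cong suc (length-snoc l x)

  length-rev : ∀ l → length (rev l) ≡ length l
  length-rev [] = refl
  length-rev (x ∷ l) = trans (length-snoc (rev l) x) (cong suc (length-rev l))

  Link-rev : ∀ {u} l {v} → Link u l v → Link v (rev l) u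
  Link-rev [] e = ~-sym e
  Link-rev (x ∷ l) (e , h) = Link-++ (rev l) (Link-rev l h) (~-sym e)

  -- The forbidden list grows along the path, so that avoidance of `F` and absence of repetitions
  -- are one condition.
  Fresh : List (Fin n) → List (Fin n) → Set
  Fresh F [] = ⊤
  Fresh F (x ∷ l) = x ∉ F × Fresh (x ∷ F) l

  Fresh-⊆ : ∀ {F F′} l → (∀ {x} → x ∈ F′ → x ∈ F) → Fresh F l → Fresh F′ l
  Fresh-⊆ [] s _ = tt
  Fresh-⊆ (x ∷ l) s (x∉ , h) = (x∉ ∘ s) , Fresh-⊆ l (λ { (here e) → here e ; (there m) → there (s m) }) h

  Fresh-snoc : ∀ {F} l {w} → Fresh (w ∷ F) l → w ∉ F → Fresh F (l ++ w ∷ [])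
  Fresh-snoc [] _ w∉ = w∉ , tt
  Fresh-snoc (x ∷ l) (x∉ , h) w∉ = (x∉ ∘ there) ,
    Fresh-snoc l (Fresh-⊆ l (λ { (here e) → there (here e) ; (there (here e)) → here e ; (there (there m)) → there (there m) }) h)
      (λ { (here e) → x∉ (here (sym e)) ; (there m) → w∉ m })

  Fresh-rev : ∀ {F} l → Fresh F l → Fresh F (rev l)
  Fresh-rev [] _ = tt
  Fresh-rev (x ∷ l) (x∉ , h) = Fresh-snoc (rev l) (Fresh-rev l h) x∉

  Fresh-∉ : ∀ {F} l {x} → Fresh F l → x ∈ F → x ∉ l
  Fresh-∉ (y ∷ l) (y∉ , h) xF (here refl) = y∉ xF
  Fresh-∉ (y ∷ l) (y∉ , h) xF (there m) = Fresh-∉ l h (there xF) m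

  Fresh-++ : ∀ {F} l {m} → Fresh F l → (∀ {F′} → (∀ {x} → x ∈ F′ → x ∈ l ⊎ x ∈ F) → Fresh F′ m) → Fresh F (l ++ m)
  Fresh-++ [] _ k = k inj₂
  Fresh-++ (x ∷ l) (x∉ , h) k = x∉ , Fresh-++ l h (λ s → k (λ m → case s m of λ where
    (inj₁ a) → inj₁ (there a)
    (inj₂ (here e)) → inj₁ (here e)
    (inj₂ (there b)) → inj₂ b))

  -- Position k of `u ∷ l`. Past the end it stays at the last vertex; such positions never matter.
  at : Fin n → List (Fin n) → ℕ → Fin n
  at u [] k = u
  at u (x ∷ l) zero = u
  at u (x ∷ l) (suc k) = at x l k

  at-zero : ∀ u l → at u l 0 ≡ u
  at-zero u [] = refl
  at-zero u (x ∷ l) = refl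

  at-++ : ∀ u l v m → at u (l ++ v ∷ m) (suc (length l)) ≡ v
  at-++ u [] v m = at-zero v m
  at-++ u (x ∷ l) v m = at-++ x l v m

  Link-at : ∀ {u} l {w} → Link u l w → ∀ {k} → suc k ≤ length l → at u l k ~ at u l (suc k)
  Link-at {u} (x ∷ l) (e , h) {zero} _ = subst (u ~_) (sym (at-zero x l)) e
  Link-at (x ∷ l) (e , h) {suc k} (s≤s le) = Link-at l h le

  Link-last : ∀ {u} l {w} → Link u l w → at u l (length l) ~ w
  Link-last [] e = e
  Link-last (x ∷ l) (_ , h) = Link-last l h

  at-∈ : ∀ x l k → at x l k ∈ (x ∷ l)
  at-∈ x [] k = here refl
  at-∈ x (y ∷ l) zero = here refl
  at-∈ x (y ∷ l) (suc k) = there (at-∈ y l k)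

  at-injective : ∀ {F} x l → Fresh F (x ∷ l) → ∀ {i j} → i ≤ length l → j ≤ length l → at x l i ≡ at x l j → i ≡ j
  at-injective x [] _ {zero} {zero} _ _ _ = refl
  at-injective x (y ∷ l) _ {zero} {zero} _ _ _ = refl
  at-injective x (y ∷ l) (_ , h) {zero} {suc j} _ _ e = ⊥-elim (Fresh-∉ (y ∷ l) h (here refl) (subst (_∈ (y ∷ l)) (sym e) (at-∈ y l j)))
  at-injective x (y ∷ l) (_ , h) {suc i} {zero} _ _ e = ⊥-elim (Fresh-∉ (y ∷ l) h (here refl) (subst (_∈ (y ∷ l)) e (at-∈ y l i)))
  at-injective x (y ∷ l) (_ , h) {suc i} {suc j} (s≤s a) (s≤s b) e = cong suc (at-injective y l h a b e)

data ThetaEdge (q r : ℕ) : ℕ → ℕ → Set where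
  step : ∀ {a} → ThetaEdge q r a (suc a)
  close : ∀ {b} → suc b ≡ q + r → ThetaEdge q r 0 b
  chord : ThetaEdge q r 0 q

thetaAdj⇒edge : ∀ q r i j → thetaAdj q r i j ≡ true → ThetaEdge q r (toℕ i) (toℕ j) ⊎ ThetaEdge q r (toℕ j) (toℕ i)
thetaAdj⇒edge q r i j h = split h
  where
  a = toℕ i
  b = toℕ j
  dec : ∀ {x y} → (x ≡ᵇ y) ≡ true → x ≡ y
  dec {x} {y} e = ℕₚ.≡ᵇ⇒≡ x y (subst T (sym e) tt)
  stepEdge : ∀ {x y} → suc x ≡ y → ThetaEdge q r x y
  stepEdge refl = step
  closeEdge : ∀ {x y} → x ≡ 0 → suc y ≡ q + r → ThetaEdge q r x y
  closeEdge refl e = close e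
  chordEdge : ∀ {x y} → x ≡ 0 → y ≡ q → ThetaEdge q r x y
  chordEdge refl refl = chord
  split : thetaAdj q r i j ≡ true → ThetaEdge q r a b ⊎ ThetaEdge q r b a
  split h with ∨-case {suc a ≡ᵇ b} h
  ... | inj₁ e = inj₁ (stepEdge (dec e))
  ... | inj₂ h with ∨-case {suc b ≡ᵇ a} h
  ... | inj₁ e = inj₂ (stepEdge (dec e))
  ... | inj₂ h with ∨-case {(a ≡ᵇ 0) ∧ (suc b ≡ᵇ q + r)} h
  ... | inj₁ e = inj₁ (closeEdge (dec (∧-left e)) (dec (∧-right {a ≡ᵇ 0} e)))
  ... | inj₂ h with ∨-case {(b ≡ᵇ 0) ∧ (suc a ≡ᵇ q + r)} h
  ... | inj₁ e = inj₂ (closeEdge (dec (∧-left e)) (dec (∧-right {b ≡ᵇ 0} e)))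
  ... | inj₂ h with ∨-case {(a ≡ᵇ 0) ∧ (b ≡ᵇ q)} h
  ... | inj₁ e = inj₁ (chordEdge (dec (∧-left e)) (dec (∧-right {a ≡ᵇ 0} e)))
  ... | inj₂ e = inj₂ (chordEdge (dec (∧-left e)) (dec (∧-right {b ≡ᵇ 0} e)))

module Connections {n : ℕ} (G : Graph n) (K : ℕ) where
  open Counting G
  open Paths G public

  -- S lists the interior vertices that every path found is committed to use;
  -- the bound on F is preserved when a path is extended by one vertex.
  Conn : List (Fin n) → Fin n → Fin n → ℕ → Set
  Conn S u v k = ∀ F → (∀ {x} → x ∈ S → x ∉ F) → length F + k ≤ K →
    ∃[ l ] suc (length l) ≡ k × Link u l v × Fresh F l

  conn-edge : ∀ {u v} → u ~ v → Conn [] u v 1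
  conn-edge e F _ _ = [] , refl , e , tt

  shift : ∀ {F : List (Fin n)} {k} → length F + suc k ≤ K → suc (length F) + k ≤ K
  shift {F} {k} = subst (_≤ K) (ℕₚ.+-suc (length F) k)

  room : ∀ {F : List (Fin n)} {k c} → length F + suc k ≤ K → K ≤ c → length F < c
  room {F} {k} le h = ℕₚ.≤-trans (s≤s (ℕₚ.m≤m+n (length F) k)) (ℕₚ.≤-trans (shift {F} le) h)

  conn-cons : ∀ {S u w v k} → u ~ w → w ∉ S → Conn S w v k → Conn (w ∷ S) u v (suc k)
  conn-cons {S} {w = w} e w∉S c F d le
    with c (w ∷ F) (λ { m (here refl) → w∉S m ; m (there m′) → d (there m) m′ }) (shift {F} le)
  ... | l , len , link , fresh = w ∷ l , cong suc len , (e , link) , (d (here refl) , fresh)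

  conn-sym : ∀ {S u v k} → Conn S u v k → Conn S v u k
  conn-sym c F d le with c F d le
  ... | l , len , link , fresh = rev l , trans (cong suc (length-rev l)) len , Link-rev l link , Fresh-rev l fresh

  conn-pick : ∀ {u v k} (W : Pred n) → K ≤ deg W u → (∀ w → W w ≡ true → u ~ w → Conn [] w v k) → Conn [] u v (suc k)
  conn-pick {u} {k = k} W big c F d le with pick F (λ j → W j ∧ adj G u j) (room {F} {k} le big)
  ... | w , h , w∉F with c w (∧-left h) (∧-right {W w} h) (w ∷ F) (λ ()) (shift {F} le)
  ...   | l , len , link , fresh = w ∷ l , cong suc len , (∧-right {W w} h , link) , (w∉F , fresh)

  conn-edge₂ : ∀ {u v} → K ≤ common all u v → Conn [] u v 2
  conn-edge₂ {u} {v} big F d le with pick F (λ j → adj G u j ∧ adj G v j) (room {F} {1} le big)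
  ... | w , h , w∉F = w ∷ [] , refl , (∧-left h , ~-sym (∧-right {adj G u w} h)) , (w∉F , tt)

  -- The q-path is taken first and keeps clear of the vertices `S₂` to which the r-path is
  -- committed; the r-path then avoids the q-path. Following the one and returning along the other
  -- gives a cycle through u at position 0 and v at position q, with uv as its chord.
  theta : ∀ {q r} S₁ S₂ {u v} → u ~ v → length S₂ + 2 + q ≤ K → 2 + q + r ≤ K →
    (∀ {x} → x ∈ S₁ → x ∉ u ∷ v ∷ S₂) → (∀ {x} → x ∈ S₂ → x ∉ u ∷ v ∷ []) →
    Conn S₁ u v q → Conn S₂ u v r → Contains G (q + r) (thetaAdj q r)
  theta {q} {r} S₁ S₂ {u} {v} e le₁ le₂ d₁ d₂ c₁ c₂
    with c₁ (u ∷ v ∷ S₂) d₁ (subst (λ z → z + q ≤ K) (ℕₚ.+-comm (length S₂) 2) le₁)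
  ... | l₁ , len₁ , link₁ , fresh₁
    with c₂ (u ∷ v ∷ l₁) (λ { m (here e) → d₂ m (here e) ; m (there (here e)) → d₂ m (there (here e))
                             ; m (there (there m′)) → Fresh-∉ l₁ fresh₁ (there (there m)) m′ })
            (linear 4 (λ a q r k → # 1 :+ a :≡ q ∷ # 2 :+ q :+ r :≤ k ∷ [] ⊢ (# 1 :+ (# 1 :+ a)) :+ r :≤ k) (length l₁ ∷ q ∷ r ∷ K ∷ []) len₁ le₂)
  ... | l₂ , len₂ , link₂ , fresh₂ = f , injective , edge
    where
    m = l₁ ++ v ∷ rev l₂
    len : suc (length m) ≡ q + r
    len = trans (cong suc (trans (Listₚ.length-++ l₁) (trans (cong (λ z → length l₁ + suc z) (length-rev l₂)) (cong (length l₁ +_) len₂))))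
      (cong (_+ r) len₁)
    closed : Link u m u
    closed = Link-++ l₁ link₁ (Link-rev l₂ link₂)
    fresh : Fresh [] (u ∷ m)
    fresh = (λ ()) , Fresh-++ l₁ (Fresh-⊆ l₁ (λ { (here e) → here e }) fresh₁) (λ {F′} s →
      (λ m → case s m of λ where
        (inj₁ a) → Fresh-∉ l₁ fresh₁ (there (here refl)) a
        (inj₂ (here e′)) → ~⇒≢ e (sym e′))
      , Fresh-⊆ (rev l₂) (λ { (here e) → there (here e) ; (there m) → case s m of λ where
          (inj₁ a) → there (there a)
          (inj₂ (here e)) → here e }) (Fresh-rev l₂ fresh₂))
    f : Fin (q + r) → Fin n
    f i = at u m (toℕ i)
    bound : ∀ i → toℕ i ≤ length m
    bound i = ℕₚ.≤-pred (subst (toℕ i <_) (sym len) (Finₚ.toℕ<n i))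
    injective : ∀ {i j} → f i ≡ f j → i ≡ j
    injective {i} {j} eq = Finₚ.toℕ-injective (at-injective u m fresh (bound i) (bound j) eq)
    edge′ : ∀ {a b} → b ≤ length m → ThetaEdge q r a b → at u m a ~ at u m b
    edge′ le step = Link-at m closed le
    edge′ {b = b} le (close eq) = subst₂ _~_ (sym (at-zero u m)) (cong (at u m) (ℕₚ.suc-injective (trans len (sym eq)))) (~-sym (Link-last m closed))
    edge′ le chord = subst₂ _~_ (sym (at-zero u m)) (trans (sym (at-++ u l₁ v (rev l₂))) (cong (at u m) len₁)) e
    edge : ∀ i j → thetaAdj q r i j ≡ true → f i ~ f j
    edge i j h with thetaAdj⇒edge q r i j h
    ... | inj₁ t = edge′ (bound j) t
    ... | inj₂ t = ~-sym (edge′ (bound i) t)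

  -- A set `X` with large common neighbourhoods serves as a switchboard. `R` is the wider class of
  -- vertices from which `X` can be entered in the same way.
  module Hub (X : Pred n) (R : Fin n → Set) (X⇒R : ∀ {x} → X x ≡ true → R x) (big : K ≤ card X)
             (joint : ∀ {u x} → R u → X x ≡ true → K ≤ common all u x) where

    -- A zigzag: choose the next vertex x′ of `X` first, then a common neighbour of u and x′, and
    -- continue from x′, which is again in `R`.
    conn-even : ∀ j {u x} → R u → X x ≡ true → Conn [] u x (suc j * 2)
    conn-even zero Ru Xx = conn-edge₂ (joint Ru Xx)
    conn-even (suc j) {u} {x} Ru Xx F d le with pick F X (room {F} {suc (suc j * 2)} le big)
    ... | x′ , Xx′ , x′∉F
      with pick (x′ ∷ F) (λ j → adj G u j ∧ adj G x′ j) (room {x′ ∷ F} {suc j * 2} (shift {F} le) (joint Ru Xx′))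
    ... | y , h , y∉ with conn-even j {x′} (X⇒R Xx′) Xx (x′ ∷ y ∷ F) (λ ()) (shift {y ∷ F} (shift {F} le))
    ... | l , len , link , fresh = y ∷ x′ ∷ l , cong (λ z → suc (suc z)) len , (∧-left h , ~-sym (∧-right {adj G u y} h) , link) ,
      ((y∉ ∘ there) , (λ { (here e) → y∉ (here (sym e)) ; (there m) → x′∉F m }) , fresh)

    -- An even path to a neighbour of v in `X`, followed by one edge. Length 1 cannot be produced
    -- this way, so there the edge uv must be given.
    conn-odd : ∀ j {u v} → R u → K ≤ deg X v → (u ~ v) ⊎ (1 ≤ j) → Conn [] u v (suc (j * 2))
    conn-odd zero Ru Xv (inj₁ e) = conn-edge e
    conn-odd (suc j) Ru Xv _ = conn-sym (conn-pick X Xv (λ w Xw _ → conn-sym (conn-even j Ru Xw)))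

-- Dense induced subgraphs without theta graphs are bipartite

-- The offsets build in r ≥ 2: even values start at 2 and odd values at 3.
data Parity (r : ℕ) : Set where
  even : ∀ b → r ≡ suc b * 2 → Parity r
  odd : ∀ b → r ≡ suc (suc b * 2) → Parity r

4ab≤[a+b]² : ∀ a b → 4 * (a * b) ≤ (a + b) * (a + b)
4ab≤[a+b]² a b with ℕₚ.≤-total a b
... | inj₁ le = subst (λ b → 4 * (a * b) ≤ (a + b) * (a + b)) (ℕₚ.m+[n∸m]≡n le)
  (linear 2 (λ a d → [] ⊢ # 4 :* (a :* (a :+ d)) :≤ (a :+ (a :+ d)) :* (a :+ (a :+ d))) (a ∷ b ∸ a ∷ []))
... | inj₂ le = subst (λ a → 4 * (a * b) ≤ (a + b) * (a + b)) (ℕₚ.m+[n∸m]≡n le)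
  (linear 2 (λ b d → [] ⊢ # 4 :* ((b :+ d) :* b) :≤ ((b :+ d) :+ b) :* ((b :+ d) :+ b)) (b ∷ a ∸ b ∷ []))

n<2^n : ∀ n → suc n ≤ 2 ^ n
n<2^n zero = s≤s z≤n
n<2^n (suc n) = linear 2 (λ n t → # 1 :+ n :≤ t ∷ [] ⊢ # 1 :+ (# 1 :+ n) :≤ t :+ (t :+ # 0)) (n ∷ 2 ^ n ∷ []) (n<2^n n)

module Ramsey {n : ℕ} (rel : Fin n → Fin n → Bool) (rel-sym : ∀ {i j} → rel i j ≡ true → rel j i ≡ true) where

  Clique : Pred n → Set
  Clique Q = ∀ {i j} → Q i ≡ true → Q j ≡ true → rel i j ≡ true

  -- If among any three elements two are related, the elements unrelated to a
  -- fixed one form a clique.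
  clique : ∀ k (P : Pred n) → 2 ^ k ≤ card P →
    (∀ i j l → P i ≡ true → P j ≡ true → P l ≡ true → rel i j ≡ true ⊎ rel i l ≡ true ⊎ rel j l ≡ true) →
    (∀ i → P i ≡ true → rel i i ≡ true) →
    ∃[ Q ] (∀ i → Q i ≡ true → P i ≡ true) × k ≤ card Q × Clique Q
  clique zero P _ _ _ = (λ _ → false) , (λ _ ()) , z≤n , (λ ())
  clique (suc k) P le three self with card-pos⁻¹ P (ℕₚ.≤-trans (ℕₚ.≤-trans (s≤s z≤n) (n<2^n (suc k))) le)
  ... | c , Pc = split
    where
    P₁ P₂ : Pred n
    P₁ i = (P ∖ c) i ∧ rel c i
    P₂ i = (P ∖ c) i ∧ not (rel c i)
    sizes : card P ≡ suc (card P₁ + card P₂)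
    sizes = trans (card-∖ P c Pc) (cong suc (cards≡ ((P ∖ c) ∷ []) (P₁ ∷ P₂ ∷ []) (λ i → sym (bit-split ((P ∖ c) i) (rel c i)))))
    P₁⊆P : ∀ i → P₁ i ≡ true → P i ≡ true
    P₁⊆P i h = ∧-left (∧-left {(P ∖ c) i} h)
    P₂⊆P : ∀ i → P₂ i ≡ true → P i ≡ true
    P₂⊆P i h = ∧-left (∧-left {(P ∖ c) i} h)
    split : ∃[ Q ] (∀ i → Q i ≡ true → P i ≡ true) × suc k ≤ card Q × Clique Q
    split with 2 ^ k ℕₚ.≤? card P₁
    ... | yes big with clique k P₁ big (λ i j l a b d → three i j l (P₁⊆P i a) (P₁⊆P j b) (P₁⊆P l d)) (λ i a → self i (P₁⊆P i a))
    ...   | Q , Q⊆ , kQ , cl = (λ i → Q i ∨ (i == c)) , sub , size , pairs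
      where
      sub : ∀ i → Q i ∨ (i == c) ≡ true → P i ≡ true
      sub i h with ∨-case {Q i} h
      ... | inj₁ q = P₁⊆P i (Q⊆ i q)
      ... | inj₂ e = subst (λ z → P z ≡ true) (sym (==⇒≡ e)) Pc
      size : suc k ≤ card (λ i → Q i ∨ (i == c))
      size = ℕₚ.≤-trans (s≤s (ℕₚ.≤-trans kQ (card-mono (λ i q → ∖-intro (λ i → Q i ∨ (i == c)) (bool⇒ 2 (λ a b → a) (λ a b → a ∨ b) (Q i ∷ (i == c) ∷ []) q)
          (∖-elim P (∧-left (Q⊆ i q)))))))
        (ℕₚ.≤-reflexive (sym (card-∖ (λ i → Q i ∨ (i == c)) c (bool⇒ 2 (λ a b → b) (λ a b → a ∨ b) (Q c ∷ (c == c) ∷ []) (==-refl c)))))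
      pairs : Clique (λ i → Q i ∨ (i == c))
      pairs {i} {j} hi hj with ∨-case {Q i} hi | ∨-case {Q j} hj
      ... | inj₁ qi | inj₁ qj = cl qi qj
      ... | inj₂ ei | inj₁ qj = subst (λ z → rel z j ≡ true) (sym (==⇒≡ ei)) (∧-right {(P ∖ c) j} (Q⊆ j qj))
      ... | inj₁ qi | inj₂ ej = subst (λ z → rel i z ≡ true) (sym (==⇒≡ ej)) (rel-sym (∧-right {(P ∖ c) i} (Q⊆ i qi)))
      ... | inj₂ ei | inj₂ ej = subst₂ (λ y z → rel y z ≡ true) (sym (==⇒≡ ei)) (sym (==⇒≡ ej)) (self c Pc)
    split | no small = P₂ , P₂⊆P , size , pairs
      where
      size : suc k ≤ card P₂
      size = linear 5 (λ k t p p₁ p₂ → # 1 :+ k :≤ t ∷ t :+ (t :+ # 0) :≤ p ∷ p :≡ # 1 :+ (p₁ :+ p₂) ∷ p₁ :< t ∷ [] ⊢ # 1 :+ k :≤ p₂)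
        (k ∷ 2 ^ k ∷ card P ∷ card P₁ ∷ card P₂ ∷ []) (n<2^n k) le sizes (ℕₚ.≰⇒> small)
      pairs : Clique P₂
      pairs {i} {j} hi hj with three c i j Pc (P₂⊆P i hi) (P₂⊆P j hj)
      ... | inj₁ ci = ⊥-elim (true≢false (trans (sym ci) (not-true (∧-right {(P ∖ c) i} hi))))
      ... | inj₂ (inj₁ cj) = ⊥-elim (true≢false (trans (sym cj) (not-true (∧-right {(P ∖ c) j} hj))))
      ... | inj₂ (inj₂ ij) = ij

≤ᵇ-true : ∀ {a b} → a ≤ b → (a ≤ᵇ b) ≡ true
≤ᵇ-true h = T⇒≡ (ℕₚ.≤⇒≤ᵇ h)

true-≤ᵇ : ∀ {a b} → (a ≤ᵇ b) ≡ true → a ≤ b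
true-≤ᵇ {a} {b} h = ℕₚ.≤ᵇ⇒≤ a b (subst T (sym h) tt)

-- `book₀` makes 1/12 of the order at least `2 ^ K`, the size the Ramsey argument consumes, and
-- keeps the order above the few dozen where one deletion in `turán+C` pays for itself. `turán₀` is
-- large enough for the gain of one deletion, about 1/20 of the order, to absorb the error `C`.
book₀ turán₀ : ℕ → ℕ
book₀ K = 24 * 2 ^ K
turán₀ K = 20 * (book₀ K * book₀ K + 1)

module Params (q r a : ℕ) (q≡ : q ≡ suc a * 2) (parity : Parity r) (K : ℕ) (K-large : q + r + 10 ≤ K) where

  M₁ C M₀ : ℕ
  M₁ = book₀ K
  C = M₁ * M₁
  M₀ = turán₀ K

  module Dense {n : ℕ} (G : Graph n) (free : Free G (q + r) (thetaAdj q r)) where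
    open Counting G
    open Connections G K

    room₁ : 2 + q + r ≤ K
    room₁ = linear 3 (λ q r k → q :+ r :+ # 10 :≤ k ∷ [] ⊢ # 2 :+ q :+ r :≤ k) (q ∷ r ∷ K ∷ []) K-large

    room₂ : ∀ (S : List (Fin n)) → length S ≤ 5 → length S + 2 + q ≤ K
    room₂ S h = linear 4 (λ s q r k → s :≤ # 5 ∷ q :+ r :+ # 10 :≤ k ∷ [] ⊢ s :+ # 2 :+ q :≤ k) (length S ∷ q ∷ r ∷ K ∷ []) h K-large

    no-theta : ∀ S₁ S₂ {u v} → length S₂ ≤ 5 → u ~ v →
      (∀ {x} → x ∈ S₁ → x ∉ u ∷ v ∷ S₂) → (∀ {x} → x ∈ S₂ → x ∉ u ∷ v ∷ []) →
      Conn S₁ u v q → Conn S₂ u v r → ⊥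
    no-theta S₁ S₂ le e d₁ d₂ c₁ c₂ = free (theta S₁ S₂ e (room₂ S₂ le) room₁ d₁ d₂ c₁ c₂)

    -- Paths from u to v through `Q` have every even length, which settles even r with chord uv. For
    -- odd r the chord is uc with c in `Q`: direct paths from u to c are odd, and the step from u to
    -- v followed by an odd path to c is even.
    no-book : ∀ {u v} (Q : Pred n) → u ~ v → K ≤ card Q → (∀ i → Q i ≡ true → (u ~ i) × (v ~ i)) →
      (∀ {i j} → Q i ≡ true → Q j ≡ true → K ≤ common all i j) → ⊥
    no-book {u} {v} Q e big adjacent joint = by-parity parity
      where
      open Hub Q (λ x → Q x ≡ true) id big joint
      Qu : K ≤ deg Q u
      Qu = ℕₚ.≤-trans big (card-mono (λ i h → ∧-intro h (proj₁ (adjacent i h))))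
      Qv : K ≤ deg Q v
      Qv = ℕₚ.≤-trans big (card-mono (λ i h → ∧-intro h (proj₂ (adjacent i h))))
      even-path : ∀ j → Conn [] u v (suc j * 2)
      even-path j = conn-pick Q Qu (λ w Qw _ → conn-odd j Qw Qv (inj₁ (~-sym (proj₂ (adjacent w Qw)))))
      by-parity : Parity r → ⊥
      by-parity (even b r≡) = no-theta [] [] z≤n e (λ ()) (λ ())
        (subst (Conn [] u v) (sym q≡) (even-path a)) (subst (Conn [] u v) (sym r≡) (even-path b))
      by-parity (odd b r≡) with pick [] Q (ℕₚ.≤-trans (linear 3 (λ q r k → q :+ r :+ # 10 :≤ k ∷ [] ⊢ # 1 :≤ k) (q ∷ r ∷ K ∷ []) K-large) big)
      ... | c , Qc , _ = no-theta (v ∷ []) [] z≤n (proj₁ (adjacent c Qc))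
        (λ { (here refl) (here e′) → ~⇒≢ e (sym e′) ; (here refl) (there (here e′)) → ~⇒≢ (proj₂ (adjacent c Qc)) e′ }) (λ ())
        (subst (Conn (v ∷ []) u c) (sym q≡) (conn-cons e (λ ()) (conn-sym (conn-odd a Qc Qv (inj₁ (~-sym (proj₂ (adjacent c Qc))))))))
        (subst (Conn [] u c) (sym r≡) (conn-sym (conn-odd (suc b) Qc Qu (inj₂ (s≤s z≤n)))))

    common-sym : ∀ p u v → common p u v ≡ common p v u
    common-sym p u v = card-cong (λ i → cong (p i ∧_) (Boolₚ.∧-comm (adj G u i) (adj G v i)))

    common-mono : ∀ p u v → common p u v ≤ common all u v
    common-mono p u v = card-mono (λ i h → ∧-right {p i} h)

    module MinDegree (S : Pred n) (large : M₁ ≤ card S)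
                     (dense : ∀ v → S v ≡ true → 39 * card S ≤ 80 * deg S v) where
      m : ℕ
      m = card S

      12K≤m : 12 * 2 ^ K ≤ m
      12K≤m = linear 2 (λ t m → # 24 :* t :≤ m ∷ [] ⊢ # 12 :* t :≤ m) (2 ^ K ∷ m ∷ []) large

      -- The three degrees sum to at least 117/80 of |S|, so the pairwise overlaps total at least
      -- 37/80 of |S|, more than three times 1/12.
      three : ∀ i j l → S i ≡ true → S j ≡ true → S l ≡ true →
        m ≤ 12 * common S i j ⊎ m ≤ 12 * common S i l ⊎ m ≤ 12 * common S j l
      three i j l Si Sj Sl with m ℕₚ.≤? 12 * common S i j | m ℕₚ.≤? 12 * common S i l
      ... | yes h | _ = inj₁ h
      ... | no _ | yes h = inj₂ (inj₁ h)
      ... | no h | no h′ = inj₂ (inj₂ (linear 7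
          (λ m x y z s t u → # 39 :* m :≤ # 80 :* x ∷ # 39 :* m :≤ # 80 :* y ∷ # 39 :* m :≤ # 80 :* z ∷
             # 12 :* s :< m ∷ # 12 :* t :< m ∷ x :+ (y :+ z) :≤ m :+ (s :+ (t :+ u)) ∷ [] ⊢ m :≤ # 12 :* u)
          (m ∷ deg S i ∷ deg S j ∷ deg S l ∷ common S i j ∷ common S i l ∷ common S j l ∷ [])
          (dense i Si) (dense j Sj) (dense l Sl) (ℕₚ.≰⇒> h) (ℕₚ.≰⇒> h′)
          (cards≤ ((λ v → S v ∧ adj G i v) ∷ (λ v → S v ∧ adj G j v) ∷ (λ v → S v ∧ adj G l v) ∷ [])
                  (S ∷ (λ v → S v ∧ (adj G i v ∧ adj G j v)) ∷ (λ v → S v ∧ (adj G i v ∧ adj G l v)) ∷ (λ v → S v ∧ (adj G j v ∧ adj G l v)) ∷ [])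
            (λ v → bool≤ 4 (λ s x y z → bit (s ∧ x) + (bit (s ∧ y) + bit (s ∧ z)))
                           (λ s x y z → bit s + (bit (s ∧ (x ∧ y)) + (bit (s ∧ (x ∧ z)) + bit (s ∧ (y ∧ z)))))
                     (S v ∷ adj G i v ∷ adj G j v ∷ adj G l v ∷ [])))))

      linear-common : ∀ i j → m ≤ 12 * common S i j → 2 ^ K ≤ common S i j
      linear-common i j h = linear 3 (λ t m c → # 12 :* t :≤ m ∷ m :≤ # 12 :* c ∷ [] ⊢ t :≤ c) (2 ^ K ∷ m ∷ common S i j ∷ []) 12K≤m h

      K≤2^K : K ≤ 2 ^ K
      K≤2^K = ℕₚ.≤-trans (ℕₚ.n≤1+n K) (n<2^n K)

      related : ∀ i j → m ≤ 12 * common S i j → (K ≤ᵇ common all i j) ≡ true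
      related i j h = ≤ᵇ-true (ℕₚ.≤-trans K≤2^K (ℕₚ.≤-trans (linear-common i j h) (common-mono S i j)))

      -- Among the common neighbours of the edge, any three contain two that are related by `three`;
      -- a clique of this relation is the set that `no-book` forbids.
      no-heavy-edge : ∀ {u v} → u ~ v → m ≤ 12 * common S u v → ⊥
      no-heavy-edge {u} {v} e h = conclude (Ramsey.clique (λ i j → K ≤ᵇ common all i j) (λ {i} {j} → subst (λ z → (K ≤ᵇ z) ≡ true) (common-sym all i j))
          K P (linear-common u v h)
          (λ i j l hi hj hl → case three i j l (∧-left hi) (∧-left hj) (∧-left hl) of λ where
            (inj₁ x) → inj₁ (related i j x)
            (inj₂ (inj₁ x)) → inj₂ (inj₁ (related i l x))
            (inj₂ (inj₂ x)) → inj₂ (inj₂ (related j l x)))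
          (λ i hi → related i i (linear 3 (λ m d c → # 39 :* m :≤ # 80 :* d ∷ d :≤ c ∷ [] ⊢ m :≤ # 12 :* c) (m ∷ deg S i ∷ common S i i ∷ [])
            (dense i (∧-left hi)) (card-mono (λ j x → ∧-intro (∧-left {S j} x) (∧-intro (∧-right {S j} x) (∧-right {S j} x)))))))
        where
        P : Pred n
        P i = S i ∧ (adj G u i ∧ adj G v i)
        conclude : (∃[ Q ] (∀ i → Q i ≡ true → P i ≡ true) × K ≤ card Q × (∀ {i j} → Q i ≡ true → Q j ≡ true → (K ≤ᵇ common all i j) ≡ true)) → ⊥
        conclude (Q , Q⊆ , big , cl) = no-book Q e big
          (λ i Qi → ∧-left (∧-right {S i} (Q⊆ i Qi)) , ∧-right {adj G u i} (∧-right {S i} (Q⊆ i Qi)))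
          (λ Qi Qj → true-≤ᵇ (cl Qi Qj))

      triangle-free : ∀ {i j l} → S i ≡ true → S j ≡ true → S l ≡ true → i ~ j → i ~ l → j ~ l → ⊥
      triangle-free {i} {j} {l} Si Sj Sl ij il jl with three i j l Si Sj Sl
      ... | inj₁ h = no-heavy-edge ij h
      ... | inj₂ (inj₁ h) = no-heavy-edge il h
      ... | inj₂ (inj₂ h) = no-heavy-edge jl h

      split-neighbours : ∀ (A : Pred n) → (∀ v → A v ≡ true → S v ≡ true) → ∀ {i j} → S i ≡ true → S j ≡ true → i ~ j →
        deg A i + deg A j ≤ card A
      split-neighbours A A⊆S {i} {j} Si Sj ij = cards≤ ((λ v → A v ∧ adj G i v) ∷ (λ v → A v ∧ adj G j v) ∷ []) (A ∷ []) pt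
        where
        pt : ∀ v → bit (A v ∧ adj G i v) + bit (A v ∧ adj G j v) ≤ bit (A v)
        pt v with A v in Av | adj G i v in iv | adj G j v in jv
        ... | false | _ | _ = z≤n
        ... | true | false | false = z≤n
        ... | true | true | false = s≤s z≤n
        ... | true | false | true = s≤s z≤n
        ... | true | true | true = ⊥-elim (triangle-free Si Sj (A⊆S v Av) ij iv jv)

      module Edge {u v : Fin n} (Su : S u ≡ true) (Sv : S v ≡ true) (uv : u ~ v) where
        A B : Pred n
        A i = S i ∧ adj G u i
        B i = S i ∧ adj G v i

        A+B≤m : card A + card B ≤ m
        A+B≤m = split-neighbours S (λ _ h → h) Su Sv uv

        degree-split : ∀ w → deg S w + (card A + card B) ≤ deg A w + (deg B w + m)
        degree-split w = cards≤ ((λ i → S i ∧ adj G w i) ∷ A ∷ B ∷ []) ((λ i → A i ∧ adj G w i) ∷ (λ i → B i ∧ adj G w i) ∷ S ∷ []) pt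
          where
          pt : ∀ i → bit (S i ∧ adj G w i) + (bit (S i ∧ adj G u i) + bit (S i ∧ adj G v i)) ≤
                     bit ((S i ∧ adj G u i) ∧ adj G w i) + (bit ((S i ∧ adj G v i) ∧ adj G w i) + bit (S i))
          pt i with S i in Si | adj G u i in ui | adj G v i in vi | adj G w i
          ... | false | _ | _ | _ = z≤n
          ... | true | false | false | false = z≤n
          ... | true | false | false | true = s≤s z≤n
          ... | true | true | false | false = s≤s z≤n
          ... | true | true | false | true = s≤s (s≤s z≤n)
          ... | true | false | true | false = s≤s z≤n
          ... | true | false | true | true = s≤s (s≤s z≤n)
          ... | true | true | true | _ = ⊥-elim (triangle-free Su Sv Si uv ui vi)

        A-independent : ∀ {x} → A x ≡ true → deg A x ≡ 0
        A-independent {x} Ax = card-empty (λ i → ≢true (λ h →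
          triangle-free Su (∧-left Ax) (∧-left (∧-left {A i} h)) (∧-right {S x} Ax) (∧-right {S i} (∧-left {A i} h)) (∧-right {A i} h)))

        B-independent : ∀ {x} → B x ≡ true → deg B x ≡ 0
        B-independent {x} Bx = card-empty (λ i → ≢true (λ h →
          triangle-free Sv (∧-left Bx) (∧-left (∧-left {B i} h)) (∧-right {S x} Bx) (∧-right {S i} (∧-left {B i} h)) (∧-right {B i} h)))

        -- With x in A and y in B adjacent to w: x has no neighbour in A, hence sees all but 2/80 of
        -- |S| that is available in B, and by triangle-freeness w sees at most that remainder of B;
        -- likewise for A through y. With the vertices outside A and B this leaves w degree at most
        -- 6/80 of |S|.
        one-sided : ∀ {w} → S w ≡ true → 0 < deg A w → 0 < deg B w → ⊥
        one-sided {w} Sw hA hB with card-pos⁻¹ _ hA | card-pos⁻¹ _ hB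
        ... | x , hx | y , hy = linear 10
          (λ m cA cB dw wA wB dx xB dy yA →
             # 39 :* m :≤ # 80 :* cA ∷ # 39 :* m :≤ # 80 :* cB ∷ # 39 :* m :≤ # 80 :* dw ∷ # 39 :* m :≤ # 80 :* dx ∷ # 39 :* m :≤ # 80 :* dy ∷
             dw :+ (cA :+ cB) :≤ wA :+ (wB :+ m) ∷ dx :+ (cA :+ cB) :≤ # 0 :+ (xB :+ m) ∷ dy :+ (cA :+ cB) :≤ yA :+ (# 0 :+ m) ∷
             wB :+ xB :≤ cB ∷ wA :+ yA :≤ cA ∷ # 1 :≤ m ∷ [] ⊢ absurd)
          (m ∷ card A ∷ card B ∷ deg S w ∷ deg A w ∷ deg B w ∷ deg S x ∷ deg B x ∷ deg S y ∷ deg A y ∷ [])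
          (dense u Su) (dense v Sv) (dense w Sw) (dense x Sx) (dense y Sy)
          (degree-split w)
          (subst (λ z → deg S x + (card A + card B) ≤ z + (deg B x + m)) (A-independent Ax) (degree-split x))
          (subst (λ z → deg S y + (card A + card B) ≤ deg A y + (z + m)) (B-independent By) (degree-split y))
          (split-neighbours B (λ i → ∧-left) Sw Sx (∧-right {A x} hx))
          (split-neighbours A (λ i → ∧-left) Sw Sy (∧-right {B y} hy))
          (card-pos S Su)
          where
          Ax : A x ≡ true
          Ax = ∧-left hx
          By : B y ≡ true
          By = ∧-left hy
          Sx : S x ≡ true
          Sx = ∧-left Ax
          Sy : S y ≡ true
          Sy = ∧-left By

        side : Fin n → Bool
        side w = deg B w ≡ᵇ 0

        -- Adjacent vertices of one side would each have about 37/80 of |S| as neighbours in the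
        -- same one of A and B. These neighbourhoods are disjoint, but neither set exceeds 41/80 of
        -- |S|.
        proper : ∀ i j → S i ≡ true → S j ≡ true → i ~ j → side i ≢ side j
        proper i j Si Sj ij same with deg B i in Bi | deg B j in Bj
        ... | zero | zero = linear 7
          (λ m cA cB di dj iA jA → # 39 :* m :≤ # 80 :* cA ∷ # 39 :* m :≤ # 80 :* cB ∷ # 39 :* m :≤ # 80 :* di ∷ # 39 :* m :≤ # 80 :* dj ∷
             di :+ (cA :+ cB) :≤ iA :+ (# 0 :+ m) ∷ dj :+ (cA :+ cB) :≤ jA :+ (# 0 :+ m) ∷ iA :+ jA :≤ cA ∷ cA :+ cB :≤ m ∷ # 1 :≤ m ∷ [] ⊢ absurd)
          (m ∷ card A ∷ card B ∷ deg S i ∷ deg S j ∷ deg A i ∷ deg A j ∷ [])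
          (dense u Su) (dense v Sv) (dense i Si) (dense j Sj)
          (subst (λ z → deg S i + (card A + card B) ≤ deg A i + (z + m)) Bi (degree-split i))
          (subst (λ z → deg S j + (card A + card B) ≤ deg A j + (z + m)) Bj (degree-split j))
          (split-neighbours A (λ i → ∧-left) Si Sj ij) A+B≤m (card-pos S Su)
        ... | suc b | suc b′ = linear 7
          (λ m cA cB di dj iB jB → # 39 :* m :≤ # 80 :* cA ∷ # 39 :* m :≤ # 80 :* cB ∷ # 39 :* m :≤ # 80 :* di ∷ # 39 :* m :≤ # 80 :* dj ∷
             di :+ (cA :+ cB) :≤ # 0 :+ (iB :+ m) ∷ dj :+ (cA :+ cB) :≤ # 0 :+ (jB :+ m) ∷ iB :+ jB :≤ cB ∷ cA :+ cB :≤ m ∷ # 1 :≤ m ∷ [] ⊢ absurd)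
          (m ∷ card A ∷ card B ∷ deg S i ∷ deg S j ∷ deg B i ∷ deg B j ∷ [])
          (dense u Su) (dense v Sv) (dense i Si) (dense j Sj)
          (subst (λ z → deg S i + (card A + card B) ≤ z + (deg B i + m)) (none Si Bi) (degree-split i))
          (subst (λ z → deg S j + (card A + card B) ≤ z + (deg B j + m)) (none Sj Bj) (degree-split j))
          (split-neighbours B (λ i → ∧-left) Si Sj ij) A+B≤m (card-pos S Su)
          where
          none : ∀ {w k} → S w ≡ true → deg B w ≡ suc k → deg A w ≡ 0
          none {w} Sw eq with deg A w in Aw
          ... | zero = refl
          ... | suc _ = ⊥-elim (one-sided Sw (subst (0 <_) (sym Aw) (s≤s z≤n)) (subst (0 <_) (sym eq) (s≤s z≤n)))
        ... | zero | suc _ = case same of λ ()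
        ... | suc _ | zero = case same of λ ()

      bipartite : ∃[ c ] ∀ i j → S i ≡ true → S j ≡ true → i ~ j → c i ≢ c j
      bipartite with card-pos⁻¹ S (linear 2 (λ t m → # 12 :* t :≤ m ∷ # 1 :≤ t ∷ [] ⊢ # 1 :≤ m) (2 ^ K ∷ m ∷ []) 12K≤m (ℕₚ.≤-trans (s≤s z≤n) (n<2^n K)))
      ... | u , Su with card-pos⁻¹ (λ i → S i ∧ adj G u i) (linear 2 (λ m d → # 39 :* m :≤ # 80 :* d ∷ # 1 :≤ m ∷ [] ⊢ # 1 :≤ d) (m ∷ deg S u ∷ []) (dense u Su) (card-pos S Su))
      ... | v , h = Edge.side Su (∧-left h) (∧-right {S v} h) , Edge.proper Su (∧-left h) (∧-right {S v} h)

-- The extremal number, and the dense bipartite core of a near-extremal graph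

module Extremal (q r a : ℕ) (q≡ : q ≡ suc a * 2) (parity : Parity r) (K : ℕ) (K-large : q + r + 10 ≤ K)
                {n : ℕ} (G : Graph n) (free : Free G (q + r) (thetaAdj q r)) where
  open Params q r a q≡ parity K K-large public
  open Dense G free public
  open Counting G public
  open Connections G K public

  bipartite-bound : ∀ p c → (∀ i j → p i ≡ true → p j ≡ true → i ~ j → c i ≢ c j) → 2 * E p ≤ card p * card p
  bipartite-bound p c ok = linear 4 (λ e x m ab → e :≡ # 2 :* x ∷ x :≤ ab ∷ # 4 :* ab :≤ m ∷ [] ⊢ # 2 :* e :≤ m)
    (E p ∷ cross A B ∷ card p * card p ∷ card A * card B ∷ [])
    (E-bipartite p c ok) (ℕₚ.≤-trans (ℕₚ.m≤m+n _ _) (ℕₚ.≤-reflexive (cross+missing A B)))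
    (subst (λ z → 4 * (card A * card B) ≤ z * z) (cards≡ (A ∷ B ∷ []) (p ∷ []) (λ i → bit-split (p i) (c i))) (4ab≤[a+b]² (card A) (card B)))
    where
    A B : Pred n
    A i = p i ∧ c i
    B i = p i ∧ not (c i)

  poor-or-dense : ∀ p → (∃[ v ] p v ≡ true × 80 * deg p v < 39 * card p) ⊎ (∀ v → p v ≡ true → 39 * card p ≤ 80 * deg p v)
  poor-or-dense p with search-pred (λ v → p v ∧ not (39 * card p ≤ᵇ 80 * deg p v))
  ... | inj₁ (v , h) = inj₁ (v , ∧-left h , ℕₚ.≰⇒> (λ le → true≢false (trans (sym (≤ᵇ-true le)) (not-true (∧-right {p v} h)))))
  ... | inj₂ none = inj₂ (λ v pv → true-≤ᵇ (≢false (λ e → true≢false (trans (sym (∧-intro pv (cong not e))) (none v)))))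

  -- Induction by deleting poor vertices; small sets are absorbed by the error `C`. The number `f`
  -- bounds the order and makes the recursion structural.
  turán+C : ∀ f p → card p ≤ f → 2 * E p ≤ card p * card p + C
  turán+C f p le with M₁ ℕₚ.≤? card p
  ... | no small = linear 3 (λ e m c → e :≤ m ∷ m :≤ c ∷ [] ⊢ # 2 :* e :≤ m :+ c) (E p ∷ card p * card p ∷ C ∷ [])
    (E-trivial p) (ℕₚ.*-mono-≤ (ℕₚ.<⇒≤ (ℕₚ.≰⇒> small)) (ℕₚ.<⇒≤ (ℕₚ.≰⇒> small)))
  ... | yes large with poor-or-dense p
  ...   | inj₂ dense = let c , ok = MinDegree.bipartite p large dense in ℕₚ.≤-trans (bipartite-bound p c ok) (ℕₚ.m≤m+n _ _)
  ...   | inj₁ (v , pv , poor) = descend f le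
    where
    descend : ∀ f → card p ≤ f → 2 * E p ≤ card p * card p + C
    descend zero le = ⊥-elim (ℕₚ.<⇒≱ (card-pos p pv) le)
    descend (suc f) le = subst (λ m → 2 * E p ≤ m * m + C) (sym (card-∖ p v pv))
      (linear 6 (λ e e′ d c m t → e :≡ e′ :+ # 2 :* d ∷ # 80 :* d :< # 39 :* (# 1 :+ m) ∷ # 2 :* e′ :≤ m :* m :+ c ∷ # 24 :* t :≤ # 1 :+ m ∷ # 1 :≤ t ∷ []
          ⊢ # 2 :* e :≤ (# 1 :+ m) :* (# 1 :+ m) :+ c)
        (E p ∷ E (p ∖ v) ∷ deg p v ∷ C ∷ card (p ∖ v) ∷ 2 ^ K ∷ [])
        (E-remove p v pv) (subst (λ m → 80 * deg p v < 39 * m) (card-∖ p v pv) poor)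
        (turán+C f (p ∖ v) (ℕₚ.≤-pred (subst (_≤ suc f) (card-∖ p v pv) le)))
        (subst (M₁ ≤_) (card-∖ p v pv) large) (ℕₚ.≤-trans (s≤s z≤n) (n<2^n K)))

  M₁≤M₀ : M₁ ≤ M₀
  M₁≤M₀ = linear 2 (λ c m → m :≤ c ∷ [] ⊢ m :≤ # 20 :* (c :+ # 1)) (C ∷ M₁ ∷ []) (square M₁)
    where
    square : ∀ m → m ≤ m * m
    square zero = z≤n
    square (suc m) = ℕₚ.m≤m+n (suc m) _

  -- The error disappears after a single deletion: the gain of about 1/20 of the order already
  -- exceeds `C`.
  turán : ∀ p → M₀ ≤ card p → 2 * E p ≤ card p * card p
  turán p large with poor-or-dense p
  ... | inj₂ dense = let c , ok = MinDegree.bipartite p (ℕₚ.≤-trans M₁≤M₀ large) dense in bipartite-bound p c ok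
  ... | inj₁ (v , pv , poor) = subst (λ m → 2 * E p ≤ m * m) (sym (card-∖ p v pv))
      (linear 5 (λ e e′ d c m → e :≡ e′ :+ # 2 :* d ∷ # 80 :* d :< # 39 :* (# 1 :+ m) ∷ # 2 :* e′ :≤ m :* m :+ c ∷ # 20 :* (c :+ # 1) :≤ # 1 :+ m ∷ []
          ⊢ # 2 :* e :≤ (# 1 :+ m) :* (# 1 :+ m))
        (E p ∷ E (p ∖ v) ∷ deg p v ∷ C ∷ card (p ∖ v) ∷ [])
        (E-remove p v pv) (subst (λ m → 80 * deg p v < 39 * m) (card-∖ p v pv) poor)
        (turán+C _ (p ∖ v) ℕₚ.≤-refl) (subst (M₀ ≤_) (card-∖ p v pv) large))

  record Core : Set where
    field
      X Y : Pred n
      disjoint : ∀ {i} → X i ≡ true → Y i ≡ true → ⊥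
      X-independent : ∀ {i j} → X i ≡ true → X j ≡ true → i ~ j → ⊥
      Y-independent : ∀ {i j} → Y i ≡ true → Y j ≡ true → i ~ j → ⊥
      size : n ≤ card X + card Y + 100
      X-degree : ∀ {i} → X i ≡ true → 39 * (card X + card Y) ≤ 80 * deg Y i
      Y-degree : ∀ {i} → Y i ≡ true → 39 * (card X + card Y) ≤ 80 * deg X i
      X-size : 39 * (card X + card Y) ≤ 80 * card X
      Y-size : 39 * (card X + card Y) ≤ 80 * card Y

  swap : Core → Core
  swap core = record
    { X = Y ; Y = X ; disjoint = λ y x → disjoint x y ; X-independent = Y-independent ; Y-independent = X-independent
    ; size = subst (λ z → n ≤ z + 100) (ℕₚ.+-comm (card X) (card Y)) size
    ; X-degree = λ {i} h → flip (deg X i) (Y-degree h)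
    ; Y-degree = λ {i} h → flip (deg Y i) (X-degree h)
    ; X-size = flip (card Y) Y-size
    ; Y-size = flip (card X) X-size }
    where
    open Core core
    flip : ∀ d → 39 * (card X + card Y) ≤ 80 * d → 39 * (card Y + card X) ≤ 80 * d
    flip d = subst (λ z → 39 * z ≤ 80 * d) (ℕₚ.+-comm (card X) (card Y))

  deg≤card : ∀ p v → deg p v ≤ card p
  deg≤card p v = card-mono {p = λ i → p i ∧ adj G v i} {q = p} (λ i → ∧-left)

  core-from : ∀ S → M₀ + 100 ≤ n → n ≤ card S + 100 → (∀ v → S v ≡ true → 39 * card S ≤ 80 * deg S v) → Core
  core-from S n-large size dense = from-colouring (MinDegree.bipartite S (ℕₚ.≤-trans M₁≤M₀ large) dense)
    where
    large : M₀ ≤ card S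
    large = linear 3 (λ m n s → m :+ # 100 :≤ n ∷ n :≤ s :+ # 100 ∷ [] ⊢ m :≤ s) (M₀ ∷ n ∷ card S ∷ []) n-large size
    from-colouring : (Σ (Fin n → Bool) λ c → ∀ i j → S i ≡ true → S j ≡ true → i ~ j → c i ≢ c j) → Core
    from-colouring (c , ok) = record
      { X = X ; Y = Y
      ; disjoint = λ {i} x y → true≢false (trans (sym (∧-right {S i} x)) (not-true (∧-right {S i} y)))
      ; X-independent = λ {i} {j} x x′ e → ok i j (∧-left x) (∧-left x′) e (trans (∧-right {S i} x) (sym (∧-right {S j} x′)))
      ; Y-independent = λ {i} {j} y y′ e → ok i j (∧-left y) (∧-left y′) e (trans (not-true (∧-right {S i} y)) (sym (not-true (∧-right {S j} y′))))
      ; size = subst (λ z → n ≤ z + 100) (sym total) size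
      ; X-degree = Xd ; Y-degree = Yd
      ; X-size = proj₁ sizes ; Y-size = proj₂ sizes }
      where
      X Y : Pred n
      X i = S i ∧ c i
      Y i = S i ∧ not (c i)
      total : card X + card Y ≡ card S
      total = cards≡ (X ∷ Y ∷ []) (S ∷ []) (λ i → bit-split (S i) (c i))
      Xd : ∀ {i} → X i ≡ true → 39 * (card X + card Y) ≤ 80 * deg Y i
      Xd {i} x rewrite total = ℕₚ.≤-trans (dense i (∧-left x)) (ℕₚ.*-monoʳ-≤ 80 (card-mono (λ j h → ∧-intro (∧-intro (∧-left {S j} h)
        (cong not (≢true (λ cj → ok i j (∧-left x) (∧-left {S j} h) (∧-right {S j} h) (trans (∧-right {S i} x) (sym cj)))))) (∧-right {S j} h))))
      Yd : ∀ {i} → Y i ≡ true → 39 * (card X + card Y) ≤ 80 * deg X i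
      Yd {i} y rewrite total = ℕₚ.≤-trans (dense i (∧-left y)) (ℕₚ.*-monoʳ-≤ 80 (card-mono (λ j h → ∧-intro (∧-intro (∧-left {S j} h)
        (≢false (λ cj → ok i j (∧-left y) (∧-left {S j} h) (∧-right {S j} h) (trans (not-true (∧-right {S i} y)) (sym cj))))) (∧-right {S j} h))))
      m-pos : 1 ≤ card X + card Y
      m-pos = subst (1 ≤_) (sym total) (ℕₚ.≤-trans (linear 1 (λ c → [] ⊢ # 1 :≤ # 20 :* (c :+ # 1)) (C ∷ [])) large)
      grow : ∀ {d s} → 39 * (card X + card Y) ≤ 80 * d → d ≤ s → 39 * (card X + card Y) ≤ 80 * s
      grow h le = ℕₚ.≤-trans h (ℕₚ.*-monoʳ-≤ 80 le)
      some : ∀ {d} → 39 * (card X + card Y) ≤ 80 * d → 0 < d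
      some {d} h = linear 2 (λ m d → # 1 :≤ m ∷ # 39 :* m :≤ # 80 :* d ∷ [] ⊢ # 0 :< d) (card X + card Y ∷ d ∷ []) m-pos h
      sizes : 39 * (card X + card Y) ≤ 80 * card X × 39 * (card X + card Y) ≤ 80 * card Y
      sizes with card-pos⁻¹ S (subst (1 ≤_) total m-pos)
      ... | v , Sv with c v in cv
      ...   | true = let Xv = ∧-intro Sv cv ; (y , h) = card-pos⁻¹ (λ j → Y j ∧ adj G v j) (some (Xd Xv)) in
                grow (Yd (∧-left h)) (deg≤card X y) , grow (Xd Xv) (deg≤card Y v)
      ...   | false = let Yv = ∧-intro Sv (cong not cv) ; (x , h) = card-pos⁻¹ (λ j → X j ∧ adj G v j) (some (Yd Yv)) in
                grow (Yd Yv) (deg≤card X v) , grow (Xd (∧-left h)) (deg≤card Y x)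

  -- Each removal of a vertex of degree below 39/80 of the order raises
  -- 2 E - |S|² by at least n/24, so by turán there are fewer than 100 of them.
  find-core : M₀ + 100 ≤ n → 1000 ≤ n → n * n ≤ 2 * E all + 4 * n → Core
  find-core n-large n≥1000 many = loop 100 0 all refl (trans (ℕₚ.+-identityʳ _) (card-all {n}))
    (subst (λ z → 24 * (z * z) + 0 ≤ 24 * (2 * E all) + 96 * n) (sym (card-all {n}))
      (linear 3 (λ nn e n → nn :≤ # 2 :* e :+ # 4 :* n ∷ [] ⊢ # 24 :* nn :+ # 0 :≤ # 24 :* (# 2 :* e) :+ # 96 :* n) (n * n ∷ E all ∷ n ∷ []) many))
    where
    loop : ∀ f t S → f + t ≡ 100 → card S + t ≡ n → 24 * (card S * card S) + t * n ≤ 24 * (2 * E S) + 96 * n → Core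
    loop f t S f+t size potential with poor-or-dense S
    ... | inj₂ dense = core-from S n-large
      (linear 4 (λ f t s n → f :+ t :≡ # 100 ∷ s :+ t :≡ n ∷ [] ⊢ n :≤ s :+ # 100) (f ∷ t ∷ card S ∷ n ∷ []) f+t size) dense
    loop zero t S refl size potential | inj₁ _ = ⊥-elim (linear 3
      (λ ss e n → # 24 :* ss :+ # 100 :* n :≤ # 24 :* (# 2 :* e) :+ # 96 :* n ∷ # 2 :* e :≤ ss ∷ # 1 :≤ n ∷ [] ⊢ absurd)
      (card S * card S ∷ E S ∷ n ∷ []) potential
      (turán S (linear 3 (λ s n m → s :+ # 100 :≡ n ∷ m :+ # 100 :≤ n ∷ [] ⊢ m :≤ s) (card S ∷ n ∷ M₀ ∷ []) size n-large))
      (ℕₚ.≤-trans (s≤s z≤n) n≥1000))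
    loop (suc f) t S f+t size potential | inj₁ (v , Sv , poor) = loop f (suc t) (S ∖ v) (trans (ℕₚ.+-suc f t) f+t)
      (trans (ℕₚ.+-suc _ t) (trans (cong (_+ t) (sym (card-∖ S v Sv))) size))
      (linear 7 (λ m t n e e′ d f → # 24 :* ((# 1 :+ m) :* (# 1 :+ m)) :+ t :* n :≤ # 24 :* (# 2 :* e) :+ # 96 :* n ∷ e :≡ e′ :+ # 2 :* d ∷
          # 80 :* d :< # 39 :* (# 1 :+ m) ∷ # 1 :+ m :+ t :≡ n ∷ # 1 :+ f :+ t :≡ # 100 ∷ # 1000 :≤ n ∷ []
          ⊢ # 24 :* (m :* m) :+ (# 1 :+ t) :* n :≤ # 24 :* (# 2 :* e′) :+ # 96 :* n)
        (card (S ∖ v) ∷ t ∷ n ∷ E S ∷ E (S ∖ v) ∷ deg S v ∷ f ∷ [])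
        (subst (λ m → 24 * (m * m) + t * n ≤ 24 * (2 * E S) + 96 * n) (card-∖ S v Sv) potential)
        (E-remove S v Sv) (subst (λ m → 80 * deg S v < 39 * m) (card-∖ S v Sv) poor)
        (trans (cong (_+ t) (sym (card-∖ S v Sv))) size) f+t n≥1000)

  minus : Pred n → List (Fin n) → Pred n
  minus p [] = p
  minus p (v ∷ vs) = minus (p ∖ v) vs

  degrees : List (Fin n) → ℕ
  degrees [] = 0
  degrees (v ∷ vs) = deg all v + degrees vs

  E-minus : ∀ p vs → E p ≤ E (minus p vs) + 2 * degrees vs
  E-minus p [] = ℕₚ.m≤m+n _ _
  E-minus p (v ∷ vs) = linear 5 (λ e e′ e″ d ds → e :≤ e′ :+ # 2 :* d ∷ e′ :≤ e″ :+ # 2 :* ds ∷ [] ⊢ e :≤ e″ :+ # 2 :* (d :+ ds))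
    (E p ∷ E (p ∖ v) ∷ E (minus (p ∖ v) vs) ∷ deg all v ∷ degrees vs ∷ []) (E-remove≤ p v) (E-minus (p ∖ v) vs)

  card-minus : ∀ {F} p vs → (∀ {i} → i ∉ F → p i ≡ true) → Fresh F vs → card p ≡ length vs + card (minus p vs)
  card-minus p [] _ _ = refl
  card-minus p (v ∷ vs) h (v∉ , fresh) = trans (card-∖ p v (h v∉))
    (cong suc (card-minus (p ∖ v) vs (λ {i} i∉ → ∖-intro p (h (i∉ ∘ there)) (i∉ ∘ here)) fresh))

  -- The rest still obeys the Turán bound, so a nearly extremal graph cannot contain a few vertices
  -- of small total degree. Configurations that theta-freeness alone permits are excluded through
  -- this inequality.
  peel : ∀ vs → Fresh [] vs → length vs ≤ 100 → M₀ + 100 ≤ n →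
    ∃[ m ] n ≡ length vs + m × 2 * E all ≤ m * m + 4 * degrees vs
  peel vs fresh short n-large = card (minus all vs) , size ,
    linear 4 (λ e e′ mm d → e :≤ e′ :+ # 2 :* d ∷ # 2 :* e′ :≤ mm ∷ [] ⊢ # 2 :* e :≤ mm :+ # 4 :* d)
      (E all ∷ E (minus all vs) ∷ card (minus all vs) * card (minus all vs) ∷ degrees vs ∷ []) (E-minus all vs)
      (turán (minus all vs) (linear 4 (λ m n l s → l :≤ # 100 ∷ m :+ # 100 :≤ n ∷ n :≡ l :+ s ∷ [] ⊢ m :≤ s)
        (M₀ ∷ n ∷ length vs ∷ card (minus all vs) ∷ []) short n-large size))
    where
    size : n ≡ length vs + card (minus all vs)
    size = trans (sym (card-all {n})) (card-minus all vs (λ _ → refl) fresh)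

-- Near-extremal graphs are bipartite up to one or two vertices

data Regime (a r : ℕ) : Set where
  two-two : a ≡ 0 → r ≡ 2 → Regime a r
  r-even : ∀ b → r ≡ suc (suc b) * 2 → Regime a r
  two-odd : a ≡ 0 → ∀ b → r ≡ suc (suc b * 2) → Regime a r
  big-odd : ∀ a′ → a ≡ suc a′ → ∀ b → r ≡ suc (suc b * 2) → Regime a r

parityOf : ∀ {a r} → Regime a r → Parity r
parityOf (two-two _ e) = even 0 e
parityOf (r-even b e) = even (suc b) e
parityOf (two-odd _ b e) = odd b e
parityOf (big-odd _ _ b e) = odd b e

module Structure (q r a : ℕ) (q≡ : q ≡ suc a * 2) (regime : Regime a r) (K : ℕ) (K-large : q + r + 10 ≤ K)
                 {n : ℕ} (G : Graph n) (free : Free G (q + r) (thetaAdj q r)) where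
  open Extremal q r a q≡ (parityOf regime) K K-large G free public

  -- θ(1,2,2) is the complete graph on four vertices less an edge.
  no-diamond : a ≡ 0 → r ≡ 2 → ∀ {u u′ y y′} → u ~ u′ → u ~ y → u′ ~ y → u ~ y′ → u′ ~ y′ → y ≢ y′ → ⊥
  no-diamond a≡0 r≡2 {u} {u′} {y} {y′} uu′ uy u′y uy′ u′y′ ne = no-theta (y ∷ []) (y′ ∷ []) (s≤s z≤n) uu′
    (λ { (here refl) (here e) → ~⇒≢ uy (sym e) ; (here refl) (there (here e)) → ~⇒≢ u′y (sym e) ; (here refl) (there (there (here e))) → ne e })
    (λ { (here refl) (here e) → ~⇒≢ uy′ (sym e) ; (here refl) (there (here e)) → ~⇒≢ u′y′ (sym e) })
    (subst (Conn (y ∷ []) u u′) (sym (trans q≡ (cong (λ z → suc z * 2) a≡0))) (conn-cons uy (λ ()) (conn-edge (~-sym u′y))))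
    (subst (Conn (y′ ∷ []) u u′) (sym r≡2) (conn-cons uy′ (λ ()) (conn-edge (~-sym u′y′))))

  record Sufficient : Set where
    field
      n≥M₀ : M₀ + 100 ≤ n
      n≥10⁵ : 100000 ≤ n
      n≥200K : 200 * K ≤ n

  module Large (sufficient : Sufficient) where
    open Sufficient sufficient

    K-pos : 1 ≤ K
    K-pos = linear 3 (λ q r k → q :+ r :+ # 10 :≤ k ∷ [] ⊢ # 1 :≤ k) (q ∷ r ∷ K ∷ []) K-large

    a-cases : ∀ a → a ≡ 0 ⊎ ∃[ a′ ] a ≡ suc a′
    a-cases zero = inj₁ refl
    a-cases (suc a′) = inj₂ (a′ , refl)

    -- The bound exceeds the number, at most n/40, of vertices on the other side
    -- that a core vertex misses.
    record Rich (p : Pred n) (v : Fin n) : Set where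
      constructor by
      field
        bound : n ≤ 32 * deg p v
    open Rich

    module Half (core : Core) where
      open Core core

      rich rich′ : Fin n → Set
      rich v = Rich Y v
      rich′ v = Rich X v

      X+Y≤n : card X + card Y ≤ n
      X+Y≤n = subst (card X + card Y ≤_) card-all (cards≤ (X ∷ Y ∷ []) (all ∷ []) pt)
        where
        pt : ∀ i → bit (X i) + bit (Y i) ≤ 1
        pt i with X i in x | Y i in y
        ... | false | false = z≤n
        ... | false | true = s≤s z≤n
        ... | true | false = s≤s z≤n
        ... | true | true = ⊥-elim (disjoint x y)

      deg-sum : ∀ u v → deg Y u + deg Y v ≤ card Y + common Y u v
      deg-sum u v = cards≤ ((λ i → Y i ∧ adj G u i) ∷ (λ i → Y i ∧ adj G v i) ∷ []) (Y ∷ (λ i → Y i ∧ (adj G u i ∧ adj G v i)) ∷ [])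
        (λ i → bool≤ 3 (λ y s t → bit (y ∧ s) + bit (y ∧ t)) (λ y s t → bit y + bit (y ∧ (s ∧ t))) (Y i ∷ adj G u i ∷ adj G v i ∷ []))

      -- A core vertex of X misses at most n/40 of Y, and u has n/32 neighbours there. The
      -- difference n/160 is at least K because n ≥ 200K.
      joint : ∀ {u x} → rich u → X x ≡ true → K ≤ common Y u x
      joint {u} {x} Ru Xx = linear 7 (λ n x y u v c k → n :≤ # 32 :* u ∷ # 39 :* (x :+ y) :≤ # 80 :* v ∷ # 39 :* (x :+ y) :≤ # 80 :* x ∷
          x :+ y :≤ n ∷ u :+ v :≤ y :+ c ∷ # 200 :* k :≤ n ∷ [] ⊢ k :≤ c)
        (n ∷ card X ∷ card Y ∷ deg Y u ∷ deg Y x ∷ common Y u x ∷ K ∷ [])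
        (bound Ru) (X-degree Xx) X-size X+Y≤n (deg-sum u x) n≥200K

      enough : ∀ d → 39 * (card X + card Y) ≤ 80 * d → n ≤ 32 * d
      enough d h = linear 4 (λ n x y d → # 39 :* (x :+ y) :≤ # 80 :* d ∷ n :≤ x :+ y :+ # 100 ∷ # 100000 :≤ n ∷ [] ⊢ n :≤ # 32 :* d)
        (n ∷ card X ∷ card Y ∷ d ∷ []) h size n≥10⁵

      K≤ : ∀ d → n ≤ 32 * d → K ≤ d
      K≤ d h = linear 3 (λ n k d → n :≤ # 32 :* d ∷ # 200 :* k :≤ n ∷ [] ⊢ k :≤ d) (n ∷ K ∷ d ∷ []) h n≥200K

      X⇒rich : ∀ {x} → X x ≡ true → rich x
      X⇒rich {x} Xx = by (enough (deg Y x) (X-degree Xx))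

      Y⇒rich′ : ∀ {y} → Y y ≡ true → rich′ y
      Y⇒rich′ {y} Yy = by (enough (deg X y) (Y-degree Yy))

      module H = Hub X rich X⇒rich (K≤ (card X) (enough (card X) X-size))
        (λ {u} {x} Ru Xx → ℕₚ.≤-trans (joint {u} {x} Ru Xx) (common-mono Y u x))

      conn-even : ∀ j {u x} → rich u → X x ≡ true → Conn [] u x (suc j * 2)
      conn-even = H.conn-even

      conn-odd : ∀ j {u v} → rich u → rich′ v → (u ~ v) ⊎ (1 ≤ j) → Conn [] u v (suc (j * 2))
      conn-odd j {u} {v} Ru Rv = H.conn-odd j Ru (K≤ (deg X v) (bound Rv))

      conn-YY : ∀ j {u v} → rich u → rich v → Conn [] u v (suc (suc j) * 2)
      conn-YY j {u} Ru Rv = conn-pick Y (K≤ (deg Y u) (bound Ru)) (λ y Yy _ → conn-sym (conn-odd (suc j) Rv (Y⇒rich′ Yy) (inj₂ (s≤s z≤n))))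

      neighbour : ∀ {u} → rich u → ∃[ y ] Y y ≡ true × u ~ y
      neighbour {u} Ru with card-pos⁻¹ (λ j → Y j ∧ adj G u j) (ℕₚ.≤-trans K-pos (K≤ (deg Y u) (bound Ru)))
      ... | y , h = y , ∧-left h , ∧-right {Y y} h

      -- Let x in X be adjacent to v, and let y in Y be a common neighbour of both. For even r the
      -- edge vx is the chord, since paths from v to x through Y are even. For odd r the chord is
      -- xy, and the detour x, v followed by an odd path to y has even length.
      one-sided : ∀ {v} → rich v → 0 < deg X v → ⊥
      one-sided {v} Rv dpos with card-pos⁻¹ (λ j → X j ∧ adj G v j) dpos
      ... | x , h with card-pos⁻¹ (λ j → Y j ∧ (adj G v j ∧ adj G x j)) (ℕₚ.≤-trans K-pos (joint {v} {x} Rv (∧-left h)))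
      ... | y , h′ = by-parity (parityOf regime)
        where
        Xx : X x ≡ true
        Xx = ∧-left h
        Yy : Y y ≡ true
        Yy = ∧-left h′
        vx : v ~ x
        vx = ∧-right {X x} h
        vy : v ~ y
        vy = ∧-left (∧-right {Y y} h′)
        xy : x ~ y
        xy = ∧-right {adj G v y} (∧-right {Y y} h′)
        by-parity : Parity r → ⊥
        by-parity (even b r≡) = no-theta [] [] z≤n vx (λ ()) (λ ())
          (subst (Conn [] v x) (sym q≡) (conn-even a Rv Xx)) (subst (Conn [] v x) (sym r≡) (conn-even b Rv Xx))
        by-parity (odd b r≡) = no-theta (v ∷ []) [] z≤n xy
          (λ { (here refl) (here e) → ~⇒≢ vx e ; (here refl) (there (here e)) → ~⇒≢ vy e }) (λ ())
          (subst (Conn (v ∷ []) x y) (sym q≡) (conn-cons (~-sym vx) (λ ()) (conn-odd a Rv (Y⇒rich′ Yy) (inj₁ vy))))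
          (subst (Conn [] x y) (sym r≡) (conn-odd (suc b) (X⇒rich Xx) (Y⇒rich′ Yy) (inj₂ (s≤s z≤n))))

      exclusive : ∀ {v} → rich v → rich′ v → ⊥
      exclusive {v} Rv Rv′ = one-sided Rv (ℕₚ.≤-trans K-pos (K≤ (deg X v) (bound Rv′)))

      rich≢rich′ : ∀ {u v} → rich u → rich′ v → u ≢ v
      rich≢rich′ Ru Rv refl = exclusive Ru Rv

      -- The chord is uy: an odd path joins its ends directly, and passing first to u′ changes the
      -- parity. The last argument supplies the odd path from u′ to y, which is a single edge when q
      -- = 2.
      conflict-odd : ∀ b → r ≡ suc (suc b * 2) → ∀ {u u′ y} → u ~ u′ → rich u → rich u′ → rich′ y → u ~ y → (u′ ~ y) ⊎ (1 ≤ a) → ⊥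
      conflict-odd b r≡ {u} {u′} {y} uu′ Ru Ru′ Ry uy alt = no-theta (u′ ∷ []) [] z≤n uy
        (λ { (here refl) (here e) → ~⇒≢ uu′ (sym e) ; (here refl) (there (here e)) → rich≢rich′ Ru′ Ry e }) (λ ())
        (subst (Conn (u′ ∷ []) u y) (sym q≡) (conn-cons uu′ (λ ()) (conn-odd a Ru′ Ry alt)))
        (subst (Conn [] u y) (sym r≡) (conn-odd (suc b) Ru Ry (inj₂ (s≤s z≤n))))

      -- The edge uu′ is the chord. For q = 2 the vertex y is the inner vertex of the short path;
      -- for larger q both paths come from `conn-YY`.
      conflict-even : ∀ b → r ≡ suc (suc b) * 2 → ∀ {u u′ y} → u ~ u′ → rich u → rich u′ → u ~ y → u′ ~ y → ⊥
      conflict-even b r≡ {u} {u′} {y} uu′ Ru Ru′ uy u′y with a-cases a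
      ... | inj₁ a≡0 = no-theta (y ∷ []) [] z≤n uu′
        (λ { (here refl) (here e) → ~⇒≢ uy (sym e) ; (here refl) (there (here e)) → ~⇒≢ u′y (sym e) }) (λ ())
        (subst (Conn (y ∷ []) u u′) (sym (trans q≡ (cong (λ z → suc z * 2) a≡0))) (conn-cons uy (λ ()) (conn-edge (~-sym u′y))))
        (subst (Conn [] u u′) (sym r≡) (conn-YY b Ru Ru′))
      ... | inj₂ (a′ , a≡) = no-theta [] [] z≤n uu′ (λ ()) (λ ())
        (subst (Conn [] u u′) (sym (trans q≡ (cong (λ z → suc z * 2) a≡))) (conn-YY a′ Ru Ru′))
        (subst (Conn [] u u′) (sym r≡) (conn-YY b Ru Ru′))

      common≤1 : ∀ {u u′} → u ~ u′ → rich u → rich u′ → common Y u u′ ≤ 1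
      common≤1 {u} {u′} uu′ Ru Ru′ = ℕₚ.≮⇒≥ λ h → first h (pick [] Z (ℕₚ.≤-trans (s≤s z≤n) h))
        where
        Z : Pred n
        Z j = Y j ∧ (adj G u j ∧ adj G u′ j)
        uZ : ∀ {y} → Z y ≡ true → u ~ y
        uZ {y} h = ∧-left (∧-right {Y y} h)
        u′Z : ∀ {y} → Z y ≡ true → u′ ~ y
        u′Z {y} h = ∧-right {adj G u y} (∧-right {Y y} h)
        by-regime : ∀ {y y′} → Z y ≡ true → Z y′ ≡ true → y ≢ y′ → Regime a r → ⊥
        by-regime h h′ ne (two-two a≡ r≡) = no-diamond a≡ r≡ uu′ (uZ h) (u′Z h) (uZ h′) (u′Z h′) ne
        by-regime h h′ ne (r-even b r≡) = conflict-even b r≡ uu′ Ru Ru′ (uZ h) (u′Z h)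
        by-regime h h′ ne (two-odd _ b r≡) = conflict-odd b r≡ uu′ Ru Ru′ (Y⇒rich′ (∧-left h)) (uZ h) (inj₁ (u′Z h))
        by-regime h h′ ne (big-odd _ _ b r≡) = conflict-odd b r≡ uu′ Ru Ru′ (Y⇒rich′ (∧-left h)) (uZ h) (inj₁ (u′Z h))
        first : 1 < card Z → (∃[ y ] Z y ≡ true × y ∉ []) → ⊥
        first h (y , Zy , _) = second (pick (y ∷ []) Z h)
          where
          second : (∃[ y′ ] Z y′ ≡ true × y′ ∉ (y ∷ [])) → ⊥
          second (y′ , Zy′ , y′∉) = by-regime Zy Zy′ (λ e → y′∉ (here (sym e))) regime

      degree-bound : ∀ v → deg all v ≤ deg X v + deg Y v + 100
      degree-bound v = linear 7 (λ d x y o n cx cy → d :≤ x :+ (y :+ o) ∷ cx :+ (cy :+ o) :≤ n ∷ n :≤ cx :+ cy :+ # 100 ∷ [] ⊢ d :≤ x :+ y :+ # 100)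
        (deg all v ∷ deg X v ∷ deg Y v ∷ card O ∷ n ∷ card X ∷ card Y ∷ [])
        (cards≤ ((λ j → adj G v j) ∷ []) ((λ j → X j ∧ adj G v j) ∷ (λ j → Y j ∧ adj G v j) ∷ O ∷ [])
          (λ j → bool≤ 3 (λ x y e → bit e) (λ x y e → bit (x ∧ e) + (bit (y ∧ e) + bit (not x ∧ not y))) (X j ∷ Y j ∷ adj G v j ∷ [])))
        (subst (card X + (card Y + card O) ≤_) card-all (cards≤ (X ∷ Y ∷ O ∷ []) (all ∷ []) pt)) size
        where
        O : Pred n
        O j = not (X j) ∧ not (Y j)
        pt : ∀ i → bit (X i) + (bit (Y i) + bit (not (X i) ∧ not (Y i))) ≤ 1
        pt i with X i in x | Y i in y
        ... | false | false = s≤s z≤n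
        ... | false | true = s≤s z≤n
        ... | true | false = s≤s z≤n
        ... | true | true = ⊥-elim (disjoint x y)

      rich-degree : ∀ {v} → rich v → deg all v ≤ deg Y v + 100
      rich-degree {v} Rv = subst (λ z → deg all v ≤ z + deg Y v + 100) none (degree-bound v)
        where
        none : deg X v ≡ 0
        none with deg X v in e
        ... | zero = refl
        ... | suc _ = ⊥-elim (one-sided Rv (subst (0 <_) (sym e) (s≤s z≤n)))

      -- Neighbours of both vertices lie in Y, which has at most 41n/80 vertices, up to 100 vertices
      -- each outside the core. Two almost disjoint neighbourhoods on one side thus have joint size
      -- near n/2 instead of n, which `peel` punishes.
      pair-degree : ∀ {u u′ k} → rich u → rich u′ → common Y u u′ ≤ k → 80 * (deg all u + deg all u′) ≤ 41 * n + 80 * k + 16000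
      pair-degree {u} {u′} {k} Ru Ru′ h = linear 9 (λ u d u′ d′ c x y n k → u :≤ d :+ # 100 ∷ u′ :≤ d′ :+ # 100 ∷ d :+ d′ :≤ y :+ c ∷ c :≤ k ∷
          # 39 :* (x :+ y) :≤ # 80 :* x ∷ x :+ y :≤ n ∷ [] ⊢ # 80 :* (u :+ u′) :≤ # 41 :* n :+ # 80 :* k :+ # 16000)
        (deg all u ∷ deg Y u ∷ deg all u′ ∷ deg Y u′ ∷ common Y u u′ ∷ card X ∷ card Y ∷ n ∷ k ∷ [])
        (rich-degree Ru) (rich-degree Ru′) (deg-sum u u′) h X-size X+Y≤n

      conflict-degree : ∀ {u u′} → u ~ u′ → rich u → rich u′ → 80 * (deg all u + deg all u′) ≤ 41 * n + 16080
      conflict-degree {u} {u′} uu′ Ru Ru′ = linear 4 (λ d d′ n k → # 80 :* (d :+ d′) :≤ # 41 :* n :+ # 80 :* k :+ # 16000 ∷ k :≤ # 1 ∷ [] ⊢ # 80 :* (d :+ d′) :≤ # 41 :* n :+ # 16080)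
        (deg all u ∷ deg all u′ ∷ n ∷ common Y u u′ ∷ []) (pair-degree {k = common Y u u′} Ru Ru′ ℕₚ.≤-refl) (common≤1 uu′ Ru Ru′)

      triangle-odd : a ≡ 0 → ∀ b → r ≡ suc (suc b * 2) → ∀ {w x y} → w ~ x → w ~ y → x ~ y → rich x → rich′ y → ⊥
      triangle-odd a≡0 b r≡ {w} {x} {y} wx wy xy Rx Ry = no-theta (w ∷ []) [] z≤n xy
        (λ { (here refl) (here e) → ~⇒≢ wx e ; (here refl) (there (here e)) → ~⇒≢ wy e }) (λ ())
        (subst (Conn (w ∷ []) x y) (sym (trans q≡ (cong (λ z → suc z * 2) a≡0))) (conn-cons (~-sym wx) (λ ()) (conn-edge wy)))
        (subst (Conn [] x y) (sym r≡) (conn-odd (suc b) Rx Ry (inj₂ (s≤s z≤n))))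

      -- The chord is wy. Entering at x and entering at z both leave an odd path to y, so both
      -- detours are even; x and z are reserved in advance to keep them disjoint.
      triangle-even : ∀ b → r ≡ suc (suc b) * 2 → ∀ {w x y z} → w ~ x → w ~ y → x ~ y → rich x → rich′ y → w ~ z → rich z → z ≢ x → ⊥
      triangle-even b r≡ {w} {x} {y} {z} wx wy xy Rx Ry wz Rz z≢x = no-theta (x ∷ []) (z ∷ []) (s≤s z≤n) wy
        (λ { (here refl) (here e) → ~⇒≢ wx (sym e) ; (here refl) (there (here e)) → ~⇒≢ xy e ; (here refl) (there (there (here e))) → z≢x (sym e) })
        (λ { (here refl) (here e) → ~⇒≢ wz (sym e) ; (here refl) (there (here e)) → rich≢rich′ Rz Ry e })
        (subst (Conn (x ∷ []) w y) (sym q≡) (conn-cons wx (λ ()) (conn-odd a Rx Ry (inj₁ xy))))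
        (subst (Conn (z ∷ []) w y) (sym r≡) (conn-cons wz (λ ()) (conn-odd (suc b) Rz Ry (inj₂ (s≤s z≤n)))))

    -- What theta-freeness imposes on a triangle w x y with x and y on opposite sides.
    Tri : Regime a r → Fin n → Fin n → Fin n → Set
    Tri (two-two _ _) w x y = ⊤
    Tri (r-even _ _) w x y = ∀ z → w ~ z → z ≡ x ⊎ z ≡ y
    Tri (two-odd _ _ _) w x y = ⊥
    Tri (big-odd _ _ _ _) w x y = ⊤

    Proper : Pred n → (Fin n → Bool) → Set
    Proper p c = ∀ {i j} → p i ≡ true → p j ≡ true → i ~ j → c i ≢ c j

    record Near : Set where
      field
        w : Fin n
        c : Fin n → Bool
        proper : Proper (all ∖ w) c
        triangle : ∀ {x y} → w ~ x → w ~ y → x ~ y → c x ≢ c y → Tri regime w x y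

    find-conflict : ∀ p c → (∃[ i ] ∃[ j ] p i ≡ true × p j ≡ true × i ~ j × c i ≡ c j) ⊎ Proper p c
    find-conflict p c with Finₚ.any? (λ i → Finₚ.any? (λ j → (p i ∧ (p j ∧ (adj G i j ∧ eqᵇ (c i) (c j)))) Boolₚ.≟ true))
    ... | yes (i , j , h) = inj₁ (i , j , ∧-left h , ∧-left (∧-right {p i} h) , ∧-left (∧-right {p j} (∧-right {p i} h)) ,
            eqᵇ-sound (subst T (sym (∧-right {adj G i j} (∧-right {p j} (∧-right {p i} h)))) tt))
    ... | no none = inj₂ (λ {i} {j} pi pj e same → none (i , j , ∧-intro pi (∧-intro pj (∧-intro e (trans (cong (eqᵇ (c i)) (sym same)) (eqᵇ-refl (c i)))))))

    module WithCore (core : Core) where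
      open Core core
      module L = Half core
      module R = Half (swap core)

      -- True marks vertices that behave like X, by having many neighbours in Y. For vertices in
      -- `low` the value carries no information.
      c : Fin n → Bool
      c v = n ≤ᵇ 32 * deg Y v

      low : Pred n
      low v = not (n ≤ᵇ 32 * deg Y v) ∧ not (n ≤ᵇ 32 * deg X v)

      rich-of : ∀ {v} → c v ≡ true → L.rich v
      rich-of {v} e = by (true-≤ᵇ {n} {32 * deg Y v} e)

      rich′-of : ∀ {v} → low v ≡ false → c v ≡ false → R.rich v
      rich′-of {v} h e = by (true-≤ᵇ {n} {32 * deg X v} (bool⇒ 2 (λ a b → not a ∧ not (not a ∧ not b)) (λ a b → b) (c v ∷ (n ≤ᵇ 32 * deg X v) ∷ [])
        (∧-intro (cong not e) (cong not h))))

      low-degree : ∀ {v} → low v ≡ true → 16 * deg all v ≤ n + 1600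
      low-degree {v} h = linear 4 (λ d x y n → d :≤ x :+ y :+ # 100 ∷ # 32 :* y :< n ∷ # 32 :* x :< n ∷ [] ⊢ # 16 :* d :≤ n :+ # 1600)
        (deg all v ∷ deg X v ∷ deg Y v ∷ n ∷ []) (L.degree-bound v) (below (not-true (∧-left h))) (below (not-true (∧-right {not (c v)} h)))
        where
        below : ∀ {d} → (n ≤ᵇ d) ≡ false → d < n
        below e = ℕₚ.≰⇒> (λ le → true≢false (trans (sym (≤ᵇ-true le)) e))

      deg≤all : ∀ p v → deg p v ≤ deg all v
      deg≤all p v = card-mono {p = λ j → p j ∧ adj G v j} {q = adj G v} (λ j → ∧-right {p j})

      nonlow-degree : ∀ {v} → low v ≡ false → n ≤ 32 * deg all v
      nonlow-degree {v} h = by-colour (c v) refl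
        where
        by-colour : ∀ β → c v ≡ β → n ≤ 32 * deg all v
        by-colour true e = ℕₚ.≤-trans (bound (rich-of e)) (ℕₚ.*-monoʳ-≤ 32 (deg≤all Y v))
        by-colour false e = ℕₚ.≤-trans (bound (rich′-of h e)) (ℕₚ.*-monoʳ-≤ 32 (deg≤all X v))

      conflict-degree : ∀ {u u′} → low u ≡ false → low u′ ≡ false → u ~ u′ → c u ≡ c u′ → 80 * (deg all u + deg all u′) ≤ 41 * n + 16080
      conflict-degree {u} {u′} lu lu′ e same = by-colour (c u) refl
        where
        by-colour : ∀ b → c u ≡ b → 80 * (deg all u + deg all u′) ≤ 41 * n + 16080
        by-colour true cu = L.conflict-degree e (rich-of cu) (rich-of (trans (sym same) cu))
        by-colour false cu = R.conflict-degree e (rich′-of lu cu) (rich′-of lu′ (trans (sym same) cu))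

      low≢ : ∀ {u v} → low u ≡ true → low v ≡ false → u ≢ v
      low≢ lu lv refl = true≢false (trans (sym lu) lv)

      conflict-triangle : ∀ {w x y} → low w ≡ false → low x ≡ false → low y ≡ false → w ~ x → w ~ y → x ~ y → c w ≡ c x → c x ≢ c y →
        ∀ ρ → Tri ρ w x y
      conflict-triangle lw lx ly wx wy xy same differ (two-two _ _) = tt
      conflict-triangle lw lx ly wx wy xy same differ (big-odd _ _ _ _) = tt
      conflict-triangle {w} {x} {y} lw lx ly wx wy xy same differ (r-even b r≡) z _ = ⊥-elim (by-colour (c x) refl)
        where
        by-colour : ∀ β → c x ≡ β → ⊥
        by-colour true cx = L.conflict-even b r≡ wx (rich-of (trans same cx)) (rich-of cx) wy xy
        by-colour false cx = R.conflict-even b r≡ wx (rich′-of lw (trans same cx)) (rich′-of lx cx) wy xy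
      conflict-triangle {w} {x} {y} lw lx ly wx wy xy same differ (two-odd _ b r≡) = by-colour (c x) (c y) refl refl
        where
        by-colour : ∀ β γ → c x ≡ β → c y ≡ γ → ⊥
        by-colour true false cx cy = L.conflict-odd b r≡ wx (rich-of (trans same cx)) (rich-of cx) (rich′-of ly cy) wy (inj₁ xy)
        by-colour false true cx cy = R.conflict-odd b r≡ wx (rich′-of lw (trans same cx)) (rich′-of lx cx) (rich-of cy) wy (inj₁ xy)
        by-colour true true cx cy = differ (trans cx (sym cy))
        by-colour false false cx cy = differ (trans cx (sym cy))

      Tri-sym : ∀ ρ {w x y} → Tri ρ w x y → Tri ρ w y x
      Tri-sym (two-two _ _) t = tt
      Tri-sym (big-odd _ _ _ _) t = tt
      Tri-sym (r-even _ _) t z e = case t z e of λ { (inj₁ h) → inj₂ h ; (inj₂ h) → inj₁ h }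

      distinct₂ : ∀ {x y : Fin n} → x ≢ y → Fresh [] (x ∷ y ∷ [])
      distinct₂ xy = (λ ()) , (λ { (here e) → xy (sym e) }) , tt

      distinct₃ : ∀ {x y z : Fin n} → x ≢ y → x ≢ z → y ≢ z → Fresh [] (x ∷ y ∷ z ∷ [])
      distinct₃ xy xz yz = (λ ()) , (λ { (here e) → xy (sym e) }) , (λ { (here e) → yz (sym e) ; (there (here e)) → xz (sym e) }) , tt

      distinct₄ : ∀ {x y z t : Fin n} → x ≢ y → x ≢ z → x ≢ t → y ≢ z → y ≢ t → z ≢ t → Fresh [] (x ∷ y ∷ z ∷ t ∷ [])
      distinct₄ xy xz xt yz yt zt = (λ ()) , (λ { (here e) → xy (sym e) }) , (λ { (here e) → yz (sym e) ; (there (here e)) → xz (sym e) }) ,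
        (λ { (here e) → zt (sym e) ; (there (here e)) → yt (sym e) ; (there (there (here e))) → xt (sym e) }) , tt

      module Near-proof (n′ : ℕ) (n≡ : n ≡ suc n′) (many : n′ * n′ + 3 ≤ 2 * E all) where

        many-at : ∀ {k} → n ≡ suc k → k * k + 3 ≤ 2 * E all
        many-at e = subst (λ z → z * z + 3 ≤ 2 * E all) (ℕₚ.suc-injective (trans (sym n≡) e)) many

        -- The common mechanism of this and the next three lemmas: if 4e ≥ (n-1)² + 3, then by
        -- `peel` any j deleted vertices have total degree at least (j-1)(n-j)/2. Here the total is
        -- only about n/8.
        two-low : ∀ {u v} → low u ≡ true → low v ≡ true → u ≢ v → ⊥
        two-low {u} {v} lu lv ne with peel (u ∷ v ∷ []) (distinct₂ ne) (s≤s (s≤s z≤n)) n≥M₀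
        ... | m , n≡2+m , le = linear 5 (λ m n e d d′ → # 16 :* d :≤ n :+ # 1600 ∷ # 16 :* d′ :≤ n :+ # 1600 ∷ n :≡ # 2 :+ m ∷ # 100000 :≤ n ∷
              # 2 :* e :≤ m :* m :+ # 4 :* (d :+ (d′ :+ # 0)) ∷ (# 1 :+ m) :* (# 1 :+ m) :+ # 3 :≤ # 2 :* e ∷ [] ⊢ absurd)
            (m ∷ n ∷ E all ∷ deg all u ∷ deg all v ∷ []) (low-degree lu) (low-degree lv) n≡2+m n≥10⁵ le (many-at n≡2+m)

        low+conflict : ∀ {w u v} → low w ≡ true → low u ≡ false → low v ≡ false → u ~ v → c u ≡ c v → ⊥
        low+conflict {w} {u} {v} lw lu lv uv same
          with peel (w ∷ u ∷ v ∷ []) (distinct₃ (low≢ lw lu) (low≢ lw lv) (~⇒≢ uv)) (s≤s (s≤s (s≤s z≤n))) n≥M₀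
        ... | m , n≡3+m , le = linear 6 (λ m n e d d′ d″ → # 16 :* d :≤ n :+ # 1600 ∷ # 80 :* (d′ :+ d″) :≤ # 41 :* n :+ # 16080 ∷ n :≡ # 3 :+ m ∷ # 100000 :≤ n ∷
              # 2 :* e :≤ m :* m :+ # 4 :* (d :+ (d′ :+ (d″ :+ # 0))) ∷ (# 2 :+ m) :* (# 2 :+ m) :+ # 3 :≤ # 2 :* e ∷ [] ⊢ absurd)
            (m ∷ n ∷ E all ∷ deg all w ∷ deg all u ∷ deg all v ∷ []) (low-degree lw) (conflict-degree lu lv uv same) n≡3+m n≥10⁵ le (many-at n≡3+m)

        -- The tightest case. The two pair bounds give 82n/80, too much on its own, but they count
        -- the middle vertex twice. Its degree is at least n/32, which leaves 159n/160 plus a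
        -- constant near 400, and n ≥ 100000 keeps this below n.
        conflict-path : ∀ {u v w} → low u ≡ false → low v ≡ false → low w ≡ false → u ~ v → c u ≡ c v → v ~ w → c v ≡ c w → u ≢ w → ⊥
        conflict-path {u} {v} {w} lu lv lw uv cuv vw cvw ne
          with peel (u ∷ v ∷ w ∷ []) (distinct₃ (~⇒≢ uv) ne (~⇒≢ vw)) (s≤s (s≤s (s≤s z≤n))) n≥M₀
        ... | m , n≡3+m , le = linear 6 (λ m n e d d′ d″ → # 80 :* (d :+ d′) :≤ # 41 :* n :+ # 16080 ∷ # 80 :* (d′ :+ d″) :≤ # 41 :* n :+ # 16080 ∷ n :≤ # 32 :* d′ ∷
              n :≡ # 3 :+ m ∷ # 100000 :≤ n ∷
              # 2 :* e :≤ m :* m :+ # 4 :* (d :+ (d′ :+ (d″ :+ # 0))) ∷ (# 2 :+ m) :* (# 2 :+ m) :+ # 3 :≤ # 2 :* e ∷ [] ⊢ absurd)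
            (m ∷ n ∷ E all ∷ deg all u ∷ deg all v ∷ deg all w ∷ [])
            (conflict-degree lu lv uv cuv) (conflict-degree lv lw vw cvw) (nonlow-degree lv) n≡3+m n≥10⁵ le (many-at n≡3+m)

        conflict-matching : ∀ {u v x y} → low u ≡ false → low v ≡ false → low x ≡ false → low y ≡ false →
          u ~ v → c u ≡ c v → x ~ y → c x ≡ c y → u ≢ x → u ≢ y → v ≢ x → v ≢ y → ⊥
        conflict-matching {u} {v} {x} {y} lu lv lx ly uv cuv xy cxy ux uy vx vy
          with peel (u ∷ v ∷ x ∷ y ∷ []) (distinct₄ (~⇒≢ uv) ux uy vx vy (~⇒≢ xy)) (s≤s (s≤s (s≤s (s≤s z≤n)))) n≥M₀
        ... | m , n≡4+m , le = linear 7 (λ m n e d d′ f f′ → # 80 :* (d :+ d′) :≤ # 41 :* n :+ # 16080 ∷ # 80 :* (f :+ f′) :≤ # 41 :* n :+ # 16080 ∷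
              n :≡ # 4 :+ m ∷ # 100000 :≤ n ∷
              # 2 :* e :≤ m :* m :+ # 4 :* (d :+ (d′ :+ (f :+ (f′ :+ # 0)))) ∷ (# 3 :+ m) :* (# 3 :+ m) :+ # 3 :≤ # 2 :* e ∷ [] ⊢ absurd)
            (m ∷ n ∷ E all ∷ deg all u ∷ deg all v ∷ deg all x ∷ deg all y ∷ [])
            (conflict-degree lu lv uv cuv) (conflict-degree lx ly xy cxy) n≡4+m n≥10⁵ le (many-at n≡4+m)

        -- Some edge ww′ joins equally coloured vertices, and w is deleted. Any other such edge
        -- avoiding w either meets w′, forming a path of two, or is disjoint from ww′; both are
        -- excluded.
        near-none : (∀ v → low v ≡ false) → ¬ Bipartite G → Near
        near-none none nonbip with find-conflict all c
        ... | inj₂ ok = ⊥-elim (nonbip (c , λ i j → ok refl refl))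
        ... | inj₁ (w , w′ , _ , _ , ww′ , same) = record { w = w ; c = c ; proper = proper ; triangle = triangle }
          where
          proper : Proper (all ∖ w) c
          proper {i} {j} hi hj ij cij with i Finₚ.≟ w′ | j Finₚ.≟ w′
          ... | yes refl | _ = conflict-path (none w) (none w′) (none j) ww′ same ij cij (λ e → ∖-elim all hj (sym e))
          ... | no _ | yes refl = conflict-path (none w) (none w′) (none i) ww′ same (~-sym ij) (sym cij) (λ e → ∖-elim all hi (sym e))
          ... | no i≢ | no j≢ = conflict-matching (none w) (none w′) (none i) (none j) ww′ same ij cij
                (λ e → ∖-elim all hi (sym e)) (λ e → ∖-elim all hj (sym e)) (i≢ ∘ sym) (j≢ ∘ sym)
          triangle : ∀ {x y} → w ~ x → w ~ y → x ~ y → c x ≢ c y → Tri regime w x y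
          triangle {x} {y} wx wy xy ne with c w Boolₚ.≟ c x
          ... | yes e = conflict-triangle (none w) (none x) (none y) wx wy xy e ne regime
          ... | no ne′ = Tri-sym regime (conflict-triangle (none w) (none y) (none x) wy wx (~-sym xy) (≢-≢⇒≡ ne′ ne) (ne ∘ sym) regime)

        near-one : ∀ w → low w ≡ true → (∀ v → v ≢ w → low v ≡ false) → Near
        near-one w lw others = record { w = w ; c = c ; proper = proper ; triangle = λ wx wy xy ne → tri regime wx wy xy ne }
          where
          proper : Proper (all ∖ w) c
          proper {i} {j} hi hj ij cij = low+conflict lw (others i (∖-elim all hi)) (others j (∖-elim all hj)) ij cij
          nb : ∀ {x} → w ~ x → low x ≡ false
          nb wx = others _ (λ e → ~⇒≢ wx (sym e))
          tri : ∀ ρ {x y} → w ~ x → w ~ y → x ~ y → c x ≢ c y → Tri ρ w x y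
          tri (two-two _ _) _ _ _ _ = tt
          tri (big-odd _ _ _ _) _ _ _ _ = tt
          tri (two-odd a≡0 b r≡) {x} {y} wx wy xy ne = by-colour (c x) (c y) refl refl
            where
            by-colour : ∀ β γ → c x ≡ β → c y ≡ γ → ⊥
            by-colour true false cx cy = L.triangle-odd a≡0 b r≡ wx wy xy (rich-of cx) (rich′-of (nb wy) cy)
            by-colour false true cx cy = R.triangle-odd a≡0 b r≡ wx wy xy (rich′-of (nb wx) cx) (rich-of cy)
            by-colour true true cx cy = ne (trans cx (sym cy))
            by-colour false false cx cy = ne (trans cx (sym cy))
          tri (r-even b r≡) {x} {y} wx wy xy ne z wz with z Finₚ.≟ x | z Finₚ.≟ y
          ... | yes e | _ = inj₁ e
          ... | no _ | yes e = inj₂ e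
          ... | no z≢x | no z≢y = ⊥-elim (by-colour (c x) (c y) (c z) refl refl refl)
            where
            by-colour : ∀ β γ δ → c x ≡ β → c y ≡ γ → c z ≡ δ → ⊥
            by-colour true false true cx cy cz = L.triangle-even b r≡ wx wy xy (rich-of cx) (rich′-of (nb wy) cy) wz (rich-of cz) z≢x
            by-colour true false false cx cy cz = R.triangle-even b r≡ wy wx (~-sym xy) (rich′-of (nb wy) cy) (rich-of cx) wz (rich′-of (nb wz) cz) z≢y
            by-colour false true true cx cy cz = L.triangle-even b r≡ wy wx (~-sym xy) (rich-of cy) (rich′-of (nb wx) cx) wz (rich-of cz) z≢y
            by-colour false true false cx cy cz = R.triangle-even b r≡ wx wy xy (rich′-of (nb wx) cx) (rich-of cy) wz (rich′-of (nb wz) cz) z≢x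
            by-colour true true _ cx cy _ = ne (trans cx (sym cy))
            by-colour false false _ cx cy _ = ne (trans cx (sym cy))

        near-core : ¬ Bipartite G → Near
        near-core nonbip with search-pred low
        ... | inj₂ none = near-none none nonbip
        ... | inj₁ (w , lw) = near-one w lw (λ v ne → ≢true (λ lv → two-low lw lv (ne ∘ sym)))

    near : ∀ n′ → n ≡ suc n′ → n′ * n′ + 3 ≤ 2 * E all → ¬ Bipartite G → Near
    near n′ n≡ many = WithCore.Near-proof.near-core (find-core n≥M₀ (ℕₚ.≤-trans (ℕₚ.m≤m+n 1000 99000) n≥10⁵) many′) n′ n≡ many
      where
      many′ : n * n ≤ 2 * E all + 4 * n
      many′ = subst (λ n → n * n ≤ 2 * E all + 4 * n) (sym n≡)
        (linear 2 (λ n e → n :* n :+ # 3 :≤ # 2 :* e ∷ [] ⊢ (# 1 :+ n) :* (# 1 :+ n) :≤ # 2 :* e :+ # 4 :* (# 1 :+ n)) (n′ ∷ E all ∷ []) many)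

-- Two low vertices: the case of q ≥ 4 and odd r

module Far (q r a : ℕ) (q≡ : q ≡ suc a * 2) (regime : Regime a r) (K : ℕ) (K-large : q + r + 10 ≤ K)
           {n : ℕ} (G : Graph n) (free : Free G (q + r) (thetaAdj q r))
           (sufficient : Structure.Sufficient q r a q≡ regime K K-large G free)
           (a′ : ℕ) (a≡ : a ≡ suc a′) (b : ℕ) (r≡ : r ≡ suc (suc b * 2)) where
  open Structure q r a q≡ regime K K-large G free
  open Sufficient sufficient
  open Large sufficient

  q≡′ : q ≡ suc (suc a′) * 2
  q≡′ = trans q≡ (cong (λ z → suc z * 2) a≡)

  record Pendant : Set where
    field
      w w′ z : Fin n
      c : Fin n → Bool
      w≢w′ : w ≢ w′
      ww′ : w ~ w′
      wz : w ~ z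
      w′z : w′ ~ z
      w-neighbours : ∀ {i} → w ~ i → i ≡ w′ ⊎ i ≡ z
      w′-neighbours : ∀ {i} → w′ ~ i → i ≡ w ⊎ i ≡ z
      proper : Proper (all ∖ w ∖ w′) c

  -- Here `β` is meant to be the common colour of the neighbours of `v`.
  recolour : Fin n → Bool → (Fin n → Bool) → Fin n → Bool
  recolour v β c u = if u == v then not β else c u

  recolour-self : ∀ v {β c} → recolour v β c v ≡ not β
  recolour-self v rewrite ==-refl v = refl

  not-≢ : ∀ {a b} → a ≡ b → not a ≢ b
  not-≢ {true} {true} _ ()
  not-≢ {false} {false} _ ()

  recolour-proper : ∀ {p v β c} → Proper (p ∖ v) c → (∀ {i} → p i ≡ true → v ~ i → c i ≡ β) → Proper p (recolour v β c)
  recolour-proper {p} {v} {β} {c} ok nb {i} {j} pi pj ij with i Finₚ.≟ v | j Finₚ.≟ v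
  ... | yes refl | yes refl = ⊥-elim (~⇒≢ ij refl)
  ... | yes refl | no _ = not-≢ (sym (nb pj ij))
  ... | no _ | yes refl = λ e → not-≢ (sym (nb pi (~-sym ij))) (sym e)
  ... | no i≢ | no j≢ = ok (∖-intro p pi i≢) (∖-intro p pj j≢) ij

  module FarHalf (core : Core) where
    open Core core
    open Half core
    module R = Half (swap core)

    no-conflict : ∀ {u u′} → u ~ u′ → rich u → rich u′ → ⊥
    no-conflict uu′ Ru Ru′ = let y , Yy , uy = neighbour Ru in
      conflict-odd b r≡ uu′ Ru Ru′ (Y⇒rich′ Yy) uy (inj₂ (subst (1 ≤_) (sym a≡) (s≤s z≤n)))

    2≤K : 2 ≤ K
    2≤K = linear 3 (λ q r k → q :+ r :+ # 10 :≤ k ∷ [] ⊢ # 2 :≤ k) (q ∷ r ∷ K ∷ []) K-large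

    -- For a further neighbour y₁ of x in Y, the chord is xy₁ and the even detour is x, w, y
    -- followed by an even path from y to y₁. That path has length at least 2, which is where q ≥ 4
    -- enters.
    two-sided : ∀ {w x y} → w ~ x → w ~ y → rich x → rich′ y → ⊥
    two-sided {w} {x} {y} wx wy Rx Ry = from (pick (y ∷ []) (λ j → Y j ∧ adj G x j) (ℕₚ.≤-trans 2≤K (K≤ (deg Y x) (Rich.bound Rx))))
      where
      from : (∃[ y₁ ] Y y₁ ∧ adj G x y₁ ≡ true × y₁ ∉ (y ∷ [])) → ⊥
      from (y₁ , h , y₁∉) = no-theta (w ∷ y ∷ []) [] z≤n xy₁
        (λ { (here refl) (here e) → ~⇒≢ wx e
           ; (here refl) (there (here e)) → R.one-sided Ry (card-pos (λ j → Y j ∧ adj G y j) (∧-intro (subst (λ z → Y z ≡ true) (sym e) Yy₁) (~-sym wy)))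
           ; (there (here refl)) (here e) → rich≢rich′ Rx Ry (sym e)
           ; (there (here refl)) (there (here e)) → y₁∉ (here (sym e)) }) (λ ())
        (subst (Conn (w ∷ y ∷ []) x y₁) (sym q≡′) (conn-cons (~-sym wx) (λ { (here e) → ~⇒≢ wy e })
          (conn-cons wy (λ ()) (R.conn-even a′ Ry Yy₁))))
        (subst (Conn [] x y₁) (sym r≡) (conn-odd (suc b) Rx (Y⇒rich′ Yy₁) (inj₂ (s≤s z≤n))))
        where
        Yy₁ : Y y₁ ≡ true
        Yy₁ = ∧-left h
        xy₁ : x ~ y₁
        xy₁ = ∧-right {Y y₁} h

    -- The chord is xy; the walk x, w, w′, x′ has length 3, and an odd path from x′ to y completes
    -- it to the even length q.
    four-walk : ∀ {w w′ x x′ y} → w ~ w′ → w ~ x → w′ ~ x′ → x ≢ x′ → w ≢ x′ → w′ ≢ x → w ≢ y → w′ ≢ y →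
      rich x → rich x′ → Y y ≡ true → x ~ y → x′ ~ y → ⊥
    four-walk {w} {w′} {x} {x′} {y} ww′ wx w′x′ x≢x′ w≢x′ w′≢x w≢y w′≢y Rx Rx′ Yy xy x′y = no-theta (w ∷ w′ ∷ x′ ∷ []) [] z≤n xy
      (λ { (here refl) (here e) → ~⇒≢ wx e ; (here refl) (there (here e)) → w≢y e
         ; (there (here refl)) (here e) → w′≢x e ; (there (here refl)) (there (here e)) → w′≢y e
         ; (there (there (here refl))) (here e) → x≢x′ (sym e) ; (there (there (here refl))) (there (here e)) → ~⇒≢ x′y e }) (λ ())
      (subst (Conn (w ∷ w′ ∷ x′ ∷ []) x y) (sym q≡′) (conn-cons (~-sym wx) (λ { (here e) → ~⇒≢ ww′ e ; (there (here e)) → w≢x′ e })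
        (conn-cons ww′ (λ { (here e) → ~⇒≢ w′x′ e }) (conn-cons w′x′ (λ ()) (conn-odd a′ Rx′ (Y⇒rich′ Yy) (inj₁ x′y))))))
      (subst (Conn [] x y) (sym r≡) (conn-odd (suc b) Rx (Y⇒rich′ Yy) (inj₂ (s≤s z≤n))))

    -- If x and x′ differ, `four-walk` leaves them no common neighbour in Y, so their degrees sum to
    -- about 41n/80. This is refuted by deleting them together with w and w′.
    meet : ∀ {w w′ x x′} → w ~ w′ → w ~ x → w′ ~ x′ → w ≢ x′ → w′ ≢ x → (∀ {y} → Y y ≡ true → (w ≢ y) × (w′ ≢ y)) →
      (x ≢ x′ → 80 * (deg all x + deg all x′) ≤ 41 * n + 80 * 0 + 16000 → ⊥) → rich x → rich x′ → x ≡ x′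
    meet {w} {w′} {x} {x′} ww′ wx w′x′ w≢x′ w′≢x avoid disjoint-absurd Rx Rx′ with x Finₚ.≟ x′
    ... | yes e = e
    ... | no ne = ⊥-elim (disjoint-absurd ne (pair-degree {k = 0} Rx Rx′ (ℕₚ.≮⇒≥ λ h → some (card-pos⁻¹ Z h))))
      where
      Z : Pred n
      Z j = Y j ∧ (adj G x j ∧ adj G x′ j)
      some : (∃[ y ] Z y ≡ true) → ⊥
      some (y , h) = four-walk ww′ wx w′x′ ne w≢x′ w′≢x (proj₁ (avoid (∧-left h))) (proj₂ (avoid (∧-left h))) Rx Rx′ (∧-left h)
        (∧-left (∧-right {Y y} h)) (∧-right {adj G x y} (∧-right {Y y} h))

  module FarCore (core : Core) (n″ : ℕ) (n≡ : n ≡ suc (suc n″)) (many : n″ * n″ + 11 ≤ 2 * E all) where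
    open Core core
    open WithCore core
    module FL = FarHalf core
    module FR = FarHalf (swap core)

    many-at : ∀ {k} → n ≡ suc (suc k) → k * k + 11 ≤ 2 * E all
    many-at e = subst (λ z → z * z + 11 ≤ 2 * E all) (ℕₚ.suc-injective (ℕₚ.suc-injective (trans (sym n≡) e))) many

    low-not-rich : ∀ {v} → low v ≡ true → L.rich v → ⊥
    low-not-rich {v} h R = true≢false (trans (sym (≤ᵇ-true (Rich.bound R))) (not-true (∧-left h)))

    low-not-rich′ : ∀ {v} → low v ≡ true → R.rich v → ⊥
    low-not-rich′ {v} h R = true≢false (trans (sym (≤ᵇ-true (Rich.bound R))) (not-true (∧-right {not (c v)} h)))

    -- The benchmark is now (n-2)² instead of (n-1)², so j deleted vertices need total degree only
    -- about (j-2)n/2: two low vertices are affordable, three are not.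
    three-low : ∀ {u v w} → low u ≡ true → low v ≡ true → low w ≡ true → u ≢ v → u ≢ w → v ≢ w → ⊥
    three-low {u} {v} {w} lu lv lw uv uw vw with peel (u ∷ v ∷ w ∷ []) (distinct₃ uv uw vw) (s≤s (s≤s (s≤s z≤n))) n≥M₀
    ... | m , n≡3+m , le = linear 6 (λ m n e d d′ d″ → # 16 :* d :≤ n :+ # 1600 ∷ # 16 :* d′ :≤ n :+ # 1600 ∷ # 16 :* d″ :≤ n :+ # 1600 ∷
          n :≡ # 3 :+ m ∷ # 100000 :≤ n ∷
          # 2 :* e :≤ m :* m :+ # 4 :* (d :+ (d′ :+ (d″ :+ # 0))) ∷ (# 1 :+ m) :* (# 1 :+ m) :+ # 11 :≤ # 2 :* e ∷ [] ⊢ absurd)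
        (m ∷ n ∷ E all ∷ deg all u ∷ deg all v ∷ deg all w ∷ []) (low-degree lu) (low-degree lv) (low-degree lw) n≡3+m n≥10⁵ le (many-at n≡3+m)

    no-disjoint : ∀ {w w′ x x′} → low w ≡ true → low w′ ≡ true → w ≢ w′ → low x ≡ false → low x′ ≡ false → x ≢ x′ →
      80 * (deg all x + deg all x′) ≤ 41 * n + 80 * 0 + 16000 → ⊥
    no-disjoint {w} {w′} {x} {x′} lw lw′ ww′ lx lx′ xx′ h
      with peel (w ∷ w′ ∷ x ∷ x′ ∷ []) (distinct₄ ww′ (low≢ lw lx) (low≢ lw lx′) (low≢ lw′ lx) (low≢ lw′ lx′) xx′) (s≤s (s≤s (s≤s (s≤s z≤n)))) n≥M₀
    ... | m , n≡4+m , le = linear 7 (λ m n e d d′ f f′ → # 16 :* d :≤ n :+ # 1600 ∷ # 16 :* d′ :≤ n :+ # 1600 ∷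
          # 80 :* (f :+ f′) :≤ # 41 :* n :+ # 80 :* # 0 :+ # 16000 ∷ n :≡ # 4 :+ m ∷ # 100000 :≤ n ∷
          # 2 :* e :≤ m :* m :+ # 4 :* (d :+ (d′ :+ (f :+ (f′ :+ # 0)))) ∷ (# 2 :+ m) :* (# 2 :+ m) :+ # 11 :≤ # 2 :* e ∷ [] ⊢ absurd)
        (m ∷ n ∷ E all ∷ deg all w ∷ deg all w′ ∷ deg all x ∷ deg all x′ ∷ []) (low-degree lw) (low-degree lw′) h n≡4+m n≥10⁵ le (many-at n≡4+m)

    module _ {w w′ : Fin n} (lw : low w ≡ true) (lw′ : low w′ ≡ true) (ww′ : w ~ w′) where

      meet : ∀ {x x′} → w ~ x → w′ ~ x′ → low x ≡ false → low x′ ≡ false → c x ≡ c x′ → x ≡ x′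
      meet {x} {x′} wx w′x′ lx lx′ same = by-colour (c x) refl
        where
        by-colour : ∀ β → c x ≡ β → x ≡ x′
        separate : ∀ {y} → low y ≡ true → ∀ {p z} → Rich p z → (low y ≡ true → Rich p y → ⊥) → y ≢ z
        separate ly Rz h refl = h ly Rz
        by-colour true e = FL.meet ww′ wx w′x′ (low≢ lw lx′) (low≢ lw′ lx)
          (λ Yy → separate lw (L.Y⇒rich′ Yy) low-not-rich′ , separate lw′ (L.Y⇒rich′ Yy) low-not-rich′)
          (no-disjoint lw lw′ (~⇒≢ ww′) lx lx′) (rich-of e) (rich-of (trans (sym same) e))
        by-colour false e = FR.meet ww′ wx w′x′ (low≢ lw lx′) (low≢ lw′ lx)
          (λ Xy → separate lw (R.Y⇒rich′ Xy) low-not-rich , separate lw′ (R.Y⇒rich′ Xy) low-not-rich)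
          (no-disjoint lw lw′ (~⇒≢ ww′) lx lx′) (rich′-of lx e) (rich′-of lx′ (trans (sym same) e))

    proper-high : ∀ {p} → (∀ {i} → p i ≡ true → low i ≡ false) → Proper p c
    proper-high high {i} {j} pi pj ij same = by-colour (c i) refl
      where
      by-colour : ∀ β → c i ≡ β → ⊥
      by-colour true e = FL.no-conflict ij (rich-of e) (rich-of (trans (sym same) e))
      by-colour false e = FR.no-conflict ij (rich′-of (high pi) e) (rich′-of (high pj) (trans (sym same) e))

    same-side : ∀ {w i j} → low i ≡ false → low j ≡ false → w ~ i → w ~ j → c i ≡ c j
    same-side {w} {i} {j} li lj wi wj = by-colour (c i) (c j) refl refl
      where
      by-colour : ∀ β γ → c i ≡ β → c j ≡ γ → c i ≡ c j
      by-colour true true e f = trans e (sym f)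
      by-colour false false e f = trans e (sym f)
      by-colour true false e f = ⊥-elim (FL.two-sided wi wj (rich-of e) (rich′-of lj f))
      by-colour false true e f = ⊥-elim (FL.two-sided wj wi (rich-of f) (rich′-of li e))

    bipartite-of : ∀ {c} → Proper all c → Bipartite G
    bipartite-of {c} ok = c , λ i j → ok {i} {j} refl refl

    neighbour-colour : ∀ w (p : Pred n) → (∀ {i} → p i ≡ true → low i ≡ false) → ∃[ β ] ∀ {i} → p i ≡ true → w ~ i → c i ≡ β
    neighbour-colour w p high with search-pred (λ i → p i ∧ adj G w i)
    ... | inj₁ (x , h) = c x , λ pi wi → same-side (high pi) (high (∧-left h)) wi (∧-right {p x} h)
    ... | inj₂ none = true , λ {i} pi wi → ⊥-elim (true≢false (trans (sym (∧-intro pi wi)) (none i)))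

    module TwoLow (nonbip : ¬ Bipartite G) (w w′ : Fin n) (lw : low w ≡ true) (lw′ : low w′ ≡ true) (w≢w′ : w ≢ w′)
                  (others : ∀ {i} → i ≢ w → i ≢ w′ → low i ≡ false) where
      P : Pred n
      P = all ∖ w ∖ w′
      P-intro : ∀ {i} → i ≢ w → i ≢ w′ → P i ≡ true
      P-intro i≢w i≢w′ = ∖-intro (all ∖ w) (∖-intro all refl i≢w) i≢w′
      P-high : ∀ {i} → P i ≡ true → low i ≡ false
      P-high {i} h = others (∖-elim all {w} {i} (∧-left h)) (∖-elim (all ∖ w) h)

      conclude : ∀ {x x′} → P x ≡ true → w ~ x → P x′ ≡ true → w′ ~ x′ → w ~ w′ → c x ≡ c x′ → Pendant
      conclude {x} {x′} Px wx Px′ w′x′ ww′ same = record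
        { w = w ; w′ = w′ ; z = x ; c = c ; w≢w′ = w≢w′ ; ww′ = ww′ ; wz = wx
        ; w′z = subst (w′ ~_) (sym (meet lw lw′ ww′ wx w′x′ (P-high Px) (P-high Px′) same)) w′x′
        ; w-neighbours = wn ; w′-neighbours = w′n ; proper = proper-high P-high }
        where
        wn : ∀ {i} → w ~ i → i ≡ w′ ⊎ i ≡ x
        wn {i} wi with i Finₚ.≟ w′
        ... | yes e = inj₁ e
        ... | no ne = let Pi = P-intro (~⇒≢ wi ∘ sym) ne in
          inj₂ (trans (meet lw lw′ ww′ wi w′x′ (P-high Pi) (P-high Px′) (trans (same-side (P-high Pi) (P-high Px) wi wx) same))
                      (sym (meet lw lw′ ww′ wx w′x′ (P-high Px) (P-high Px′) same)))
        w′n : ∀ {i} → w′ ~ i → i ≡ w ⊎ i ≡ x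
        w′n {i} w′i with i Finₚ.≟ w
        ... | yes e = inj₁ e
        ... | no ne = let Pi = P-intro ne (~⇒≢ w′i ∘ sym) in
          inj₂ (sym (meet lw lw′ ww′ wx w′i (P-high Px) (P-high Pi) (trans same (same-side (P-high Px′) (P-high Pi) w′x′ w′i))))

      -- Colouring w′ and then w against their neighbours fails only if they are
      -- adjacent and both see the same side.
      pendant : Pendant
      pendant = from (neighbour-colour w′ P P-high)
        where
        from : (∃[ β ] ∀ {i} → P i ≡ true → w′ ~ i → c i ≡ β) → Pendant
        from (β , nb′) = split (search-pred (λ i → P i ∧ adj G w i)) (search-pred (λ i → P i ∧ adj G w′ i)) (adj G w w′ Boolₚ.≟ true)
          where
          c₁ : Fin n → Bool
          c₁ = recolour w′ β c
          ok₁ : Proper (all ∖ w) c₁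
          ok₁ = recolour-proper {all ∖ w} (proper-high P-high) (λ {i} pi w′i → nb′ (∖-intro (all ∖ w) pi (~⇒≢ w′i ∘ sym)) w′i)
          fail : ∀ γ → (∀ {i} → w ~ i → c₁ i ≡ γ) → Pendant
          fail γ h = ⊥-elim (nonbip (bipartite-of (recolour-proper {all} {w} {γ} ok₁ (λ _ → h))))
          uniform : ∀ γ → (∀ {i} → P i ≡ true → w ~ i → c i ≡ γ) → (w ~ w′ → not β ≡ γ) → ∀ {i} → w ~ i → c₁ i ≡ γ
          uniform γ h h′ {i} wi with i Finₚ.≟ w′
          ... | yes refl = h′ wi
          ... | no ne = h (P-intro (~⇒≢ wi ∘ sym) ne) wi
          split : ((∃[ i ] P i ∧ adj G w i ≡ true) ⊎ (∀ i → P i ∧ adj G w i ≡ false)) →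
                  ((∃[ i ] P i ∧ adj G w′ i ≡ true) ⊎ (∀ i → P i ∧ adj G w′ i ≡ false)) → Dec (w ~ w′) → Pendant
          split (inj₂ none) _ _ = fail (not β) (uniform (not β) (λ {i} Pi wi → ⊥-elim (true≢false (trans (sym (∧-intro Pi wi)) (none i)))) (λ _ → refl))
          split (inj₁ (x , h)) s (no w≁w′) = fail (c x) (uniform (c x) (λ Pi wi → same-side (P-high Pi) (P-high (∧-left h)) wi (∧-right {P x} h)) (λ ww′ → ⊥-elim (w≁w′ ww′)))
          split (inj₁ (x , h)) (inj₁ (x′ , h′)) (yes ww′) with c x Boolₚ.≟ c x′
          ... | yes same = conclude (∧-left h) (∧-right {P x} h) (∧-left h′) (∧-right {P x′} h′) ww′ same
          ... | no ne = fail (c x) (uniform (c x) (λ Pi wi → same-side (P-high Pi) (P-high (∧-left h)) wi (∧-right {P x} h))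
                (λ _ → trans (cong not (sym (nb′ (∧-left h′) (∧-right {P x′} h′)))) (not-other ne)))
            where
            not-other : ∀ {a b : Bool} → a ≢ b → not b ≡ a
            not-other {true} {true} h = ⊥-elim (h refl)
            not-other {false} {false} h = ⊥-elim (h refl)
            not-other {true} {false} _ = refl
            not-other {false} {true} _ = refl
          -- Now w′ has no neighbour but w, so w is coloured against its neighbours first and w′
          -- against w afterwards.
          split (inj₁ (x , h)) (inj₂ none) (yes ww′) = ⊥-elim (nonbip (bipartite-of
            (recolour-proper {all} {w′} {not (c x)} {recolour w (c x) c}
              (λ {i} {j} pi pj → recolour-proper {all ∖ w′} {w} {c x} {c}
                (λ {i} {j} hi hj → proper-high P-high (swap∖ i hi) (swap∖ j hj))
                (λ {i} pi wi → same-side (P-high (P-intro (~⇒≢ wi ∘ sym) (∖-elim all pi))) (P-high (∧-left h)) wi (∧-right {P x} h)) {i} {j} pi pj)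
              (λ {i} _ w′i → only i w′i (i Finₚ.≟ w)))))
            where
            swap∖ : ∀ i → (all ∖ w′ ∖ w) i ≡ true → P i ≡ true
            swap∖ i hi = P-intro (∖-elim (all ∖ w′) hi) (∖-elim all {w′} {i} (∧-left hi))
            only : ∀ i → w′ ~ i → Dec (i ≡ w) → recolour w (c x) c i ≡ not (c x)
            only i w′i (yes e) = trans (cong (recolour w (c x) c) e) (recolour-self w {c x} {c})
            only i w′i (no ne) = ⊥-elim (true≢false (trans (sym (∧-intro (P-intro ne (~⇒≢ w′i ∘ sym)) w′i)) (none i)))

    pendant : ¬ Bipartite G → Pendant
    pendant nonbip with search-pred low
    ... | inj₂ none = ⊥-elim (nonbip (bipartite-of (proper-high (λ {i} _ → none i))))
    ... | inj₁ (w , lw) with search-pred (low ∖ w)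
    ...   | inj₂ none = ⊥-elim (nonbip (bipartite-of (recolour-proper {all} {w} (proper-high high) (λ {i} _ wi → proj₂ nc (∖-intro all refl (~⇒≢ wi ∘ sym)) wi))))
      where
      high : ∀ {i} → (all ∖ w) i ≡ true → low i ≡ false
      high {i} h = ≢true (λ li → true≢false (trans (sym (∖-intro low li (∖-elim all h))) (none i)))
      nc : ∃[ β ] ∀ {i} → (all ∖ w) i ≡ true → w ~ i → c i ≡ β
      nc = neighbour-colour w (all ∖ w) high
    ...   | inj₁ (w′ , h′) = TwoLow.pendant nonbip w w′ lw (∧-left h′) (∖-elim low h′ ∘ sym)
      (λ i≢w i≢w′ → ≢true (λ li → three-low lw (∧-left h′) li (∖-elim low h′ ∘ sym) (i≢w ∘ sym) (i≢w′ ∘ sym)))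

  far : ∀ n″ → n ≡ suc (suc n″) → n″ * n″ + 11 ≤ 2 * E all → ¬ Bipartite G → Pendant
  far n″ n≡ many = FarCore.pendant (find-core n≥M₀ (ℕₚ.≤-trans (ℕₚ.m≤m+n 1000 99000) n≥10⁵) many′) n″ n≡ many
    where
    many′ : n * n ≤ 2 * E all + 4 * n
    many′ = subst (λ n → n * n ≤ 2 * E all + 4 * n) (sym n≡)
      (linear 2 (λ n e → n :* n :+ # 11 :≤ # 2 :* e ∷ [] ⊢ (# 2 :+ n) :* (# 2 :+ n) :≤ # 2 :* e :+ # 4 :* (# 2 :+ n)) (n″ ∷ E all ∷ []) many)

-- Graphs that become bipartite after deleting one vertex

halves : ∀ m → ⌊ m /2⌋ + ⌈ m /2⌉ ≡ m × ⌊ m /2⌋ ≤ ⌈ m /2⌉ × ⌈ m /2⌉ ≤ suc ⌊ m /2⌋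
halves m = ℕₚ.⌊n/2⌋+⌈n/2⌉≡n m , ℕₚ.⌊n/2⌋≤⌈n/2⌉ m , go m
  where
  go : ∀ m → ⌈ m /2⌉ ≤ suc ⌊ m /2⌋
  go zero = z≤n
  go (suc zero) = s≤s z≤n
  go (suc (suc m)) = s≤s (go m)

half² : ℕ → ℕ
half² m = ⌈ m /2⌉ * ⌊ m /2⌋

sq≤4half²+1 : ∀ m → m * m ≤ 4 * half² m + 1
sq≤4half²+1 m with halves m
... | eq , le , le′ = subst (λ z → z * z ≤ 4 * half² m + 1) eq (go (ℕₚ.m≤n⇒m<n∨m≡n le))
  where
  h h′ : ℕ
  h = ⌊ m /2⌋
  h′ = ⌈ m /2⌉
  go : h < h′ ⊎ h ≡ h′ → (h + h′) * (h + h′) ≤ 4 * (h′ * h) + 1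
  go (inj₁ lt) = subst (λ z → (h + z) * (h + z) ≤ 4 * (z * h) + 1) (ℕₚ.≤-antisym lt le′)
    (linear 1 (λ h → [] ⊢ (h :+ (# 1 :+ h)) :* (h :+ (# 1 :+ h)) :≤ # 4 :* ((# 1 :+ h) :* h) :+ # 1) (h ∷ []))
  go (inj₂ e) = subst (λ z → (h + z) * (h + z) ≤ 4 * (z * h) + 1) e
    (linear 1 (λ h → [] ⊢ (h :+ h) :* (h :+ h) :≤ # 4 :* (h :* h) :+ # 1) (h ∷ []))

Balanced : ℕ → ℕ → ℕ → Set
Balanced m a b = (a ≡ ⌈ m /2⌉ × b ≡ ⌊ m /2⌋) ⊎ (a ≡ ⌊ m /2⌋ × b ≡ ⌈ m /2⌉)

product-max : ∀ m a b → a + b ≡ m → a * b ≤ half² m × (half² m ≤ a * b → Balanced m a b)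
product-max m a b a+b with halves m
... | eq , le , le′ = go (ℕₚ.≤-total a h)
  where
  h h′ : ℕ
  h = ⌊ m /2⌋
  h′ = ⌈ m /2⌉
  -- x and y differ from the halves by t; the product drops by t² + t d.
  below : ∀ x y t d → x + t ≡ h → h + d ≡ h′ → x + y ≡ h + h′ → x * y ≤ h′ * h × (h′ * h ≤ x * y → x ≡ h × y ≡ h′)
  below x y t d e₁ e₂ e₃ = subst₂ (λ H H′ → x * y ≤ H′ * H × (H′ * H ≤ x * y → x ≡ H × y ≡ H′)) e₁ (trans (cong (_+ d) e₁) e₂)
    (subst (λ y → x * y ≤ (x + t + d) * (x + t) × ((x + t + d) * (x + t) ≤ x * y → x ≡ x + t × y ≡ x + t + d)) (sym y≡)
      (linear 3 (λ x t d → [] ⊢ x :* (x :+ t :+ t :+ d) :≤ (x :+ t :+ d) :* (x :+ t)) (x ∷ t ∷ d ∷ []) ,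
       λ h → let t≡0 = zero-sq t (linear 3 (λ x t d → (x :+ t :+ d) :* (x :+ t) :≤ x :* (x :+ t :+ t :+ d) ∷ [] ⊢ t :* t :≤ # 0) (x ∷ t ∷ d ∷ []) h) in
         linear 2 (λ x t → t :≡ # 0 ∷ [] ⊢ x :≡ x :+ t) (x ∷ t ∷ []) t≡0 ,
         linear 3 (λ x t d → t :≡ # 0 ∷ [] ⊢ x :+ t :+ t :+ d :≡ x :+ t :+ d) (x ∷ t ∷ d ∷ []) t≡0))
    where
    y≡ : y ≡ x + t + t + d
    y≡ = linear 6 (λ x y t d h h′ → x :+ t :≡ h ∷ h :+ d :≡ h′ ∷ x :+ y :≡ h :+ h′ ∷ [] ⊢ y :≡ x :+ t :+ t :+ d) (x ∷ y ∷ t ∷ d ∷ h ∷ h′ ∷ []) e₁ e₂ e₃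
    zero-sq : ∀ t → t * t ≤ 0 → t ≡ 0
    zero-sq zero _ = refl
  total : a + b ≡ h + h′
  total = trans a+b (sym eq)
  go : a ≤ h ⊎ h ≤ a → a * b ≤ h′ * h × (h′ * h ≤ a * b → Balanced m a b)
  go (inj₁ a≤h) = let p , q = below a b (h ∸ a) (h′ ∸ h) (ℕₚ.m+[n∸m]≡n a≤h) (ℕₚ.m+[n∸m]≡n le) total in
    p , λ g → inj₂ (q g)
  go (inj₂ h≤a) with ℕₚ.m≤n⇒m<n∨m≡n h≤a
  ... | inj₂ refl = let p , q = below a b 0 (h′ ∸ h) (ℕₚ.+-identityʳ a) (ℕₚ.m+[n∸m]≡n le) total in p , λ g → inj₂ (q g)
  ... | inj₁ h<a = let p , q = below b a (h ∸ b) (h′ ∸ h) (ℕₚ.m+[n∸m]≡n b≤h) (ℕₚ.m+[n∸m]≡n le) (trans (ℕₚ.+-comm b a) total) in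
    subst (_≤ h′ * h) (ℕₚ.*-comm b a) p , λ g → let x , y = q (subst (h′ * h ≤_) (ℕₚ.*-comm a b) g) in inj₁ (y , x)
    where
    b≤h : b ≤ h
    b≤h = linear 4 (λ a b h h′ → h :< a ∷ a :+ b :≡ h :+ h′ ∷ h′ :≤ # 1 :+ h ∷ [] ⊢ b :≤ h) (a ∷ b ∷ h ∷ h′ ∷ []) h<a total le′

module Split {n : ℕ} (G : Graph n) (w : Fin n) (c : Fin n → Bool)
             (proper : ∀ {i j} → i ≢ w → j ≢ w → adj G i j ≡ true → c i ≢ c j) where
  open Counting G

  A B P Q : Pred n
  A i = not (i == w) ∧ c i
  B i = not (i == w) ∧ not (c i)
  P i = adj G w i ∧ c i
  Q i = adj G w i ∧ not (c i)

  M : ℕ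
  M = missing A B

  miss : Fin n → Fin n → Bool
  miss i j = A i ∧ (B j ∧ not (adj G i j))

  size : suc (card A + card B) ≡ n
  size = trans (cong suc (cards≡ (A ∷ B ∷ []) ((all ∖ w) ∷ []) (λ i → bit-split (not (i == w)) (c i)))) (trans (sym (card-∖ all w refl)) card-all)

  count : edges G + M ≡ card A * card B + (card P + card Q)
  count = linear 8 (λ e M E E′ d x AB PQ → E :≡ # 2 :* e ∷ E :≡ E′ :+ # 2 :* d ∷ E′ :≡ # 2 :* x ∷ x :+ M :≡ AB ∷ PQ :≡ d ∷ [] ⊢ e :+ M :≡ AB :+ PQ)
    (edges G ∷ M ∷ E all ∷ E (all ∖ w) ∷ deg all w ∷ cross A B ∷ card A * card B ∷ card P + card Q ∷ [])
    E-all (E-remove all w refl) (E-bipartite (all ∖ w) c (λ i j hi hj → proper (∖-elim all hi) (∖-elim all hj)))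
    (cross+missing A B) (cards≡ (P ∷ Q ∷ []) ((adj G w) ∷ []) (λ i → bit-split (adj G w i) (c i)))

  miss≥ : ∀ (T : Fin n → Fin n → Bool) → (∀ i j → T i j ≡ true → miss i j ≡ true) → ∑ (λ i → ∑ (λ j → bit (T i j))) ≤ M
  miss≥ T h = ∑-mono (λ i → ∑-mono (λ j → bit-mono {n} (h i j)))

  bit-injective : ∀ {x y} → bit x ≡ bit y → x ≡ y
  bit-injective {false} {false} _ = refl
  bit-injective {true} {true} _ = refl

  miss-exact : ∀ (T : Fin n → Fin n → Bool) → (∀ i j → T i j ≡ true → miss i j ≡ true) →
    M ≤ ∑ (λ i → ∑ (λ j → bit (T i j))) → ∀ i j → miss i j ≡ T i j
  miss-exact T h le i j = sym (bit-injective (∑∑-pointwise (λ i j → bit-mono {n} (h i j)) le i j))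

  miss-total : ∀ (T : Fin n → Fin n → Bool) → (∀ i j → miss i j ≡ T i j) → M ≡ ∑ (λ i → ∑ (λ j → bit (T i j)))
  miss-total T h = ∑-cong (λ i → ∑-cong (λ j → cong bit (h i j)))

  -- The adjacency of a graph bipartite off w, rebuilt from the row of w, the colours, and the bits
  -- `t`, `t′` telling whether ij or ji is a missing pair. Once the missing pairs are known, the
  -- graph is known.
  normal : (wi ci pi wj cj pj t t′ : Bool) → Bool
  normal wi ci pi wj cj pj t t′ = (wi ∧ pj) ∨ (wj ∧ pi) ∨ (not wi ∧ not wj ∧ ((ci ∧ not cj ∧ not t) ∨ (cj ∧ not ci ∧ not t′)))

  adj-normal : ∀ (T : Fin n → Fin n → Bool) → (∀ i j → miss i j ≡ T i j) → ∀ i j →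
    adj G i j ≡ normal (i == w) (c i) (adj G w i) (j == w) (c j) (adj G w j) (T i j) (T j i)
  adj-normal T h i j rewrite sym (h i j) | sym (h j i) | adj-sym G j i with i Finₚ.≟ w | j Finₚ.≟ w
  ... | yes refl | yes refl rewrite adj-irrefl G w = refl
  ... | yes refl | no _ = sym (Boolₚ.∨-identityʳ _)
  ... | no _ | yes refl rewrite adj-sym G i w = sym (Boolₚ.∨-identityʳ _)
  ... | no i≢ | no j≢ with c i in ci | c j in cj | adj G i j in e
  ...   | true | true | true = ⊥-elim (proper i≢ j≢ e (trans ci (sym cj)))
  ...   | false | false | true = ⊥-elim (proper i≢ j≢ e (trans ci (sym cj)))
  ...   | true | true | false = refl
  ...   | false | false | false = refl
  ...   | true | false | true = refl
  ...   | true | false | false = refl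
  ...   | false | true | true = refl
  ...   | false | true | false = refl

  A-intro : ∀ {i} → i ≢ w → c i ≡ true → A i ≡ true
  A-intro ne e rewrite ≢⇒== ne = e

  B-intro : ∀ {i} → i ≢ w → c i ≡ false → B i ≡ true
  B-intro ne e rewrite ≢⇒== ne | e = refl

  module Nonbipartite (nonbip : ¬ Bipartite G) where

    -- If w had no neighbour of colour β, giving it that colour would make the whole graph
    -- bipartite.
    seen : ∀ β → ∃[ x ] w ~ x × c x ≡ β
    seen β with search-pred (λ i → adj G w i ∧ eqᵇ (c i) β)
    ... | inj₁ (x , h) = x , ∧-left h , eqᵇ-sound (subst T (sym (∧-right {adj G w x} h)) tt)
    ... | inj₂ none = ⊥-elim (nonbip ((λ u → if u == w then β else c u) , λ i j → ok i j))
      where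
      avoid : ∀ {i} → w ~ i → β ≢ c i
      avoid {i} e refl = true≢false (trans (sym (∧-intro e (eqᵇ-refl (c i)))) (none i))
      ok : ∀ i j → i ~ j → (if i == w then β else c i) ≢ (if j == w then β else c j)
      ok i j e with i Finₚ.≟ w | j Finₚ.≟ w
      ... | yes refl | yes refl = ⊥-elim (~⇒≢ e refl)
      ... | yes refl | no _ = avoid e
      ... | no _ | yes refl = avoid (~-sym e) ∘ sym
      ... | no i≢ | no j≢ = proper i≢ j≢ e

    P-pos : 1 ≤ card P
    P-pos with seen true
    ... | x , e , cx = card-pos P (∧-intro e cx)

    Q-pos : 1 ≤ card Q
    Q-pos with seen false
    ... | x , e , cx = card-pos Q (∧-intro e (cong not cx))

  sum≤product+1 : ∀ {p q} → 1 ≤ p → 1 ≤ q → p + q ≤ p * q + 1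
  sum≤product+1 {suc p} {suc q} _ _ = linear 2 (λ p q → [] ⊢ (# 1 :+ p) :+ (# 1 :+ q) :≤ (# 1 :+ p) :* (# 1 :+ q) :+ # 1) (p ∷ q ∷ [])

  PQ-miss : (∀ {i j} → P i ≡ true → Q j ≡ true → i ~ j → ⊥) → ∀ i j → P i ∧ Q j ≡ true → miss i j ≡ true
  PQ-miss none i j h = ∧-intro (A-intro (~⇒≢ (∧-left Pi) ∘ sym) (∧-right {adj G w i} Pi))
      (∧-intro (B-intro (~⇒≢ (∧-left Qj) ∘ sym) (not-true (∧-right {adj G w j} Qj))) (cong not (≢true (none Pi Qj))))
    where
    Pi : P i ≡ true
    Pi = ∧-left h
    Qj : Q j ≡ true
    Qj = ∧-right {P i} h

-- Recognising the extremal families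

eqᵇ-true : ∀ {a b} → eqᵇ a b ≡ true → a ≡ b
eqᵇ-true {a} {b} h = eqᵇ-sound {a} {b} (subst T (sym h) tt)

roleOf : Bool → Bool → Side
roleOf true _ = sW
roleOf false true = sA
roleOf false false = sB

module _ {n : ℕ} where

  apart : ∀ {u v : Fin n} i → u ≢ v → not ((i == u) ∧ (i == v)) ≡ true
  apart {u} {v} i ne with i Finₚ.≟ u | i Finₚ.≟ v
  ... | yes refl | yes refl = ⊥-elim (ne refl)
  ... | yes refl | no _ = refl
  ... | no _ | _ = refl

  at-vertex : ∀ {u : Fin n} (f : Fin n → Bool) → f u ≡ true → ∀ i → not (i == u) ∨ f i ≡ true
  at-vertex {u} f h i with i Finₚ.≟ u
  ... | yes refl = h
  ... | no _ = refl

  both : ∀ (u i j : Fin n) → not ((i == u) ∧ (j == u)) ∨ (i == j) ≡ true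
  both u i j with i Finₚ.≟ u | j Finₚ.≟ u
  ... | yes refl | yes refl = ==-refl i
  ... | yes refl | no _ = refl
  ... | no _ | _ = refl

  same-bit : ∀ (u i j : Fin n) → not (i == j) ∨ eqᵇ (i == u) (j == u) ≡ true
  same-bit u i j with i Finₚ.≟ j
  ... | no _ = refl
  ... | yes refl with i == u
  ...   | true = refl
  ...   | false = refl

  ∑∑-row : ∀ (a : Fin n) (f : Fin n → ℕ) → ∑ (λ i → ∑ (λ j → if i == a then f j else 0)) ≡ ∑ f
  ∑∑-row a f = trans (∑-cong pull) (∑-at a (λ _ → ∑ f))
    where
    pull : ∀ i → ∑ (λ j → if i == a then f j else 0) ≡ (if i == a then ∑ f else 0)
    pull i with i == a
    ... | true = refl
    ... | false = ∑-zero n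

  ∑∑-col : ∀ (b : Fin n) (f : Fin n → ℕ) → ∑ (λ i → ∑ (λ j → if j == b then f i else 0)) ≡ ∑ f
  ∑∑-col b f = ∑-cong (λ i → ∑-at b (λ _ → f i))

-- The adjacency formulas are Boolean functions of bits such as i == w and c i,
-- so that identities between them reduce to truth tables.

bulletFormula : (wi ci xi yi wj cj xj yj : Bool) → Bool
bulletFormula wi ci xi yi wj cj xj yj = crossAB (roleOf wi ci) (roleOf wj cj)
  ∨ (isW (roleOf wi ci) ∧ (xj ∨ yj)) ∨ (isW (roleOf wj cj) ∧ (xi ∨ yi))

module Recognise {n : ℕ} (G : Graph n) (w : Fin n) (c : Fin n → Bool)
                 (proper : ∀ {i j} → i ≢ w → j ≢ w → adj G i j ≡ true → c i ≢ c j) where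
  open Counting G
  open Split G w c proper

  isA-role : ∀ i → isA (roleOf (i == w) (c i)) ≡ A i
  isA-role i with i == w | c i
  ... | true | _ = refl
  ... | false | true = refl
  ... | false | false = refl

  isB-role : ∀ i → isB (roleOf (i == w) (c i)) ≡ B i
  isB-role i with i == w | c i
  ... | true | _ = refl
  ... | false | true = refl
  ... | false | false = refl

  isW-roleOf : ∀ x y → isW (roleOf x y) ≡ x
  isW-roleOf true _ = refl
  isW-roleOf false true = refl
  isW-roleOf false false = refl

  bullet : ∀ {x y} → c x ≡ true → c y ≡ false → x ≢ w → y ≢ w → (∀ i → adj G w i ≡ (i == x) ∨ (i == y)) →
    (∀ i j → miss i j ≡ false) → IsBullet (card A) (card B) G
  bullet {x} {y} cx cy x≢w y≢w adj-w full =
    (λ i → roleOf (i == w) (c i)) , x , y , card-cong isA-role , card-cong isB-role ,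
    trans (card-cong (λ i → isW-roleOf (i == w) (c i))) (card-single w) ,
    cong₂ roleOf (≢⇒== x≢w) cx , cong₂ roleOf (≢⇒== y≢w) cy , formula
    where
    guard : ∀ i → not ((i == w) ∧ ((i == x) ∨ (i == y))) ≡ true
    guard i = bool⇒ 3 (λ p q r → not (p ∧ q) ∧ not (p ∧ r)) (λ p q r → not (p ∧ (q ∨ r))) ((i == w) ∷ (i == x) ∷ (i == y) ∷ [])
      (∧-intro (apart i (x≢w ∘ sym)) (apart i (y≢w ∘ sym)))
    formula : ∀ i j → adj G i j ≡ bulletFormula (i == w) (c i) (i == x) (i == y) (j == w) (c j) (j == x) (j == y)
    formula i j = trans (adj-normal (λ _ _ → false) full i j)
      (trans (cong₂ (λ pi pj → normal (i == w) (c i) pi (j == w) (c j) pj false false) (adj-w i) (adj-w j))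
        (eqᵇ-true (bool⇒ 8 (λ wi ci xi yi wj cj xj yj → not (wi ∧ (xi ∨ yi)) ∧ not (wj ∧ (xj ∨ yj)))
          (λ wi ci xi yi wj cj xj yj → eqᵇ (normal wi ci (xi ∨ yi) wj cj (xj ∨ yj) false false) (bulletFormula wi ci xi yi wj cj xj yj))
          ((i == w) ∷ c i ∷ (i == x) ∷ (i == y) ∷ (j == w) ∷ c j ∷ (j == x) ∷ (j == y) ∷ []) (∧-intro (guard i) (guard j)))))

-- 𝓗(n): w is u₁ and its only neighbour on the side of A is u₂.

hRole : Bool → Bool → Side
hRole wi ci = if not wi ∧ not ci then sA else sB

hEdge : (xi wj aj : Bool) → Bool
hEdge xi wj aj = if wj then xi else if aj then not xi else true

hFormula : (wi ci ai pi wj cj aj pj : Bool) → Bool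
hFormula wi ci ai pi wj cj aj pj =
  (isA (hRole wi ci) ∧ isB (hRole wj cj) ∧ hEdge (pi ∧ not ci) wj aj)
  ∨ (isA (hRole wj cj) ∧ isB (hRole wi ci) ∧ hEdge (pj ∧ not cj) wi ai)
  ∨ (wi ∧ aj) ∨ (ai ∧ wj)

-- The vertex w, in the role of u₁, joins the part of size x. If that is the larger of two unequal
-- parts, then m is odd and n is even, which is the case b = 1.
InH-sizes : ∀ m x y → Balanced m x y → Σ ℕ λ b → (b ≡ 0 ⊎ (b ≡ 1 × 2 ∣ suc m)) × suc x ≡ ⌈ suc m /2⌉ + b × y ≡ ⌊ suc m /2⌋ ∸ b
InH-sizes m x y (inj₂ (refl , refl)) = 0 , inj₁ refl , sym (ℕₚ.+-identityʳ _) , refl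
InH-sizes m x y (inj₁ (refl , refl)) with halves m
... | eq , le , le′ with ℕₚ.m≤n⇒m<n∨m≡n le
...   | inj₂ e = 0 , inj₁ refl , trans (cong suc (sym e)) (sym (ℕₚ.+-identityʳ _)) , e
...   | inj₁ lt = 1 , inj₂ (refl , divides ⌈ m /2⌉ two) , trans (cong suc one) (ℕₚ.+-comm 1 _) , cong (_∸ 1) (sym one)
  where
  one : ⌈ m /2⌉ ≡ suc ⌊ m /2⌋
  one = ℕₚ.≤-antisym le′ lt
  two : suc m ≡ ⌈ m /2⌉ * 2
  two = linear 3 (λ h h′ m → h :+ h′ :≡ m ∷ h′ :≡ # 1 :+ h ∷ [] ⊢ # 1 :+ m :≡ h′ :* # 2) (⌊ m /2⌋ ∷ ⌈ m /2⌉ ∷ m ∷ []) eq one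

module RecogniseH {n : ℕ} (G : Graph n) (w : Fin n) (c : Fin n → Bool)
                  (proper : ∀ {i j} → i ≢ w → j ≢ w → adj G i j ≡ true → c i ≢ c j) where
  open Counting G
  open Split G w c proper

  inH : ∀ m → n ≡ suc m → ¬ Bipartite G → ∀ a → (∀ i → P i ≡ (i == a)) → (∀ i j → miss i j ≡ P i ∧ Q j) → Balanced m (card A) (card B) → InH n G
  inH m refl nonbip a P≡ miss≡ balanced with InH-sizes m (card A) (card B) balanced
  ... | b , b-ok , sizeA , sizeB = b , b-ok , role , w , a , Q ,
      trans (trans (card-∖ (isB ∘ role) w (role-w-isB)) (cong suc (card-cong isB∖w))) sizeA ,
      trans (card-cong isA-role) sizeB ,
      card-empty isW-role ,
      (trans (cong (λ x → hRole x (c w)) (==-refl w)) refl) , role-a , w≢a ,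
      (λ i Qi → Q⇒sA i Qi) , (let x , e , cx = seen false in x , ∧-intro e (cong not cx)) , other , formula
    where
    open Nonbipartite nonbip
    P-bit : ∀ i → eqᵇ (adj G w i ∧ c i) (i == a) ≡ true
    P-bit i = trans (cong (λ z → eqᵇ z (i == a)) (P≡ i)) (eqᵇ-refl (i == a))
    w-bit : ∀ i → not ((i == w) ∧ adj G w i) ≡ true
    w-bit i with i Finₚ.≟ w
    ... | yes refl = cong not (adj-irrefl G w)
    ... | no _ = refl
    role : Fin n → Side
    role i = hRole (i == w) (c i)
    Pa : P a ≡ true
    Pa = trans (P≡ a) (==-refl a)
    w≢a : w ≢ a
    w≢a = ~⇒≢ (∧-left Pa)
    isA-role : ∀ i → isA (role i) ≡ B i
    isA-role i with i == w | c i
    ... | true | _ = refl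
    ... | false | true = refl
    ... | false | false = refl
    isW-role : ∀ i → isW (role i) ≡ false
    isW-role i with i == w | c i
    ... | true | _ = refl
    ... | false | true = refl
    ... | false | false = refl
    role-w-isB : isB (role w) ≡ true
    role-w-isB = cong (λ x → isB (hRole x (c w))) (==-refl w)
    isB∖w : ∀ i → ((isB ∘ role) ∖ w) i ≡ A i
    isB∖w i with i == w | c i
    ... | true | _ = refl
    ... | false | true = refl
    ... | false | false = refl
    role-a : role a ≡ sB
    role-a = trans (cong₂ hRole (≢⇒== (w≢a ∘ sym)) (∧-right {adj G w a} Pa)) refl
    Q⇒sA : ∀ i → Q i ≡ true → role i ≡ sA
    Q⇒sA i Qi = trans (cong₂ hRole (≢⇒== (~⇒≢ (∧-left Qi) ∘ sym)) (not-true (∧-right {adj G w i} Qi))) refl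
    other : ∃[ i ] (role i ≡ sA × Q i ≡ false)
    other with search-pred (λ i → B i ∧ not (Q i))
    ... | inj₁ (i , h) = i , trans (cong₂ hRole (not-true (∧-left (∧-left {B i} h))) (not-true (∧-right {not (i == w)} (∧-left {B i} h)))) refl , not-true (∧-right {B i} h)
    -- If the neighbours of w exhausted B, then `a` would miss all of B and keep w as its only
    -- neighbour; moving w to the colour of A and `a` to the other one would be a proper colouring.
    ... | inj₂ none = ⊥-elim (nonbip (c′ , λ i j → ok i j))
      where
      c′ : Fin n → Bool
      c′ i = ((i == w) ∨ c i) ∧ not (i == a)
      ok : ∀ i j → i ~ j → c′ i ≢ c′ j
      ok i j ij e = true≢false (trans (sym ij) (trans (adj-normal (λ i j → P i ∧ Q j) miss≡ i j) (not-true collapse)))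
        where
        full : ∀ i → not ((not (i == w) ∧ not (c i)) ∧ not (adj G w i ∧ not (c i))) ≡ true
        full i = cong not (none i)
        collapse : not (normal (i == w) (c i) (adj G w i) (j == w) (c j) (adj G w j) (P i ∧ Q j) (P j ∧ Q i)) ≡ true
        collapse = bool⇒ 8 (λ wi ci ai pi wj cj aj pj → eqᵇ ((wi ∨ ci) ∧ not ai) ((wj ∨ cj) ∧ not aj) ∧ (eqᵇ (pi ∧ ci) ai ∧ (eqᵇ (pj ∧ cj) aj ∧
              (not (wi ∧ pi) ∧ (not (wj ∧ pj) ∧ (not ((not wi ∧ not ci) ∧ not (pi ∧ not ci)) ∧ not ((not wj ∧ not cj) ∧ not (pj ∧ not cj))))))))
           (λ wi ci ai pi wj cj aj pj → not (normal wi ci pi wj cj pj ((pi ∧ ci) ∧ (pj ∧ not cj)) ((pj ∧ cj) ∧ (pi ∧ not ci))))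
           ((i == w) ∷ c i ∷ (i == a) ∷ adj G w i ∷ (j == w) ∷ c j ∷ (j == a) ∷ adj G w j ∷ [])
           (∧-intro (trans (cong (λ z → eqᵇ z (c′ j)) e) (eqᵇ-refl (c′ j))) (∧-intro (P-bit i) (∧-intro (P-bit j)
             (∧-intro (w-bit i) (∧-intro (w-bit j) (∧-intro (full i) (full j)))))))
    formula : ∀ i j → adj G i j ≡ hFormula (i == w) (c i) (i == a) (adj G w i) (j == w) (c j) (j == a) (adj G w j)
    formula i j = trans (adj-normal (λ i j → P i ∧ Q j) miss≡ i j)
      (eqᵇ-true (bool⇒ 8 (λ wi ci ai pi wj cj aj pj → eqᵇ (pi ∧ ci) ai ∧ (eqᵇ (pj ∧ cj) aj ∧ (not (wi ∧ pi) ∧ not (wj ∧ pj))))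
        (λ wi ci ai pi wj cj aj pj → eqᵇ (normal wi ci pi wj cj pj ((pi ∧ ci) ∧ (pj ∧ not cj)) ((pj ∧ cj) ∧ (pi ∧ not ci))) (hFormula wi ci ai pi wj cj aj pj))
        ((i == w) ∷ c i ∷ (i == a) ∷ adj G w i ∷ (j == w) ∷ c j ∷ (j == a) ∷ adj G w j ∷ [])
        (∧-intro (P-bit i) (∧-intro (P-bit j) (∧-intro (w-bit i) (w-bit j))))))

-- 𝓖(n): the triangle is w = w₃, a = w₂, b = w₁.

gT : (ai bi ci pi aj bj cj pj : Bool) → Bool
gT ai bi ci pi aj bj cj pj = (ai ∧ (not bj ∧ (pj ∧ not cj))) ∨ (bj ∧ (not ai ∧ (pi ∧ ci)))

gFormula : (e wi ai bi ci pi wj aj bj cj pj : Bool) → Bool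
gFormula e wi ai bi ci pi wj aj bj cj pj =
  crossAB ri rj ∨ (isW ri ∧ isW rj ∧ not e)
  ∨ (bi ∧ isA rj ∧ not (not aj ∧ (pj ∧ cj))) ∨ (bj ∧ isA ri ∧ not (not ai ∧ (pi ∧ ci)))
  ∨ (ai ∧ isB rj ∧ not (not bj ∧ (pj ∧ not cj))) ∨ (aj ∧ isB ri ∧ not (not bi ∧ (pi ∧ not ci)))
  ∨ (wi ∧ ((not aj ∧ (pj ∧ cj)) ∨ (not bj ∧ (pj ∧ not cj)))) ∨ (wj ∧ ((not ai ∧ (pi ∧ ci)) ∨ (not bi ∧ (pi ∧ not ci))))
  where
  ri rj : Side
  ri = roleOf (wi ∨ ai ∨ bi) ci
  rj = roleOf (wj ∨ aj ∨ bj) cj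

-- A truth table cannot see how its bits depend on each other. This guard records the relations
-- among the bits of one vertex, and `gSame` those that tie two vertices to the bit e of their
-- equality.
gGuard : (wi ai bi ci pi : Bool) → Bool
gGuard wi ai bi ci pi = not (wi ∧ ai) ∧ (not (wi ∧ bi) ∧ (not (ai ∧ bi) ∧ ((not ai ∨ (pi ∧ ci)) ∧ ((not bi ∨ (pi ∧ not ci)) ∧ (not wi ∨ not pi)))))

gSame : (e wi ai bi ci pi wj aj bj cj pj : Bool) → Bool
gSame e wi ai bi ci pi wj aj bj cj pj =
  (not (wi ∧ wj) ∨ e) ∧ ((not (ai ∧ aj) ∨ e) ∧ ((not (bi ∧ bj) ∨ e) ∧
    ((not e ∨ eqᵇ wi wj) ∧ ((not e ∨ eqᵇ ai aj) ∧ (not e ∨ eqᵇ bi bj)))))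

Balanced-pred : ∀ m x y → Balanced (suc (suc m)) (suc x) (suc y) → Balanced m x y
Balanced-pred m x y (inj₁ (e , f)) = inj₁ (ℕₚ.suc-injective e , ℕₚ.suc-injective f)
Balanced-pred m x y (inj₂ (e , f)) = inj₂ (ℕₚ.suc-injective e , ℕₚ.suc-injective f)

module RecogniseG {n : ℕ} (G : Graph n) (w : Fin n) (c : Fin n → Bool)
                  (proper : ∀ {i j} → i ≢ w → j ≢ w → adj G i j ≡ true → c i ≢ c j)
                  (no-diamond : ∀ {u u′ y y′} → adj G u u′ ≡ true → adj G u y ≡ true → adj G u′ y ≡ true → adj G u y′ ≡ true → adj G u′ y′ ≡ true → y ≢ y′ → ⊥) where
  open Counting G
  open Split G w c proper

  module _ {a b : Fin n} (wa : w ~ a) (wb : w ~ b) (ab : a ~ b) (ca : c a ≡ true) (cb : c b ≡ false) where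

    X₁ Y₁ : Pred n
    X₁ i = not (i == a) ∧ (adj G w i ∧ c i)
    Y₁ i = not (i == b) ∧ (adj G w i ∧ not (c i))

    Tᵍ : Fin n → Fin n → Bool
    Tᵍ i j = gT (i == a) (i == b) (c i) (adj G w i) (j == a) (j == b) (c j) (adj G w j)

    a≢b : a ≢ b
    a≢b = ~⇒≢ ab

    -- A neighbour of w other than b that is adjacent to a would share the edge wa with b and
    -- complete a diamond; symmetrically for the edge wb.
    T-miss : ∀ i j → Tᵍ i j ≡ true → miss i j ≡ true
    T-miss i j h with ∨-case {(i == a) ∧ (not (j == b) ∧ (adj G w j ∧ not (c j)))} h
    ... | inj₁ h₁ = from (==⇒≡ {i = i} (∧-left h₁)) (==⇒≢ (not-true (∧-left (∧-right {i == a} h₁)))) (∧-right {not (j == b)} (∧-right {i == a} h₁))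
      where
      from : i ≡ a → j ≢ b → Q j ≡ true → miss i j ≡ true
      from refl ne Qj = ∧-intro (A-intro (~⇒≢ wa ∘ sym) ca) (∧-intro (B-intro (~⇒≢ (∧-left Qj) ∘ sym) (not-true (∧-right {adj G w j} Qj)))
        (cong not (≢true λ aj → no-diamond wa wb ab (∧-left Qj) aj (ne ∘ sym))))
    ... | inj₂ h₂ = from (==⇒≡ {i = j} (∧-left h₂)) (==⇒≢ (not-true (∧-left (∧-right {j == b} h₂)))) (∧-right {not (i == a)} (∧-right {j == b} h₂))
      where
      from : j ≡ b → i ≢ a → P i ≡ true → miss i j ≡ true
      from refl ne Pi = ∧-intro (A-intro (~⇒≢ (∧-left Pi) ∘ sym) (∧-right {adj G w i} Pi)) (∧-intro (B-intro (~⇒≢ wb ∘ sym) cb)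
        (cong not (≢true λ ib → no-diamond wb wa (~-sym ab) (∧-left Pi) (~-sym ib) (ne ∘ sym))))

    T-total : ∑ (λ i → ∑ (λ j → bit (Tᵍ i j))) ≡ card Y₁ + card X₁
    T-total = trans (∑-cong (λ i → trans (∑-cong (pt i)) (∑-+ (row i) (col i))))
      (trans (∑-+ (∑ ∘ row) (∑ ∘ col)) (cong₂ _+_ (∑∑-row a (bit ∘ Y₁)) (∑∑-col b (bit ∘ X₁))))
      where
      row col : Fin n → Fin n → ℕ
      row i j = if i == a then bit (Y₁ j) else 0
      col i j = if j == b then bit (X₁ i) else 0
      pt : ∀ i j → bit (Tᵍ i j) ≡ row i j + col i j
      pt i j with i == a | j == b
      ... | true | true = refl
      ... | true | false = trans (cong bit (Boolₚ.∨-identityʳ _)) (sym (ℕₚ.+-identityʳ _))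
      ... | false | true = refl
      ... | false | false = refl

    card-P : card P ≡ suc (card X₁)
    card-P = trans (card-∖ P a (∧-intro wa ca)) (cong suc (card-cong (λ i → Boolₚ.∧-comm (P i) _)))

    card-Q : card Q ≡ suc (card Y₁)
    card-Q = trans (card-∖ Q b (∧-intro wb (cong not cb))) (cong suc (card-cong (λ i → Boolₚ.∧-comm (Q i) _)))

    module Exact (exact : ∀ i j → miss i j ≡ Tᵍ i j) where

      guard : ∀ i → gGuard (i == w) (i == a) (i == b) (c i) (adj G w i) ≡ true
      guard i = ∧-intro (apart i (~⇒≢ wa)) (∧-intro (apart i (~⇒≢ wb)) (∧-intro (apart i a≢b)
        (∧-intro (at-vertex P (∧-intro wa ca) i) (∧-intro (at-vertex Q (∧-intro wb (cong not cb)) i) (at-vertex (not ∘ adj G w) (cong not (adj-irrefl G w)) i)))))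

      same : ∀ i j → gSame (i == j) (i == w) (i == a) (i == b) (c i) (adj G w i) (j == w) (j == a) (j == b) (c j) (adj G w j) ≡ true
      same i j = ∧-intro (both w i j) (∧-intro (both a i j) (∧-intro (both b i j) (∧-intro (same-bit w i j) (∧-intro (same-bit a i j) (same-bit b i j)))))

      role : Fin n → Side
      role i = roleOf ((i == w) ∨ (i == a) ∨ (i == b)) (c i)

      formula : ∀ i j → adj G i j ≡ gFormula (i == j) (i == w) (i == a) (i == b) (c i) (adj G w i) (j == w) (j == a) (j == b) (c j) (adj G w j)
      formula i j = trans (adj-normal Tᵍ exact i j)
        (eqᵇ-true (bool⇒ 11 (λ e wi ai bi ci pi wj aj bj cj pj → gGuard wi ai bi ci pi ∧ (gGuard wj aj bj cj pj ∧ gSame e wi ai bi ci pi wj aj bj cj pj))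
          (λ e wi ai bi ci pi wj aj bj cj pj → eqᵇ (normal wi ci pi wj cj pj (gT ai bi ci pi aj bj cj pj) (gT aj bj cj pj ai bi ci pi))
             (gFormula e wi ai bi ci pi wj aj bj cj pj))
          ((i == j) ∷ (i == w) ∷ (i == a) ∷ (i == b) ∷ c i ∷ adj G w i ∷ (j == w) ∷ (j == a) ∷ (j == b) ∷ c j ∷ adj G w j ∷ [])
          (∧-intro (guard i) (∧-intro (guard j) (same i j)))))

      isA-role : ∀ i → isA (role i) ≡ (A ∖ a) i
      isA-role i = eqᵇ-true (bool⇒ 5 gGuard (λ wi ai bi ci pi → eqᵇ (isA (roleOf (wi ∨ ai ∨ bi) ci)) ((not wi ∧ ci) ∧ not ai))
        ((i == w) ∷ (i == a) ∷ (i == b) ∷ c i ∷ adj G w i ∷ []) (guard i))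

      isB-role : ∀ i → isB (role i) ≡ (B ∖ b) i
      isB-role i = eqᵇ-true (bool⇒ 5 gGuard (λ wi ai bi ci pi → eqᵇ (isB (roleOf (wi ∨ ai ∨ bi) ci)) ((not wi ∧ not ci) ∧ not bi))
        ((i == w) ∷ (i == a) ∷ (i == b) ∷ c i ∷ adj G w i ∷ []) (guard i))

      W-count : card (isW ∘ role) ≡ 3
      W-count = trans (cards≡ ((isW ∘ role) ∷ []) ((_== w) ∷ (_== a) ∷ (_== b) ∷ []) pt) (cong₂ _+_ (card-single w) (cong₂ _+_ (card-single a) (card-single b)))
        where
        pt : ∀ i → bit (isW (role i)) ≡ bit (i == w) + (bit (i == a) + bit (i == b))
        pt i with i == w | i == a | i == b | guard i
        ... | true | false | false | _ = refl
        ... | false | true | false | _ = refl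
        ... | false | false | true | _ = refl
        ... | false | false | false | _ with c i
        ...   | true = refl
        ...   | false = refl

      X₁-role : ∀ i → X₁ i ≡ true → role i ≡ sA
      X₁-role i h = sA-inv (trans (isA-role i) (∧-intro (A-intro (~⇒≢ (∧-left (∧-right {not (i == a)} h)) ∘ sym) (∧-right {adj G w i} (∧-right {not (i == a)} h))) (∧-left h)))
        where
        sA-inv : ∀ {s} → isA s ≡ true → s ≡ sA
        sA-inv {sA} _ = refl

      Y₁-role : ∀ i → Y₁ i ≡ true → role i ≡ sB
      Y₁-role i h = sB-inv (trans (isB-role i) (∧-intro (B-intro (~⇒≢ (∧-left (∧-right {not (i == b)} h)) ∘ sym) (not-true (∧-right {adj G w i} (∧-right {not (i == b)} h)))) (∧-left h)))
        where
        sB-inv : ∀ {s} → isB s ≡ true → s ≡ sB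
        sB-inv {sB} _ = refl

      X₁Y₁-edge : ∀ {x y} → X₁ x ≡ true → Y₁ y ≡ true → x ~ y
      X₁Y₁-edge {x} {y} hx hy = ≢false (λ e → true≢false (trans (sym
          (∧-intro {A x} (A-intro (~⇒≢ (∧-left (∧-right {not (x == a)} hx)) ∘ sym) (∧-right {adj G w x} (∧-right {not (x == a)} hx)))
            (∧-intro (B-intro (~⇒≢ (∧-left (∧-right {not (y == b)} hy)) ∘ sym) (not-true (∧-right {adj G w y} (∧-right {not (y == b)} hy)))) (cong not e))))
          (trans (exact x y) (cong₂ (λ p q → (p ∧ (not (y == b) ∧ (adj G w y ∧ not (c y)))) ∨ (q ∧ (not p ∧ (adj G w x ∧ c x)))) (not-true (∧-left {not (x == a)} hx)) (not-true (∧-left {not (y == b)} hy))))))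

      -- All edges between X₁ and Y₁ are present and w sees both sets. A second vertex in either set
      -- would put two triangles on one edge at w.
      product : card X₁ * card Y₁ ≤ 1
      product = ℕₚ.≮⇒≥ two
        where
        X₁w : ∀ {x} → X₁ x ≡ true → w ~ x
        X₁w {x} h = ∧-left (∧-right {not (x == a)} h)
        Y₁w : ∀ {y} → Y₁ y ≡ true → w ~ y
        Y₁w {y} h = ∧-left (∧-right {not (y == b)} h)
        wide : ∀ {p q} → 1 < p * q → (1 ≤ p × 1 ≤ q) × (2 ≤ p ⊎ 2 ≤ q)
        wide {suc (suc p)} {suc q} _ = (s≤s z≤n , s≤s z≤n) , inj₁ (s≤s (s≤s z≤n))
        wide {suc zero} {suc (suc q)} _ = (s≤s z≤n , s≤s z≤n) , inj₂ (s≤s (s≤s z≤n))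
        wide {suc zero} {suc zero} (s≤s ())
        wide {suc p} {zero} h with subst (1 <_) (ℕₚ.*-zeroʳ p) h
        ... | ()
        two : 1 < card X₁ * card Y₁ → ⊥
        two h with wide {card X₁} {card Y₁} h
        ... | (x≥1 , y≥1) , alt with card-pos⁻¹ X₁ x≥1 | card-pos⁻¹ Y₁ y≥1
        ... | x , hx | y , hy with alt
        ...   | inj₁ x≥2 = let x′ , hx′ , ne = pick (x ∷ []) X₁ x≥2 in
                no-diamond (Y₁w {y} hy) (X₁w {x} hx) (~-sym (X₁Y₁-edge {x} {y} hx hy)) (X₁w {x′} hx′) (~-sym (X₁Y₁-edge {x′} {y} hx′ hy)) (λ e → ne (here (sym e)))
        ...   | inj₂ y≥2 = let y′ , hy′ , ne = pick (y ∷ []) Y₁ y≥2 in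
                no-diamond (X₁w {x} hx) (Y₁w {y} hy) (X₁Y₁-edge {x} {y} hx hy) (Y₁w {y′} hy′) (X₁Y₁-edge {x} {y′} hx hy′) (λ e → ne (here (sym e)))

      inG : ∀ m → n ≡ suc (suc (suc m)) → Balanced (suc (suc m)) (card A) (card B) → InG n G
      inG m refl balanced = role , b , a , w , X₁ , Y₁ , sizes balanced′ , W-count ,
        role-at b (bool⇒ 3 (λ x y z → z) (λ x y z → x ∨ y ∨ z) ((b == w) ∷ (b == a) ∷ (b == b) ∷ []) (==-refl b)) ,
        role-at a (bool⇒ 3 (λ x y z → y) (λ x y z → x ∨ y ∨ z) ((a == w) ∷ (a == a) ∷ (a == b) ∷ []) (==-refl a)) ,
        role-at w (bool⇒ 3 (λ x y z → x) (λ x y z → x ∨ y ∨ z) ((w == w) ∷ (w == a) ∷ (w == b) ∷ []) (==-refl w)) ,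
        a≢b ∘ sym , ~⇒≢ wb ∘ sym , ~⇒≢ wa ∘ sym , X₁-role , Y₁-role , product , formula
        where
        role-at : ∀ i → (i == w) ∨ (i == a) ∨ (i == b) ≡ true → role i ≡ sW
        role-at i h = cong (λ x → roleOf x (c i)) h
        balanced′ : Balanced m (card (A ∖ a)) (card (B ∖ b))
        balanced′ = Balanced-pred m (card (A ∖ a)) (card (B ∖ b)) (subst₂ (Balanced (suc (suc m))) (card-∖ A a (A-intro (~⇒≢ wa ∘ sym) ca)) (card-∖ B b (B-intro (~⇒≢ wb ∘ sym) cb)) balanced)
        sizes : Balanced m (card (A ∖ a)) (card (B ∖ b)) →
          ((card (isA ∘ role) ≡ ⌈ m /2⌉ × card (isB ∘ role) ≡ ⌊ m /2⌋) ⊎ (card (isA ∘ role) ≡ ⌊ m /2⌋ × card (isB ∘ role) ≡ ⌈ m /2⌉))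
        sizes (inj₁ (e , f)) = inj₁ (trans (card-cong isA-role) e , trans (card-cong isB-role) f)
        sizes (inj₂ (e , f)) = inj₂ (trans (card-cong isA-role) e , trans (card-cong isB-role) f)

-- K ∘ K₃: w and v are the two pendant triangle vertices.

circFormula : (e wi vi zi ci wj vj zj cj : Bool) → Bool
circFormula e wi vi zi ci wj vj zj cj = crossAB ri rj ∨ (isW ri ∧ isW rj ∧ not e) ∨ (isW ri ∧ zj) ∨ (isW rj ∧ zi)
  where
  ri rj : Side
  ri = roleOf (wi ∨ vi) ci
  rj = roleOf (wj ∨ vj) cj

circGuard : (wi vi zi ci : Bool) → Bool
circGuard wi vi zi ci = not (wi ∧ vi) ∧ (not (wi ∧ zi) ∧ (not (vi ∧ zi) ∧ (not zi ∨ not ci)))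

circT : (vi wj vj zj cj : Bool) → Bool
circT vi wj vj zj cj = vi ∧ ((not wj ∧ not (vj ∨ cj)) ∧ not zj)

module RecogniseCirc {n : ℕ} (G : Graph n) (w v z : Fin n) (c : Fin n → Bool)
    (w≢v : w ≢ v) (wv : adj G w v ≡ true) (wz : adj G w z ≡ true) (vz : adj G v z ≡ true)
    (w-nb : ∀ {i} → adj G w i ≡ true → i ≡ v ⊎ i ≡ z) (v-nb : ∀ {i} → adj G v i ≡ true → i ≡ w ⊎ i ≡ z)
    (proper : ∀ {i j} → i ≢ w → i ≢ v → j ≢ w → j ≢ v → adj G i j ≡ true → c i ≢ c j) (cz : c z ≡ false) where
  open Counting G

  -- Treating the graph as bipartite off w alone lets `Split` apply here too. The other pendant
  -- vertex v is coloured opposite to its neighbour z, at the price of missing every vertex of B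
  -- except z.
  c′ : Fin n → Bool
  c′ i = (i == v) ∨ c i

  proper′ : ∀ {i j} → i ≢ w → j ≢ w → i ~ j → c′ i ≢ c′ j
  proper′ {i} {j} i≢w j≢w ij with i Finₚ.≟ v | j Finₚ.≟ v
  ... | yes refl | yes refl = ⊥-elim (~⇒≢ ij refl)
  ... | yes refl | no _ = pendant (v-nb ij)
    where
    pendant : j ≡ w ⊎ j ≡ z → true ≢ c j
    pendant (inj₁ e) = ⊥-elim (j≢w e)
    pendant (inj₂ refl) e = true≢false (trans e cz)
  ... | no _ | yes refl = pendant (v-nb (~-sym ij))
    where
    pendant : i ≡ w ⊎ i ≡ z → c i ≢ true
    pendant (inj₁ e) = ⊥-elim (i≢w e)
    pendant (inj₂ refl) e = true≢false (trans (sym e) cz)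
  ... | no i≢v | no j≢v = proper i≢w i≢v j≢w j≢v ij

  open Split G w c′ proper′

  v≢z : v ≢ z
  v≢z = ~⇒≢ vz

  w≢z : w ≢ z
  w≢z = ~⇒≢ wz

  c′z : c′ z ≡ false
  c′z = trans (cong (_∨ c z) (≢⇒== (v≢z ∘ sym))) cz

  adj-w : ∀ i → adj G w i ≡ (i == v) ∨ (i == z)
  adj-w i with i Finₚ.≟ v | i Finₚ.≟ z
  ... | yes refl | _ = wv
  ... | no _ | yes refl = wz
  ... | no i≢v | no i≢z = ≢true (λ e → case w-nb e of λ { (inj₁ h) → i≢v h ; (inj₂ h) → i≢z h })

  guard : ∀ i → circGuard (i == w) (i == v) (i == z) (c i) ≡ true
  guard i = ∧-intro (apart i w≢v) (∧-intro (apart i w≢z) (∧-intro (apart i v≢z) (at-vertex (not ∘ c) (cong not cz) i)))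

  degree-w : card P + card Q ≡ 2
  degree-w = cong₂ _+_ (trans (card-cong Pv) (card-single v)) (trans (card-cong Qz) (card-single z))
    where
    Pv : ∀ i → P i ≡ (i == v)
    Pv i = trans (cong (_∧ c′ i) (adj-w i)) (eqᵇ-true (bool⇒ 4 circGuard (λ wi vi zi ci → eqᵇ ((vi ∨ zi) ∧ (vi ∨ ci)) vi) ((i == w) ∷ (i == v) ∷ (i == z) ∷ c i ∷ []) (guard i)))
    Qz : ∀ i → Q i ≡ (i == z)
    Qz i = trans (cong (_∧ not (c′ i)) (adj-w i)) (eqᵇ-true (bool⇒ 4 circGuard (λ wi vi zi ci → eqᵇ ((vi ∨ zi) ∧ not (vi ∨ ci)) zi) ((i == w) ∷ (i == v) ∷ (i == z) ∷ c i ∷ []) (guard i)))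

  Tᶜ : Fin n → Fin n → Bool
  Tᶜ i j = circT (i == v) (j == w) (j == v) (j == z) (c j)

  T-miss : ∀ i j → Tᶜ i j ≡ true → miss i j ≡ true
  T-miss i j h = from (==⇒≡ {i = i} (∧-left h))
    where
    Bj : B j ≡ true
    Bj = ∧-left (∧-right {i == v} h)
    j≢z : j ≢ z
    j≢z = ==⇒≢ (not-true (∧-right {B j} (∧-right {i == v} h)))
    from : i ≡ v → miss i j ≡ true
    from refl = ∧-intro (A-intro (w≢v ∘ sym) (trans (cong (_∨ c v) (==-refl v)) refl)) (∧-intro Bj (cong not (≢true (λ e → far (v-nb e)))))
      where
      far : j ≡ w ⊎ j ≡ z → ⊥
      far (inj₁ e) = ==⇒≢ (not-true (∧-left Bj)) e
      far (inj₂ e) = j≢z e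

  Bz : B z ≡ true
  Bz = B-intro (w≢z ∘ sym) c′z

  T-total : ∑ (λ i → ∑ (λ j → bit (Tᶜ i j))) ≡ card (B ∖ z)
  T-total = trans (∑-cong (λ i → ∑-cong (λ j → pt i j))) (∑∑-row v (bit ∘ (B ∖ z)))
    where
    pt : ∀ i j → bit (Tᶜ i j) ≡ (if i == v then bit ((B ∖ z) j) else 0)
    pt i j with i == v
    ... | true = refl
    ... | false = refl

  Av : A v ≡ true
  Av = A-intro (w≢v ∘ sym) (cong (_∨ c v) (==-refl v))

  A₀ : ℕ
  A₀ = card (A ∖ v)

  circ-count : edges G + M ≡ (1 + A₀) * card B + 2
  circ-count = trans count (cong₂ (λ x y → x * card B + y) (card-∖ A v Av) degree-w)

  circ-size : suc (suc (A₀ + card B)) ≡ n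
  circ-size = trans (cong (λ x → suc (x + card B)) (sym (card-∖ A v Av))) size

  isCirc : (∀ i j → miss i j ≡ Tᶜ i j) → IsCirc A₀ (card B) G
  isCirc exact = role , z , card-cong isA-role , card-cong isB-role , W-count , role-z , formula
    where
    role : Fin n → Side
    role i = roleOf ((i == w) ∨ (i == v)) (c i)
    isA-role : ∀ i → isA (role i) ≡ (A ∖ v) i
    isA-role i = eqᵇ-true (bool⇒ 4 circGuard (λ wi vi zi ci → eqᵇ (isA (roleOf (wi ∨ vi) ci)) ((not wi ∧ (vi ∨ ci)) ∧ not vi)) ((i == w) ∷ (i == v) ∷ (i == z) ∷ c i ∷ []) (guard i))
    isB-role : ∀ i → isB (role i) ≡ B i
    isB-role i = eqᵇ-true (bool⇒ 4 circGuard (λ wi vi zi ci → eqᵇ (isB (roleOf (wi ∨ vi) ci)) (not wi ∧ not (vi ∨ ci))) ((i == w) ∷ (i == v) ∷ (i == z) ∷ c i ∷ []) (guard i))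
    W-count : card (isW ∘ role) ≡ 2
    W-count = trans (cards≡ ((isW ∘ role) ∷ []) ((_== w) ∷ (_== v) ∷ []) pt) (cong₂ _+_ (card-single w) (card-single v))
      where
      pt : ∀ i → bit (isW (role i)) ≡ bit (i == w) + bit (i == v)
      pt i with i == w | i == v | guard i
      ... | true | false | _ = refl
      ... | false | true | _ = refl
      ... | false | false | _ with c i
      ...   | true = refl
      ...   | false = refl
    role-z : role z ≡ sB
    role-z = trans (cong₂ (λ x y → roleOf (x ∨ y) (c z)) (≢⇒== (w≢z ∘ sym)) (≢⇒== (v≢z ∘ sym))) (cong (roleOf false) cz)
    formula : ∀ i j → adj G i j ≡ circFormula (i == j) (i == w) (i == v) (i == z) (c i) (j == w) (j == v) (j == z) (c j)
    formula i j = trans (adj-normal Tᶜ exact i j)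
      (trans (cong₂ (λ pi pj → normal (i == w) (c′ i) pi (j == w) (c′ j) pj (Tᶜ i j) (Tᶜ j i)) (adj-w i) (adj-w j))
        (eqᵇ-true (bool⇒ 9 (λ e wi vi zi ci wj vj zj cj → circGuard wi vi zi ci ∧ (circGuard wj vj zj cj ∧ ((not (wi ∧ wj) ∨ e) ∧ ((not (vi ∧ vj) ∨ e) ∧ ((not e ∨ eqᵇ wi wj) ∧ (not e ∨ eqᵇ vi vj))))))
          (λ e wi vi zi ci wj vj zj cj → eqᵇ (normal wi (vi ∨ ci) (vi ∨ zi) wj (vj ∨ cj) (vj ∨ zj) (circT vi wj vj zj cj) (circT vj wi vi zi ci)) (circFormula e wi vi zi ci wj vj zj cj))
          ((i == j) ∷ (i == w) ∷ (i == v) ∷ (i == z) ∷ c i ∷ (j == w) ∷ (j == v) ∷ (j == z) ∷ c j ∷ [])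
          (∧-intro (guard i) (∧-intro (guard j) (∧-intro (both w i j) (∧-intro (both v i j) (∧-intro (same-bit w i j) (same-bit v i j)))))))))

  -- The pairs missed by v number |B| - 1, so `circ-count` gives e ≤ A₀|B| + 3, and e at least the
  -- maximum leaves room neither for another missing pair nor for unbalanced parts.
  circ-complete : ∀ m → n ≡ suc (suc m) → half² m + 3 ≤ edges G → Balanced m A₀ (card B) × IsCirc A₀ (card B) G
  circ-complete m n≡ many = balanced , isCirc (miss-exact Tᶜ T-miss M≤)
    where
    sums : A₀ + card B ≡ m
    sums = ℕₚ.suc-injective (ℕₚ.suc-injective (trans circ-size n≡))
    card-B : card B ≡ suc (card (B ∖ z))
    card-B = card-∖ B z Bz
    M≥ : card (B ∖ z) ≤ M
    M≥ = subst (_≤ M) T-total (miss≥ Tᶜ T-miss)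
    small : A₀ * card B ≤ half² m
    small = proj₁ (product-max m A₀ (card B) sums)
    M≤ : M ≤ ∑ (λ i → ∑ (λ j → bit (Tᶜ i j)))
    M≤ = subst (M ≤_) (sym T-total) (linear 6 (λ e M x h b b′ → e :+ M :≡ b :+ x :+ # 2 ∷ x :≤ h ∷ h :+ # 3 :≤ e ∷ b :≡ # 1 :+ b′ ∷ [] ⊢ M :≤ b′)
      (edges G ∷ M ∷ A₀ * card B ∷ half² m ∷ card B ∷ card (B ∖ z) ∷ []) circ-count small many card-B)
    balanced : Balanced m A₀ (card B)
    balanced = proj₂ (product-max m A₀ (card B) sums) (linear 6 (λ e M x h b b′ → e :+ M :≡ b :+ x :+ # 2 ∷ b′ :≤ M ∷ h :+ # 3 :≤ e ∷ b :≡ # 1 :+ b′ ∷ [] ⊢ h :≤ x)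
      (edges G ∷ M ∷ A₀ * card B ∷ half² m ∷ card B ∷ card (B ∖ z) ∷ []) circ-count M≥ many card-B)

-- Near-extremal graphs belong to the extremal families

threshold : ℕ → ℕ
threshold K = turán₀ K + 100 + 100000 + 200 * K

one-of : ∀ {p q} → 1 ≤ p → 1 ≤ q → p * q + 1 ≤ p + q → p ≡ 1 ⊎ q ≡ 1
one-of {suc zero} _ _ _ = inj₁ refl
one-of {suc (suc p)} {suc zero} _ _ _ = inj₂ refl
one-of {suc (suc p)} {suc (suc q)} _ _ h = ⊥-elim (linear 2 (λ p q → (# 2 :+ p) :* (# 2 :+ q) :+ # 1 :≤ (# 2 :+ p) :+ (# 2 :+ q) ∷ [] ⊢ absurd) (p ∷ q ∷ []) h)

Balanced-swap : ∀ {m a b} → Balanced m a b → Balanced m b a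
Balanced-swap (inj₁ (e , f)) = inj₂ (f , e)
Balanced-swap (inj₂ (e , f)) = inj₁ (f , e)

module NearComplete (q r a : ℕ) (q≡ : q ≡ suc a * 2) (regime : Regime a r) (K : ℕ) (K-large : q + r + 10 ≤ K)
                    {n : ℕ} (G : Graph n) (free : Free G (q + r) (thetaAdj q r)) (n-large : threshold K ≤ n) where
  open Structure q r a q≡ regime K K-large G free public

  sufficient : Sufficient
  sufficient = record
    { n≥M₀ = linear 3 (λ m k n → m :+ # 100 :+ # 100000 :+ # 200 :* k :≤ n ∷ [] ⊢ m :+ # 100 :≤ n) (turán₀ K ∷ K ∷ n ∷ []) n-large
    ; n≥10⁵ = linear 3 (λ m k n → m :+ # 100 :+ # 100000 :+ # 200 :* k :≤ n ∷ [] ⊢ # 100000 :≤ n) (turán₀ K ∷ K ∷ n ∷ []) n-large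
    ; n≥200K = linear 3 (λ m k n → m :+ # 100 :+ # 100000 :+ # 200 :* k :≤ n ∷ [] ⊢ # 200 :* k :≤ n) (turán₀ K ∷ K ∷ n ∷ []) n-large }

  open Large sufficient public

  -- Since m² ≤ 4⌊m²/4⌋ + 1, one edge above ⌊m²/4⌋ already yields 4e ≥ m² + 3.
  near-extremal : ∀ m → n ≡ suc m → half² m + 1 ≤ edges G → ¬ Bipartite G → Near
  near-extremal m n≡ many nonbip = near m n≡
    (linear 4 (λ mm h e E → mm :≤ # 4 :* h :+ # 1 ∷ h :+ # 1 :≤ e ∷ E :≡ # 2 :* e ∷ [] ⊢ mm :+ # 3 :≤ # 2 :* E)
      (m * m ∷ half² m ∷ edges G ∷ E all ∷ []) (sq≤4half²+1 m) many E-all) nonbip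

  module AtNear (m : ℕ) (n≡ : n ≡ suc m) (nonbip : ¬ Bipartite G) (N : Near) where
    open Near N public

    proper≢ : ∀ {i j} → i ≢ w → j ≢ w → i ~ j → c i ≢ c j
    proper≢ i≢ j≢ = proper (∖-intro all refl i≢) (∖-intro all refl j≢)

    open Split G w c proper≢ public
    open Nonbipartite nonbip public

    not-proper : ∀ {i j} → i ≢ w → j ≢ w → i ~ j → not (c i) ≢ not (c j)
    not-proper i≢ j≢ e h = proper≢ i≢ j≢ e (Boolₚ.not-injective h)

    module Flip = Split G w (not ∘ c) not-proper

    flip-A : card Flip.B ≡ card A
    flip-A = card-cong (λ i → cong (not (i == w) ∧_) (Boolₚ.not-involutive (c i)))

    flip-miss : ∀ i j → Flip.miss i j ≡ miss j i
    flip-miss i j = trans (cong₂ (λ x y → B i ∧ ((not (j == w) ∧ x) ∧ not y)) (Boolₚ.not-involutive (c j)) (adj-sym G i j))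
      (bool≡ 3 (λ x y z → x ∧ (y ∧ z)) (λ x y z → y ∧ (x ∧ z)) (B i ∷ A j ∷ not (adj G j i) ∷ []))

    sums : card A + card B ≡ m
    sums = ℕₚ.suc-injective (trans size n≡)

    AB≤ : card A * card B ≤ half² m
    AB≤ = proj₁ (product-max m (card A) (card B) sums)

    balanced : half² m ≤ card A * card B → Balanced m (card A) (card B)
    balanced = proj₂ (product-max m (card A) (card B) sums)

    PQ≤ : card P + card Q ≤ card P * card Q + 1
    PQ≤ = sum≤product+1 P-pos Q-pos

    -- Without an edge between P and Q all |P||Q| pairs are missing, at least |P| + |Q| - 1 of them,
    -- and then e ≤ ⌊m²/4⌋ + 1. A second extra edge thus forces a triangle at w.
    adjacent-pair : half² m + 2 ≤ edges G → ∃[ x ] ∃[ y ] w ~ x × w ~ y × x ~ y × c x ≡ true × c y ≡ false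
    adjacent-pair many with Finₚ.any? (λ x → Finₚ.any? (λ y → (P x ∧ (Q y ∧ adj G x y)) Boolₚ.≟ true))
    ... | yes (x , y , h) = x , y , ∧-left (∧-left {P x} h) , ∧-left (∧-left {Q y} (∧-right {P x} h)) , ∧-right {Q y} (∧-right {P x} h) ,
            ∧-right {adj G w x} (∧-left {P x} h) , not-true (∧-right {adj G w y} (∧-left {Q y} (∧-right {P x} h)))
    ... | no none = ⊥-elim (linear 6 (λ e M ab pq s h → e :+ M :≡ ab :+ s ∷ pq :≤ M ∷ s :≤ pq :+ # 1 ∷ ab :≤ h ∷ h :+ # 2 :≤ e ∷ [] ⊢ absurd)
        (edges G ∷ M ∷ card A * card B ∷ card P * card Q ∷ card P + card Q ∷ half² m ∷ []) count
        (subst (_≤ M) (∑∑-product P Q) (miss≥ (λ i j → P i ∧ Q j) (PQ-miss (λ {i} {j} Pi Qj ij → none (i , j , ∧-intro Pi (∧-intro Qj ij))))))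
        PQ≤ AB≤ many)

-- Triangles at w are excluded, so M ≥ |P||Q|. With at least ⌊m²/4⌋ + 1 edges this forces
-- (|P|-1)(|Q|-1) ≤ 0, and the part of size one is the vertex u₂; which side it lies on decides
-- whether the colours are exchanged.
complete-H : ∀ q r a (q≡ : q ≡ suc a * 2) (a≡0 : a ≡ 0) b (r≡ : r ≡ suc (suc b * 2)) K → q + r + 10 ≤ K → ∀ m (G : Graph (suc m)) →
  threshold K ≤ suc m → Free G (q + r) (thetaAdj q r) → ¬ Bipartite G → half² m + 1 ≤ edges G → InH (suc m) G
complete-H q r a q≡ a≡0 b r≡ K K-large m G n-large free nonbip many = conclude (near-extremal m refl many nonbip)
  where
  open NearComplete q r a q≡ (two-odd a≡0 b r≡) K K-large G free n-large
  conclude : Near → InH (suc m) G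
  conclude N = finish (one-of P-pos Q-pos (linear 6 (λ e M ab pq s h → e :+ M :≡ ab :+ s ∷ pq :≤ M ∷ ab :≤ h ∷ h :+ # 1 :≤ e ∷ [] ⊢ pq :+ # 1 :≤ s)
      (edges G ∷ M ∷ card A * card B ∷ card P * card Q ∷ card P + card Q ∷ half² m ∷ []) count pq≤M AB≤ many))
    where
    open AtNear m refl nonbip N
    none : ∀ {i j} → P i ≡ true → Q j ≡ true → i ~ j → ⊥
    none {i} {j} Pi Qj ij = triangle (∧-left Pi) (∧-left Qj) ij
      (λ e → true≢false (trans (sym (∧-right {adj G w i} Pi)) (trans e (not-true (∧-right {adj G w j} Qj)))))
    pq≤M : card P * card Q ≤ M
    pq≤M = subst (_≤ M) (∑∑-product P Q) (miss≥ (λ i j → P i ∧ Q j) (PQ-miss none))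
    exact : ∀ i j → miss i j ≡ P i ∧ Q j
    exact = miss-exact (λ i j → P i ∧ Q j) (PQ-miss none) (subst (M ≤_) (sym (∑∑-product P Q))
      (linear 6 (λ e M ab pq s h → e :+ M :≡ ab :+ s ∷ s :≤ pq :+ # 1 ∷ ab :≤ h ∷ h :+ # 1 :≤ e ∷ [] ⊢ M :≤ pq)
        (edges G ∷ M ∷ card A * card B ∷ card P * card Q ∷ card P + card Q ∷ half² m ∷ []) count PQ≤ AB≤ many))
    bal : Balanced m (card A) (card B)
    bal = balanced (linear 6 (λ e M ab pq s h → e :+ M :≡ ab :+ s ∷ pq :≤ M ∷ s :≤ pq :+ # 1 ∷ h :+ # 1 :≤ e ∷ [] ⊢ h :≤ ab)
        (edges G ∷ M ∷ card A * card B ∷ card P * card Q ∷ card P + card Q ∷ half² m ∷ []) count pq≤M PQ≤ many)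
    unique : ∀ (S : Pred (suc m)) → card S ≡ 1 → ∀ {x} → S x ≡ true → ∀ i → S i ≡ (i == x)
    unique S one {x} Sx i with i Finₚ.≟ x
    ... | yes refl = Sx
    ... | no ne = ≢true (λ Si → ne (card≤1-unique S (ℕₚ.≤-reflexive one) Si Sx))
    finish : card P ≡ 1 ⊎ card Q ≡ 1 → InH (suc m) G
    finish (inj₁ one) = let x , e , cx = seen true in
      RecogniseH.inH G w c proper≢ m refl nonbip x (unique P one (∧-intro e cx)) exact bal
    finish (inj₂ one) = let x , e , cx = seen false in
      RecogniseH.inH G w (not ∘ c) not-proper m refl nonbip x (unique Q one (∧-intro e (cong not cx)))
        (λ i j → trans (flip-miss i j) (trans (exact j i) (trans (Boolₚ.∧-comm (P j) (Q i)) (cong (λ z → Q i ∧ (adj G w j ∧ z)) (sym (Boolₚ.not-involutive (c j)))))))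
        (subst (Balanced m (card B)) (sym flip-A) (Balanced-swap {m} {card A} {card B} bal))

-- Each neighbour of w outside the triangle adds one to the degree of w and, by diamond-freeness,
-- costs one missing pair. The gains cancel, which is why the family has free choices of X₁ and Y₁.
complete-G : ∀ q r a (q≡ : q ≡ suc a * 2) (a≡0 : a ≡ 0) (r≡ : r ≡ 2) K → q + r + 10 ≤ K → ∀ k (G : Graph (suc (suc (suc k)))) →
  threshold K ≤ suc (suc (suc k)) → Free G (q + r) (thetaAdj q r) → ¬ Bipartite G → half² (suc (suc k)) + 2 ≤ edges G → InG (suc (suc (suc k))) G
complete-G q r a q≡ a≡0 r≡ K K-large k G n-large free nonbip many = conclude (near-extremal m refl many′ nonbip)
  where
  m : ℕ
  m = suc (suc k)
  open NearComplete q r a q≡ (two-two a≡0 r≡) K K-large G free n-large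
  many′ : half² m + 1 ≤ edges G
  many′ = linear 2 (λ h e → h :+ # 2 :≤ e ∷ [] ⊢ h :+ # 1 :≤ e) (half² m ∷ edges G ∷ []) many
  conclude : Near → InG (suc m) G
  conclude N = from (adjacent-pair many)
    where
    open AtNear m refl nonbip N
    from : (∃[ x ] ∃[ y ] w ~ x × w ~ y × x ~ y × c x ≡ true × c y ≡ false) → InG (suc m) G
    from (x , y , wx , wy , xy , cx , cy) = R.Exact.inG wx wy xy cx cy
        (miss-exact (R.Tᵍ wx wy xy cx cy) (R.T-miss wx wy xy cx cy) (subst (M ≤_) (sym total)
          (linear 6 (λ e M ab x y h → e :+ M :≡ ab :+ ((# 1 :+ x) :+ (# 1 :+ y)) ∷ ab :≤ h ∷ h :+ # 2 :≤ e ∷ [] ⊢ M :≤ y :+ x)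
            (edges G ∷ M ∷ card A * card B ∷ X ∷ Y ∷ half² m ∷ []) count′ AB≤ many)))
        k refl (balanced (linear 6 (λ e M ab x y h → e :+ M :≡ ab :+ ((# 1 :+ x) :+ (# 1 :+ y)) ∷ y :+ x :≤ M ∷ h :+ # 2 :≤ e ∷ [] ⊢ h :≤ ab)
            (edges G ∷ M ∷ card A * card B ∷ X ∷ Y ∷ half² m ∷ []) count′ (subst (_≤ M) total (miss≥ (R.Tᵍ wx wy xy cx cy) (R.T-miss wx wy xy cx cy))) many))
      where
      module R = RecogniseG G w c proper≢ (no-diamond a≡0 r≡)
      X Y : ℕ
      X = card (R.X₁ wx wy xy cx cy)
      Y = card (R.Y₁ wx wy xy cx cy)
      total : ∑ (λ i → ∑ (λ j → bit (R.Tᵍ wx wy xy cx cy i j))) ≡ Y + X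
      total = R.T-total wx wy xy cx cy
      count′ : edges G + M ≡ card A * card B + (suc X + suc Y)
      count′ = trans count (cong (card A * card B +_) (cong₂ _+_ (R.card-P wx wy xy cx cy) (R.card-Q wx wy xy cx cy)))

-- The triangle forced by the edge count allows w no third neighbour, so w contributes 2 and nothing
-- may be missing between A and B.
complete-bullet : ∀ q r a (q≡ : q ≡ suc a * 2) b (r≡ : r ≡ suc (suc b) * 2) K → q + r + 10 ≤ K → ∀ m (G : Graph (suc m)) →
  threshold K ≤ suc m → Free G (q + r) (thetaAdj q r) → ¬ Bipartite G → half² m + 2 ≤ edges G → InBullet (suc m) G
complete-bullet q r a q≡ b r≡ K K-large m G n-large free nonbip many = conclude (near-extremal m refl many′ nonbip)
  where
  open NearComplete q r a q≡ (r-even b r≡) K K-large G free n-large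
  many′ : half² m + 1 ≤ edges G
  many′ = linear 2 (λ h e → h :+ # 2 :≤ e ∷ [] ⊢ h :+ # 1 :≤ e) (half² m ∷ edges G ∷ []) many
  conclude : Near → InBullet (suc m) G
  conclude N = from (adjacent-pair many)
    where
    open AtNear m refl nonbip N
    from : (∃[ x ] ∃[ y ] w ~ x × w ~ y × x ~ y × c x ≡ true × c y ≡ false) → InBullet (suc m) G
    from (x , y , wx , wy , xy , cx , cy) = by-balance (balanced (linear 4 (λ e M ab h → e :+ M :≡ ab :+ # 2 ∷ h :+ # 2 :≤ e ∷ [] ⊢ h :≤ ab)
          (edges G ∷ M ∷ card A * card B ∷ half² m ∷ []) count′ many))
      where
      only : ∀ z → w ~ z → z ≡ x ⊎ z ≡ y
      only = triangle wx wy xy (λ e → true≢false (trans (sym cx) (trans e cy)))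
      adj-w : ∀ i → adj G w i ≡ (i == x) ∨ (i == y)
      adj-w i with i Finₚ.≟ x | i Finₚ.≟ y
      ... | yes refl | _ = wx
      ... | no _ | yes refl = wy
      ... | no i≢x | no i≢y = ≢true (λ e → case only i e of λ { (inj₁ h) → i≢x h ; (inj₂ h) → i≢y h })
      deg-w : card P + card Q ≡ 2
      deg-w = trans (cards≡ (P ∷ Q ∷ []) ((_== x) ∷ (_== y) ∷ []) (λ i → trans (bit-split (adj G w i) (c i)) (trans (cong bit (adj-w i)) (pt i)))) (cong₂ _+_ (card-single x) (card-single y))
        where
        pt : ∀ i → bit ((i == x) ∨ (i == y)) ≡ bit (i == x) + bit (i == y)
        pt i with i Finₚ.≟ x | i Finₚ.≟ y
        ... | yes refl | yes refl = ⊥-elim (~⇒≢ xy refl)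
        ... | yes refl | no _ = refl
        ... | no _ | yes refl = refl
        ... | no _ | no _ = refl
      count′ : edges G + M ≡ card A * card B + 2
      count′ = trans count (cong (card A * card B +_) deg-w)
      M≡0 : M ≡ 0
      M≡0 = linear 4 (λ e M ab h → e :+ M :≡ ab :+ # 2 ∷ ab :≤ h ∷ h :+ # 2 :≤ e ∷ [] ⊢ M :≡ # 0) (edges G ∷ M ∷ card A * card B ∷ half² m ∷ []) count′ AB≤ many
      full : ∀ i j → miss i j ≡ false
      full = miss-exact (λ _ _ → false) (λ _ _ ()) (ℕₚ.≤-trans (ℕₚ.≤-reflexive M≡0) z≤n)
      by-balance : Balanced m (card A) (card B) → InBullet (suc m) G
      by-balance (inj₁ (e , f)) = subst₂ (λ s t → IsBullet s t G) e f
        (Recognise.bullet G w c proper≢ cx cy (~⇒≢ wx ∘ sym) (~⇒≢ wy ∘ sym) adj-w full)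
      by-balance (inj₂ (e , f)) = subst₂ (λ s t → IsBullet s t G) f (trans flip-A e)
        (Recognise.bullet G w (not ∘ c) not-proper (cong not cy) (cong not cx) (~⇒≢ wy ∘ sym) (~⇒≢ wx ∘ sym)
          (λ i → trans (adj-w i) (Boolₚ.∨-comm (i == x) (i == y))) (λ i j → trans (flip-miss i j) (full j i)))

complete-circ : ∀ q r a (q≡ : q ≡ suc a * 2) a′ (a≡ : a ≡ suc a′) b (r≡ : r ≡ suc (suc b * 2)) K → q + r + 10 ≤ K → ∀ m (G : Graph (suc (suc m))) →
  threshold K ≤ suc (suc m) → Free G (q + r) (thetaAdj q r) → ¬ Bipartite G → half² m + 3 ≤ edges G → InCirc (suc (suc m)) G
complete-circ q r a q≡ a′ a≡ b r≡ K K-large m G n-large free nonbip many = conclude (F.far m refl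
    (linear 4 (λ mm h e E → mm :≤ # 4 :* h :+ # 1 ∷ h :+ # 3 :≤ e ∷ E :≡ # 2 :* e ∷ [] ⊢ mm :+ # 11 :≤ # 2 :* E)
      (m * m ∷ half² m ∷ edges G ∷ E all ∷ []) (sq≤4half²+1 m) many E-all) nonbip)
  where
  open NearComplete q r a q≡ (big-odd a′ a≡ b r≡) K K-large G free n-large
  module F = Far q r a q≡ (big-odd a′ a≡ b r≡) K K-large G free sufficient a′ a≡ b r≡
  conclude : F.Pendant → InCirc (suc (suc m)) G
  conclude p = by-colour (c z) refl
    where
    open F.Pendant p
    inside : ∀ {i} → i ≢ w → i ≢ w′ → (all ∖ w ∖ w′) i ≡ true
    inside i≢w i≢w′ = ∖-intro (all ∖ w) (∖-intro all refl i≢w) i≢w′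
    place : ∀ {s t} → Balanced m s t × IsCirc s t G → InCirc (suc (suc m)) G
    place (inj₁ (e , f) , circ) = inj₁ (subst₂ (λ s t → IsCirc s t G) e f circ)
    place (inj₂ (e , f) , circ) = inj₂ (subst₂ (λ s t → IsCirc s t G) e f circ)
    by-colour : ∀ β → c z ≡ β → InCirc (suc (suc m)) G
    by-colour false cz = place (RecogniseCirc.circ-complete G w w′ z c w≢w′ ww′ wz w′z w-neighbours w′-neighbours
      (λ i₁ i₂ j₁ j₂ → proper (inside i₁ i₂) (inside j₁ j₂)) cz m refl many)
    by-colour true cz = place (RecogniseCirc.circ-complete G w w′ z (not ∘ c) w≢w′ ww′ wz w′z w-neighbours w′-neighbours
      (λ i₁ i₂ j₁ j₂ e h → proper (inside i₁ i₂) (inside j₁ j₂) e (Boolₚ.not-injective h)) (cong not cz) m refl many)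

-- Embedded theta graphs

thetaAdj-intro : ∀ q r i j → suc (toℕ i) ≡ toℕ j ⊎ (toℕ i ≡ 0 × (suc (toℕ j) ≡ q + r ⊎ toℕ j ≡ q)) → thetaAdj q r i j ≡ true
thetaAdj-intro q r i j h = bool⇒ 6 (λ s s′ c c′ d d′ → s ∨ c ∨ d) (λ s s′ c c′ d d′ → s ∨ s′ ∨ c ∨ c′ ∨ d ∨ d′)
    ((suc a ≡ᵇ b) ∷ (suc b ≡ᵇ a) ∷ ((a ≡ᵇ 0) ∧ (suc b ≡ᵇ q + r)) ∷ ((b ≡ᵇ 0) ∧ (suc a ≡ᵇ q + r)) ∷ ((a ≡ᵇ 0) ∧ (b ≡ᵇ q)) ∷ ((b ≡ᵇ 0) ∧ (a ≡ᵇ q)) ∷ [])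
    (some h)
  where
  a b : ℕ
  a = toℕ i
  b = toℕ j
  eq : ∀ {x y} → x ≡ y → (x ≡ᵇ y) ≡ true
  eq {x} {y} h = T⇒≡ (ℕₚ.≡⇒≡ᵇ x y h)
  select : Bool → Bool
  select s = s ∨ ((a ≡ᵇ 0) ∧ (suc b ≡ᵇ q + r)) ∨ ((a ≡ᵇ 0) ∧ (b ≡ᵇ q))
  some : suc a ≡ b ⊎ (a ≡ 0 × (suc b ≡ q + r ⊎ b ≡ q)) → select (suc a ≡ᵇ b) ≡ true
  some (inj₁ e) = cong select (eq e)
  some (inj₂ (e , inj₁ f)) = bool⇒ 3 (λ x y z → y) (λ x y z → x ∨ y ∨ z) ((suc a ≡ᵇ b) ∷ ((a ≡ᵇ 0) ∧ (suc b ≡ᵇ q + r)) ∷ ((a ≡ᵇ 0) ∧ (b ≡ᵇ q)) ∷ []) (∧-intro (eq e) (eq f))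
  some (inj₂ (e , inj₂ f)) = bool⇒ 3 (λ x y z → z) (λ x y z → x ∨ y ∨ z) ((suc a ≡ᵇ b) ∷ ((a ≡ᵇ 0) ∧ (suc b ≡ᵇ q + r)) ∷ ((a ≡ᵇ 0) ∧ (b ≡ᵇ q)) ∷ []) (∧-intro (eq e) (eq f))

module Embedded {n : ℕ} (G : Graph n) (a r′ : ℕ) (f : Fin (suc a * 2 + suc (suc r′)) → Fin n)
                (f-injective : ∀ {i j} → f i ≡ f j → i ≡ j)
                (f-edge : ∀ i j → thetaAdj (suc a * 2) (suc (suc r′)) i j ≡ true → adj G (f i) (f j) ≡ true) where
  open Counting G

  q r N : ℕ
  q = suc a * 2
  r = suc (suc r′)
  N = q + r

  -- Lets the theta graph be walked by natural numbers; the default 0 outside the range is never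
  -- relied upon.
  index : ℕ → Fin N
  index k with k ℕₚ.<? N
  ... | yes h = Fin.fromℕ< h
  ... | no _ = zero

  toℕ-index : ∀ {k} → k < N → toℕ (index k) ≡ k
  toℕ-index {k} h with k ℕₚ.<? N
  ... | yes h′ = Finₚ.toℕ-fromℕ< h′
  ... | no nh = ⊥-elim (nh h)

  g : ℕ → Fin n
  g k = f (index k)

  g-injective : ∀ {i j} → i < N → j < N → g i ≡ g j → i ≡ j
  g-injective hi hj e = trans (sym (toℕ-index hi)) (trans (cong toℕ (f-injective e)) (toℕ-index hj))

  g-distinct : ∀ {i j} → i < N → j < N → i ≢ j → g i ≢ g j
  g-distinct hi hj ne e = ne (g-injective hi hj e)

  g-step : ∀ {k} → suc k < N → g k ~ g (suc k)
  g-step {k} h = f-edge (index k) (index (suc k)) (thetaAdj-intro q r (index k) (index (suc k))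
    (inj₁ (trans (cong suc (toℕ-index (ℕₚ.<-trans (ℕₚ.n<1+n k) h))) (sym (toℕ-index h)))))

  q<N : q < N
  q<N = linear 2 (λ q r → [] ⊢ q :< q :+ (# 2 :+ r)) (q ∷ r′ ∷ [])

  g-close : g 0 ~ g (q + suc r′)
  g-close = f-edge (index 0) (index (q + suc r′)) (thetaAdj-intro q r (index 0) (index (q + suc r′)) 
    (inj₂ (toℕ-index (s≤s z≤n) , inj₁ (trans (cong suc (toℕ-index last<N)) (sym (ℕₚ.+-suc q (suc r′)))))))
    where
    last<N : q + suc r′ < N
    last<N = linear 2 (λ q r → [] ⊢ q :+ (# 1 :+ r) :< q :+ (# 2 :+ r)) (q ∷ r′ ∷ [])

  g-chord : g 0 ~ g q
  g-chord = f-edge (index 0) (index q) (thetaAdj-intro q r (index 0) (index q) (inj₂ (toℕ-index (s≤s z≤n) , inj₂ (toℕ-index q<N))))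

  alternate : ∀ (c : Fin n → Bool) s j → (∀ {d} → d < j * 2 → c (g (s + d)) ≢ c (g (s + suc d))) → c (g s) ≡ c (g (s + j * 2))
  alternate c s zero h = cong (c ∘ g) (sym (ℕₚ.+-identityʳ s))
  alternate c s (suc j) h = trans (alternate c s j (λ lt → h (ℕₚ.<-trans lt (ℕₚ.<-trans (ℕₚ.n<1+n _) (ℕₚ.n<1+n _)))))
    (≢-≢⇒≡ (h (ℕₚ.<-trans (ℕₚ.n<1+n _) (ℕₚ.n<1+n _))) (h (ℕₚ.n<1+n _)))

  module OffVertex (w : Fin n) (c : Fin n → Bool) (proper : ∀ {i j} → i ≢ w → j ≢ w → i ~ j → c i ≢ c j) where

    -- The first cycle 0, …, q has odd length q + 1.
    hits-first : (∀ k → k ≤ q → g k ≢ w) → ⊥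
    hits-first avoid = proper (avoid 0 z≤n) (avoid q ℕₚ.≤-refl) g-chord
      (alternate c 0 (suc a) (λ {d} lt → proper (avoid d (ℕₚ.<⇒≤ lt)) (avoid (suc d) lt) (g-step (ℕₚ.≤-trans (s≤s lt) q<N))))

    -- The second cycle q, …, q + r − 1, 0 has odd length r + 1 when r is even.
    hits-second : ∀ b → r′ ≡ b * 2 → g 0 ≢ w → (∀ d → d < r → g (q + d) ≢ w) → ⊥
    hits-second b refl avoid₀ avoid = proper avoid₀ (subst (λ z → g z ≢ w) (ℕₚ.+-identityʳ q) (avoid 0 (s≤s z≤n))) g-chord
      (trans (≢-≢⇒≡ {c (g 0)} (proper avoid₀ (avoid (suc (b * 2)) ℕₚ.≤-refl) g-close)
                (λ e → edge-at (ℕₚ.n<1+n (b * 2)) (sym e)))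
             (sym (alternate c q b (λ lt → edge-at (ℕₚ.<-trans lt (ℕₚ.n<1+n _))))))
      where
      edge-at : ∀ {d} → d < suc (b * 2) → c (g (q + d)) ≢ c (g (q + suc d))
      edge-at {d} lt = proper (avoid d (ℕₚ.<-trans lt (ℕₚ.n<1+n _))) (avoid (suc d) (s≤s lt))
        (subst (λ z → g (q + d) ~ g z) (sym (ℕₚ.+-suc q d)) (g-step (subst (_< N) (ℕₚ.+-suc q d) (ℕₚ.+-monoʳ-< q (s≤s lt)))))

  module TwoNeighbours {v s t : Fin n} (nb : ∀ {i} → v ~ i → i ≡ s ⊎ i ≡ t) where

    three : ∀ {x y z} → x ≡ s ⊎ x ≡ t → y ≡ s ⊎ y ≡ t → z ≡ s ⊎ z ≡ t → x ≢ y → x ≢ z → y ≢ z → ⊥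
    three (inj₁ refl) (inj₁ refl) _ xy _ _ = xy refl
    three (inj₂ refl) (inj₂ refl) _ xy _ _ = xy refl
    three (inj₁ refl) (inj₂ refl) (inj₁ refl) _ xz _ = xz refl
    three (inj₁ refl) (inj₂ refl) (inj₂ refl) _ _ yz = yz refl
    three (inj₂ refl) (inj₁ refl) (inj₁ refl) _ _ yz = yz refl
    three (inj₂ refl) (inj₁ refl) (inj₂ refl) _ xz _ = xz refl

    1<N : 1 < N
    1<N = s≤s (s≤s z≤n)

    last<N : q + suc r′ < N
    last<N = linear 2 (λ q r → [] ⊢ q :+ (# 1 :+ r) :< q :+ (# 2 :+ r)) (q ∷ r′ ∷ [])

    -- Positions 0 and q are the branch vertices of the theta graph, with three neighbours each.
    not-start : g 0 ≢ v
    not-start refl = three (nb (g-step 1<N)) (nb g-chord) (nb g-close)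
      (g-distinct 1<N q<N (λ ())) (g-distinct 1<N last<N (λ ())) (g-distinct q<N last<N (λ e → ℕₚ.m≢1+m+n q (trans e (ℕₚ.+-suc q r′))))

    not-chord-end : g q ≢ v
    not-chord-end refl = three (nb (~-sym (g-step q<N))) (nb (g-step 1+q<N)) (nb (~-sym g-chord))
      (g-distinct (ℕₚ.<-trans (ℕₚ.n<1+n _) q<N) 1+q<N (λ e → ℕₚ.<-irrefl e (ℕₚ.<-trans (ℕₚ.n<1+n _) (ℕₚ.n<1+n _))))
      (g-distinct (ℕₚ.<-trans (ℕₚ.n<1+n _) q<N) (s≤s z≤n) (λ ())) (g-distinct 1+q<N (s≤s z≤n) (λ ()))
      where
      1+q<N : suc q < N
      1+q<N = linear 2 (λ q r → [] ⊢ # 1 :+ q :< q :+ (# 2 :+ r)) (q ∷ r′ ∷ [])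

  search≤ : ∀ w k → (∃[ i ] i ≤ k × g i ≡ w) ⊎ (∀ i → i ≤ k → g i ≢ w)
  search≤ w zero with g 0 Finₚ.≟ w
  ... | yes e = inj₁ (0 , z≤n , e)
  ... | no ne = inj₂ (λ { zero _ → ne })
  search≤ w (suc k) with search≤ w k | g (suc k) Finₚ.≟ w
  ... | inj₁ (i , le , e) | _ = inj₁ (i , ℕₚ.m≤n⇒m≤1+n le , e)
  ... | inj₂ _ | yes e = inj₁ (suc k , ℕₚ.≤-refl , e)
  ... | inj₂ none | no ne = inj₂ (λ i le → case ℕₚ.m≤n⇒m<n∨m≡n le of λ where
    (inj₁ (s≤s lt)) → none i lt
    (inj₂ refl) → ne)

  -- Two odd cycles sharing only an edge cannot both pass through a vertex of degree two.
  two-odd-cycles : ∀ b → r′ ≡ b * 2 → ∀ {w s t} (c : Fin n → Bool) → (∀ {i j} → i ≢ w → j ≢ w → i ~ j → c i ≢ c j) →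
    (∀ {i} → w ~ i → i ≡ s ⊎ i ≡ t) → ⊥
  two-odd-cycles b r′≡ {w} c proper nb with search≤ w q
  ... | inj₂ avoid = hits-first avoid
    where open OffVertex w c proper
  ... | inj₁ (k , k≤q , refl) = hits-second b r′≡ not-start (λ d d<r e → beyond d d<r (g-injective (ℕₚ.+-monoʳ-< q d<r) (ℕₚ.≤-<-trans k≤q q<N) e))
    where
    open OffVertex w c proper
    open TwoNeighbours nb
    beyond : ∀ d → d < r → q + d ≡ k → ⊥
    beyond zero _ e = not-chord-end (cong g (trans (sym (ℕₚ.+-identityʳ q)) e))
    beyond (suc d) _ e = ℕₚ.<⇒≱ (subst (q <_) e (ℕₚ.m<m+n q (s≤s z≤n))) k≤q

  -- The odd cycle 0, ..., q must pass through w, which is no branch vertex, so its two neighbours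
  -- on the path are v and z. Having degree two, v is no branch vertex either and needs a second
  -- neighbour on the path; that could only be w or z, whose positions are already taken.
  pendant-triangle : ∀ {w v z} (c : Fin n → Bool) → (∀ {i j} → i ≢ w → j ≢ w → i ~ j → c i ≢ c j) →
    (∀ {i} → w ~ i → i ≡ v ⊎ i ≡ z) → (∀ {i} → v ~ i → i ≡ w ⊎ i ≡ z) → ⊥
  pendant-triangle {w} {v} {z} c proper w-nb v-nb with search≤ w q
  ... | inj₂ avoid = hits-first avoid
    where open OffVertex w c proper
  ... | inj₁ (zero , _ , e) = TwoNeighbours.not-start w-nb e
  ... | inj₁ (suc k , k<q , refl) with ℕₚ.m≤n⇒m<n∨m≡n k<q
  ...   | inj₂ refl = TwoNeighbours.not-chord-end w-nb refl
  ...   | inj₁ k+1<q = sides (w-nb (~-sym (g-step k+1<N))) (w-nb (g-step k+2<N))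
    where
    k+2<N : suc (suc k) < N
    k+2<N = ℕₚ.≤-<-trans k+1<q q<N
    k+1<N : suc k < N
    k+1<N = ℕₚ.<-trans (ℕₚ.n<1+n _) k+2<N
    k<N : k < N
    k<N = ℕₚ.<-trans (ℕₚ.n<1+n _) k+1<N
    apart₂ : ∀ {x} → g k ≡ x → g (suc (suc k)) ≡ x → ⊥
    apart₂ e e′ = g-distinct k<N k+2<N (λ h → ℕₚ.<-irrefl h (ℕₚ.<-trans (ℕₚ.n<1+n _) (ℕₚ.n<1+n _))) (trans e (sym e′))
    forward : g (suc (suc k)) ≡ v → g k ≡ z → ⊥
    forward refl e with ℕₚ.m≤n⇒m<n∨m≡n k+1<q
    ... | inj₂ end = TwoNeighbours.not-chord-end v-nb (cong g (sym end))
    ... | inj₁ k+2<q = meet (v-nb (g-step k+3<N))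
      where
      k+3<N : suc (suc (suc k)) < N
      k+3<N = ℕₚ.≤-<-trans k+2<q q<N
      meet : g (suc (suc (suc k))) ≡ g (suc k) ⊎ g (suc (suc (suc k))) ≡ z → ⊥
      meet (inj₁ h) = g-distinct k+3<N k+1<N (λ x → ℕₚ.<-irrefl (sym x) (ℕₚ.<-trans (ℕₚ.n<1+n _) (ℕₚ.n<1+n _))) h
      meet (inj₂ h) = g-distinct k+3<N k<N (λ x → ℕₚ.<-irrefl (sym x) (ℕₚ.<-trans (ℕₚ.n<1+n _) (ℕₚ.<-trans (ℕₚ.n<1+n _) (ℕₚ.n<1+n _)))) (trans h (sym e))
    backward : ∀ k → suc (suc k) < N → k < N → g (suc k) ≡ w → g k ≡ v → g (suc (suc k)) ≡ z → ⊥
    backward zero _ _ _ e _ = TwoNeighbours.not-start v-nb e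
    backward (suc k) lt lt′ ew refl e = meet (v-nb (~-sym (g-step lt′)))
      where
      k<N′ : k < N
      k<N′ = ℕₚ.<-trans (ℕₚ.n<1+n _) lt′
      meet : g k ≡ w ⊎ g k ≡ z → ⊥
      meet (inj₁ h) = g-distinct k<N′ (ℕₚ.<-trans (ℕₚ.n<1+n _) lt) (λ x → ℕₚ.<-irrefl x (ℕₚ.<-trans (ℕₚ.n<1+n _) (ℕₚ.n<1+n _))) (trans h (sym ew))
      meet (inj₂ h) = g-distinct k<N′ lt (λ x → ℕₚ.<-irrefl x (ℕₚ.<-trans (ℕₚ.n<1+n _) (ℕₚ.<-trans (ℕₚ.n<1+n _) (ℕₚ.n<1+n _)))) (trans h (sym e))
    sides : g k ≡ v ⊎ g k ≡ z → g (suc (suc k)) ≡ v ⊎ g (suc (suc k)) ≡ z → ⊥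
    sides (inj₁ e) (inj₁ e′) = apart₂ e e′
    sides (inj₂ e) (inj₂ e′) = apart₂ e e′
    sides (inj₂ e) (inj₁ e′) = forward e′ e
    sides (inj₁ e) (inj₂ e′) = backward k k+2<N k<N refl e e′

-- Members of the families: theta-freeness, odd cycles and edge counts

cong₄ : ∀ {A B C D E : Set} (f : A → B → C → D → E) {a a′ b b′ c c′ d d′} → a ≡ a′ → b ≡ b′ → c ≡ c′ → d ≡ d′ → f a b c d ≡ f a′ b′ c′ d′
cong₄ f refl refl refl refl = refl

isB-bits : ∀ s → isB s ≡ not (isA s) ∧ not (isW s)
isB-bits sA = refl
isB-bits sB = refl
isB-bits sW = refl

isA⇒¬isW : ∀ s → not (isA s ∧ isW s) ≡ true
isA⇒¬isW sA = refl
isA⇒¬isW sB = refl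
isA⇒¬isW sW = refl

guard-from : ∀ {n} (p q : Pred n) → (∀ i → p i ≡ true → q i ≡ true) → ∀ i → not (p i) ∨ q i ≡ true
guard-from p q h i with p i in e
... | false = refl
... | true = h i e

Listed : ∀ {n} → Pred n → List (Fin n) → Set
Listed p [] = ⊤
Listed p (v ∷ vs) = p v ≡ true × Listed (p ∖ v) vs

exhaust : ∀ {n} (vs : List (Fin n)) (p : Pred n) → Listed p vs → card p ≡ length vs → ∀ {i} → p i ≡ true → i ∈ vs
exhaust [] p _ size {i} pi = ⊥-elim (true≢false (trans (sym pi) (card-0 p size i)))
exhaust (v ∷ vs) p (pv , rest) size {i} pi with i Finₚ.≟ v
... | yes e = here e
... | no ne = there (exhaust vs (p ∖ v) rest (ℕₚ.suc-injective (trans (sym (card-∖ p v pv)) size)) (∖-intro p pi ne))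

module _ {n : ℕ} (F : Graph n) where
  open Counting F

  triangle-odd-cycle : ∀ {x y z} → x ~ y → x ~ z → y ~ z → ¬ Bipartite F
  triangle-odd-cycle {x} {y} {z} xy xz yz (c , ok) = ok x z xz (≢-≢⇒≡ (ok x y xy) (ok y z yz))

  pentagon-odd-cycle : ∀ {x₁ x₂ x₃ x₄ x₅} → x₁ ~ x₂ → x₂ ~ x₃ → x₃ ~ x₄ → x₄ ~ x₅ → x₅ ~ x₁ → ¬ Bipartite F
  pentagon-odd-cycle {x₁} {x₂} {x₃} {x₄} {x₅} e₁ e₂ e₃ e₄ e₅ (c , ok) =
    ok _ _ e₅ (sym (trans (≢-≢⇒≡ (ok _ _ e₁) (ok _ _ e₂)) (≢-≢⇒≡ (ok _ _ e₃) (ok _ _ e₄))))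

Sound : ∀ {n} → Graph n → ℕ → ℕ → ℕ → Set
Sound F q r N = Free F (q + r) (thetaAdj q r) × ¬ Bipartite F × edges F ≡ N

-- Throughout this part, small letters are bits of the first vertex and capitals those of the
-- second; each guard collects the dependences among such bits under which a truth table is to hold.
bGuard : (α ω x y : Bool) → Bool
bGuard α ω x y = not (α ∧ ω) ∧ ((not x ∨ α) ∧ (not y ∨ (not α ∧ not ω)))

bForm : (β ω B O α x y A X Y : Bool) → Bool
bForm β ω B O α x y A X Y = ((α ∧ B) ∨ (β ∧ A)) ∨ (ω ∧ (X ∨ Y)) ∨ (O ∧ (x ∨ y))

bAdj : (α ω x y A O X Y : Bool) → Bool
bAdj α ω x y A O X Y = bForm (not α ∧ not ω) ω (not A ∧ not O) O α x y A X Y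

sound-bullet : ∀ a b {n} s t (F : Graph n) → IsBullet s t F → Sound F (suc a * 2) (suc b * 2) (s * t + 2)
sound-bullet a b {n} s t F (role , x , y , sizeA , sizeB , sizeW , rx , ry , formula) = from (card-pos⁻¹ (isW ∘ role) (subst (0 <_) (sym sizeW) (s≤s z≤n)))
  where
  open Counting F
  from : (∃[ w ] isW (role w) ≡ true) → Sound F (suc a * 2) (suc b * 2) (s * t + 2)
  from (w , Ww) = free , triangle-odd-cycle F wx wy xy , count′
    where
    c : Fin n → Bool
    c i = isA (role i)
    W≡ : ∀ i → isW (role i) ≡ (i == w)
    W≡ i with i Finₚ.≟ w
    ... | yes refl = Ww
    ... | no ne = ≢true (λ h → ne (card≤1-unique (isW ∘ role) (ℕₚ.≤-reflexive sizeW) h Ww))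
    B≡ : ∀ i → isB (role i) ≡ not (c i) ∧ not (i == w)
    B≡ i = trans (isB-bits (role i)) (cong (λ z → not (c i) ∧ not z) (W≡ i))
    guard : ∀ i → bGuard (c i) (i == w) (i == x) (i == y) ≡ true
    guard i = ∧-intro (trans (cong (λ z → not (c i ∧ z)) (sym (W≡ i))) (isA⇒¬isW (role i)))
      (∧-intro (at-vertex c (cong isA rx) i) (at-vertex (λ i → not (c i) ∧ not (i == w)) (trans (sym (B≡ y)) (cong isB ry)) i))
    form : ∀ i j → adj F i j ≡ bAdj (c i) (i == w) (i == x) (i == y) (c j) (j == w) (j == x) (j == y)
    form i j = trans (formula i j) (cong₄ (λ β ω β′ ω′ → bForm β ω β′ ω′ (c i) (i == x) (i == y) (c j) (j == x) (j == y)) (B≡ i) (W≡ i) (B≡ j) (W≡ j))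
    vec : (i j : Fin n) → Vec Bool 8
    vec i j = c i ∷ (i == w) ∷ (i == x) ∷ (i == y) ∷ c j ∷ (j == w) ∷ (j == x) ∷ (j == y) ∷ []
    guards : ∀ i j → bGuard (c i) (i == w) (i == x) (i == y) ∧ bGuard (c j) (j == w) (j == x) (j == y) ≡ true
    guards i j = ∧-intro (guard i) (guard j)
    proper : ∀ {i j} → i ≢ w → j ≢ w → i ~ j → c i ≢ c j
    proper {i} {j} i≢ j≢ e = not-eqᵇ
      (bool⇒ 8 (λ α ω x y A O X Y → (bGuard α ω x y ∧ bGuard A O X Y) ∧ (not ω ∧ (not O ∧ bAdj α ω x y A O X Y)))
        (λ α ω x y A O X Y → not (eqᵇ α A)) (vec i j)
        (∧-intro (guards i j) (∧-intro (cong not (≢⇒== i≢)) (∧-intro (cong not (≢⇒== j≢)) (trans (sym (form i j)) e)))))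
    open Split F w c proper
    adj-w : ∀ j → adj F w j ≡ (j == x) ∨ (j == y)
    adj-w j = trans (form w j) (eqᵇ-true (bool⇒ 8 (λ α ω x y A O X Y → (bGuard α ω x y ∧ bGuard A O X Y) ∧ ω)
      (λ α ω x y A O X Y → eqᵇ (bAdj α ω x y A O X Y) (X ∨ Y)) (vec w j) (∧-intro (guards w j) (==-refl w))))
    wx : w ~ x
    wx = trans (adj-w x) (cong (_∨ (x == y)) (==-refl x))
    wy : w ~ y
    wy = trans (adj-w y) (trans (cong ((y == x) ∨_) (==-refl y)) (Boolₚ.∨-zeroʳ _))
    xy : x ~ y
    xy = trans (form x y) (bool⇒ 8 (λ α ω x y A O X Y → (bGuard α ω x y ∧ bGuard A O X Y) ∧ (x ∧ Y))
      bAdj (vec x y) (∧-intro (guards x y) (∧-intro (==-refl x) (==-refl y))))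
    nb : ∀ {i} → w ~ i → i ≡ x ⊎ i ≡ y
    nb {i} e with ∨-case {i == x} (trans (sym (adj-w i)) e)
    ... | inj₁ h = inj₁ (==⇒≡ h)
    ... | inj₂ h = inj₂ (==⇒≡ h)
    full : ∀ i j → miss i j ≡ false
    full i j = trans (cong (λ z → A i ∧ (B j ∧ not z)) (form i j)) (not-true (bool⇒ 8 (λ α ω x y A O X Y → bGuard α ω x y ∧ bGuard A O X Y)
      (λ α ω x y A O X Y → not ((not ω ∧ α) ∧ ((not O ∧ not A) ∧ not (bAdj α ω x y A O X Y)))) (vec i j) (guards i j)))
    M≡0 : M ≡ 0
    M≡0 = trans (miss-total (λ _ _ → false) full) (trans (∑-cong (λ (i : Fin n) → ∑-zero n)) (∑-zero n))
    A≡ : card A ≡ s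
    A≡ = trans (card-cong (λ i → eqᵇ-true (bool⇒ 4 bGuard (λ α ω x y → eqᵇ (not ω ∧ α) α) (c i ∷ (i == w) ∷ (i == x) ∷ (i == y) ∷ []) (guard i)))) sizeA
    B-size : card B ≡ t
    B-size = trans (card-cong (λ i → trans (Boolₚ.∧-comm (not (i == w)) (not (c i))) (sym (B≡ i)))) sizeB
    P≡ : card P ≡ 1
    P≡ = trans (card-cong (λ i → trans (cong (_∧ c i) (adj-w i)) (eqᵇ-true (bool⇒ 4 bGuard (λ α ω x y → eqᵇ ((x ∨ y) ∧ α) x) (c i ∷ (i == w) ∷ (i == x) ∷ (i == y) ∷ []) (guard i))))) (card-single x)
    Q≡ : card Q ≡ 1
    Q≡ = trans (card-cong (λ i → trans (cong (_∧ not (c i)) (adj-w i)) (eqᵇ-true (bool⇒ 4 bGuard (λ α ω x y → eqᵇ ((x ∨ y) ∧ not α) y) (c i ∷ (i == w) ∷ (i == x) ∷ (i == y) ∷ []) (guard i))))) (card-single y)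
    count′ : edges F ≡ s * t + 2
    count′ = trans (sym (ℕₚ.+-identityʳ _)) (trans (cong (edges F +_) (sym M≡0)) (trans count (cong₄ (λ a b p q → a * b + (p + q)) A≡ B-size P≡ Q≡)))
    free : Free F (suc a * 2 + suc b * 2) (thetaAdj (suc a * 2) (suc b * 2))
    free (f , inj , hom) = Embedded.two-odd-cycles F a (b * 2) f inj hom b refl c proper nb

cGuard : (α w v z : Bool) → Bool
cGuard α w v z = not (w ∧ v) ∧ (not (α ∧ (w ∨ v)) ∧ (not z ∨ (not α ∧ not (w ∨ v))))

cForm : (β ω B O e α z A Z : Bool) → Bool
cForm β ω B O e α z A Z = ((α ∧ B) ∨ (β ∧ A)) ∨ (ω ∧ O ∧ not e) ∨ (ω ∧ Z) ∨ (O ∧ z)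

cAdj : (e α w v z A W V Z : Bool) → Bool
cAdj e α w v z A W V Z = cForm (not α ∧ not (w ∨ v)) (w ∨ v) (not A ∧ not (W ∨ V)) (W ∨ V) e α z A Z

cSame : (e w v W V : Bool) → Bool
cSame e w v W V = (not (w ∧ W) ∨ e) ∧ ((not (v ∧ V) ∨ e) ∧ ((not e ∨ eqᵇ w W) ∧ (not e ∨ eqᵇ v V)))

cGuard₂ : (e α w v z A W V Z : Bool) → Bool
cGuard₂ e α w v z A W V Z = cGuard α w v z ∧ (cGuard A W V Z ∧ cSame e w v W V)

sound-circ : ∀ a r′ {n} s t (F : Graph n) → IsCirc s t F → Sound F (suc a * 2) (suc (suc r′)) (s * t + 3)
sound-circ a r′ {n} s t F (role , z , sizeA , sizeB , sizeW , rz , formula) = from (card-pos⁻¹ Ω (subst (0 <_) (sym sizeW) (s≤s z≤n)))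
  where
  open Counting F
  Ω : Pred n
  Ω = isW ∘ role
  module Named (w v : Fin n) (Ωw : Ω w ≡ true) (Ωv : Ω v ≡ true) (v≢w : v ≢ w) where
    c : Fin n → Bool
    c i = isA (role i)
    W≡ : ∀ i → Ω i ≡ (i == w) ∨ (i == v)
    W≡ i with i Finₚ.≟ w | i Finₚ.≟ v
    ... | yes refl | _ = Ωw
    ... | no _ | yes refl = Ωv
    ... | no i≢w | no i≢v = ≢true (λ h → case exhaust (w ∷ v ∷ []) Ω (Ωw , ∖-intro Ω Ωv v≢w , tt) sizeW h of λ where
      (here e) → i≢w e
      (there (here e)) → i≢v e)
    B≡ : ∀ i → isB (role i) ≡ not (c i) ∧ not ((i == w) ∨ (i == v))
    B≡ i = trans (isB-bits (role i)) (cong (λ z → not (c i) ∧ not z) (W≡ i))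
    cz : c z ≡ false
    cz = cong isA rz
    guard′ : ∀ i → cGuard (c i) (i == w) (i == v) (i == z) ≡ true
    guard′ i = ∧-intro (apart i (v≢w ∘ sym)) (∧-intro (trans (cong (λ z → not (c i ∧ z)) (sym (W≡ i))) (isA⇒¬isW (role i)))
      (at-vertex (λ i → not (c i) ∧ not ((i == w) ∨ (i == v))) (trans (sym (B≡ z)) (cong isB rz)) i))
    form : ∀ i j → adj F i j ≡ cAdj (i == j) (c i) (i == w) (i == v) (i == z) (c j) (j == w) (j == v) (j == z)
    form i j = trans (formula i j) (cong₄ (λ β ω β′ ω′ → cForm β ω β′ ω′ (i == j) (c i) (i == z) (c j) (j == z)) (B≡ i) (W≡ i) (B≡ j) (W≡ j))
    vec : (i j : Fin n) → Vec Bool 9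
    vec i j = (i == j) ∷ c i ∷ (i == w) ∷ (i == v) ∷ (i == z) ∷ c j ∷ (j == w) ∷ (j == v) ∷ (j == z) ∷ []
    guards : ∀ i j → cGuard₂ (i == j) (c i) (i == w) (i == v) (i == z) (c j) (j == w) (j == v) (j == z) ≡ true
    guards i j = ∧-intro (guard′ i) (∧-intro (guard′ j) (∧-intro (both w i j) (∧-intro (both v i j) (∧-intro (same-bit w i j) (same-bit v i j)))))
    proper : ∀ {i j} → i ≢ w → i ≢ v → j ≢ w → j ≢ v → i ~ j → c i ≢ c j
    proper {i} {j} i≢w i≢v j≢w j≢v e = not-eqᵇ
      (bool⇒ 9 (λ e α w v z A W V Z → cGuard₂ e α w v z A W V Z ∧ ((not w ∧ (not v ∧ (not W ∧ not V))) ∧ cAdj e α w v z A W V Z))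
        (λ e α w v z A W V Z → not (eqᵇ α A)) (vec i j)
        (∧-intro (guards i j) (∧-intro (∧-intro (cong not (≢⇒== i≢w)) (∧-intro (cong not (≢⇒== i≢v)) (∧-intro (cong not (≢⇒== j≢w)) (cong not (≢⇒== j≢v))))) (trans (sym (form i j)) e))))
    row-w : ∀ j → adj F w j ≡ (j == v) ∨ (j == z)
    row-w j = trans (form w j) (eqᵇ-true (bool⇒ 9 (λ e α w v z A W V Z → cGuard₂ e α w v z A W V Z ∧ w)
      (λ e α w v z A W V Z → eqᵇ (cAdj e α w v z A W V Z) (V ∨ Z)) (vec w j) (∧-intro (guards w j) (==-refl w))))
    row-v : ∀ j → adj F v j ≡ (j == w) ∨ (j == z)
    row-v j = trans (form v j) (eqᵇ-true (bool⇒ 9 (λ e α w v z A W V Z → cGuard₂ e α w v z A W V Z ∧ v)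
      (λ e α w v z A W V Z → eqᵇ (cAdj e α w v z A W V Z) (W ∨ Z)) (vec v j) (∧-intro (guards v j) (==-refl v))))
    split : ∀ {i u u′ : Fin n} → (i == u) ∨ (i == u′) ≡ true → i ≡ u ⊎ i ≡ u′
    split {i} {u} h with ∨-case {i == u} h
    ... | inj₁ e = inj₁ (==⇒≡ e)
    ... | inj₂ e = inj₂ (==⇒≡ e)
    second : ∀ (u u′ : Fin n) → (u′ == u) ∨ (u′ == u′) ≡ true
    second u u′ = trans (cong ((u′ == u) ∨_) (==-refl u′)) (Boolₚ.∨-zeroʳ _)
    wv : w ~ v
    wv = trans (row-w v) (cong (_∨ (v == z)) (==-refl v))
    wz : w ~ z
    wz = trans (row-w z) (second v z)
    vz : v ~ z
    vz = trans (row-v z) (second w z)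
    w-nb : ∀ {i} → w ~ i → i ≡ v ⊎ i ≡ z
    w-nb {i} e = split (trans (sym (row-w i)) e)
    v-nb : ∀ {i} → v ~ i → i ≡ w ⊎ i ≡ z
    v-nb {i} e = split (trans (sym (row-v i)) e)
    module R = RecogniseCirc F w v z c (v≢w ∘ sym) wv wz vz w-nb v-nb proper cz
    open Split F w R.c′ R.proper′
    exact : ∀ i j → miss i j ≡ R.Tᶜ i j
    exact i j = trans (cong (λ z → A i ∧ (B j ∧ not z)) (form i j)) (eqᵇ-true (bool⇒ 9 cGuard₂
      (λ e α w v z A W V Z → eqᵇ ((not w ∧ (v ∨ α)) ∧ ((not W ∧ not (V ∨ A)) ∧ not (cAdj e α w v z A W V Z))) (circT v W V Z A)) (vec i j) (guards i j)))
    A₀≡ : R.A₀ ≡ s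
    A₀≡ = trans (card-cong (λ i → eqᵇ-true (bool⇒ 4 cGuard (λ α w v z → eqᵇ ((not w ∧ (v ∨ α)) ∧ not v) α) (c i ∷ (i == w) ∷ (i == v) ∷ (i == z) ∷ []) (guard′ i)))) sizeA
    B-size : card B ≡ t
    B-size = trans (card-cong (λ i → trans (eqᵇ-true (bool⇒ 4 cGuard (λ α w v z → eqᵇ (not w ∧ not (v ∨ α)) (not α ∧ not (w ∨ v))) (c i ∷ (i == w) ∷ (i == v) ∷ (i == z) ∷ []) (guard′ i))) (sym (B≡ i)))) sizeB
    count′ : edges F ≡ s * t + 3
    count′ = subst₂ (λ x y → edges F ≡ x * y + 3) A₀≡ B-size (linear 5 (λ e M x b b′ → e :+ M :≡ b :+ x :+ # 2 ∷ b :≡ # 1 :+ b′ ∷ M :≡ b′ ∷ [] ⊢ e :≡ x :+ # 3)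
      (edges F ∷ M ∷ R.A₀ * card B ∷ card B ∷ card (B ∖ z) ∷ []) R.circ-count (card-∖ B z R.Bz) (trans (miss-total R.Tᶜ exact) R.T-total))
    free : Free F (suc a * 2 + suc (suc r′)) (thetaAdj (suc a * 2) (suc (suc r′)))
    free (f , inj , hom) = Embedded.pendant-triangle F a r′ f inj hom R.c′ R.proper′ w-nb v-nb
    result : Sound F (suc a * 2) (suc (suc r′)) (s * t + 3)
    result = free , triangle-odd-cycle F wv wz vz , count′
  from : (∃[ w ] Ω w ≡ true) → Sound F (suc a * 2) (suc (suc r′)) (s * t + 3)
  from (w , Ωw) = from₂ (pick (w ∷ []) Ω (subst (1 <_) (sym sizeW) (s≤s (s≤s z≤n))))
    where
    from₂ : (∃[ v ] Ω v ≡ true × v ∉ (w ∷ [])) → Sound F (suc a * 2) (suc (suc r′)) (s * t + 3)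
    from₂ (v , Ωv , v∉) = Named.result w v Ωw Ωv (λ e → v∉ (here e))

hGuard : (α p q x : Bool) → Bool
hGuard α p q x = not (p ∧ q) ∧ ((not p ∨ not α) ∧ ((not q ∨ not α) ∧ (not x ∨ α)))

hForm : (β B α p q x A P Q X : Bool) → Bool
hForm β B α p q x A P Q X = (α ∧ B ∧ hEdge x P Q) ∨ (A ∧ β ∧ hEdge X p q) ∨ (p ∧ Q) ∨ (q ∧ P)

hAdj : (α p q x A P Q X : Bool) → Bool
hAdj α p q x A P Q X = hForm (not α) (not A) α p q x A P Q X

hGuard₂ : (α p q x A P Q X : Bool) → Bool
hGuard₂ α p q x A P Q X = hGuard α p q x ∧ hGuard A P Q X

-- For b = 1 the order n = m + 1 is even, so the two halves of m differ by one and the shift by b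
-- just exchanges them.
InH-product : ∀ m b {x y} → b ≡ 0 ⊎ (b ≡ 1 × 2 ∣ suc m) → suc y ≡ ⌈ suc m /2⌉ + b → x ≡ ⌊ suc m /2⌋ ∸ b → y * x ≡ half² m
InH-product m .0 {x} {y} (inj₁ refl) ey ex = trans (cong₂ _*_ (trans (ℕₚ.suc-injective ey) (ℕₚ.+-identityʳ _)) ex) (ℕₚ.*-comm ⌊ m /2⌋ ⌈ m /2⌉)
InH-product m .1 {x} {y} (inj₂ (refl , divides k k≡)) ey ex with halves m
... | eq , le , le′ = cong₂ _*_ (trans (ℕₚ.suc-injective ey) (trans (ℕₚ.+-comm _ 1) (sym one))) (trans ex (cong (_∸ 1) one))
  where
  h h′ : ℕ
  h = ⌊ m /2⌋
  h′ = ⌈ m /2⌉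
  odd≢ : h ≢ h′
  odd≢ e with ℕₚ.≤-total k h
  ... | inj₁ k≤h = linear 4 (λ m k h h′ → h :+ h′ :≡ m ∷ h :≡ h′ ∷ # 1 :+ m :≡ k :* # 2 ∷ k :≤ h ∷ [] ⊢ absurd) (m ∷ k ∷ h ∷ h′ ∷ []) eq e k≡ k≤h
  ... | inj₂ h≤k with ℕₚ.m≤n⇒m<n∨m≡n h≤k
  ...   | inj₁ lt = linear 4 (λ m k h h′ → h :+ h′ :≡ m ∷ h :≡ h′ ∷ # 1 :+ m :≡ k :* # 2 ∷ h :< k ∷ [] ⊢ absurd) (m ∷ k ∷ h ∷ h′ ∷ []) eq e k≡ lt
  ...   | inj₂ e′ = linear 4 (λ m k h h′ → h :+ h′ :≡ m ∷ h :≡ h′ ∷ # 1 :+ m :≡ k :* # 2 ∷ h :≡ k ∷ [] ⊢ absurd) (m ∷ k ∷ h ∷ h′ ∷ []) eq e k≡ e′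
  one : h′ ≡ suc h
  one with ℕₚ.m≤n⇒m<n∨m≡n le
  ... | inj₁ lt = ℕₚ.≤-antisym le′ lt
  ... | inj₂ e = ⊥-elim (odd≢ e)

-- θ(1,2,r) contains a triangle and F has none: u₁ lies in no triangle, and F is bipartite off u₁.
-- The odd cycle that remains is a pentagon through u₁u₂.
sound-H : ∀ r′ m (F : Graph (suc m)) → 5 ≤ suc m → InH (suc m) F → Sound F 2 (suc (suc r′)) (half² m + 1)
sound-H r′ m F n≥5 (b , b-ok , role , u₁ , u₂ , X₁ , sizeB , sizeA , sizeW , ru₁ , ru₂ , u₁≢u₂ , X₁⊆ , (x₁ , X₁x₁) , (x₂ , rx₂ , ¬X₁x₂) , formula) =
  free , pentagon , count′
  where
  open Counting F
  α : Fin (suc m) → Bool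
  α i = isA (role i)
  c : Fin (suc m) → Bool
  c i = not (α i)
  B≡ : ∀ i → isB (role i) ≡ not (α i)
  B≡ i = trans (isB-bits (role i)) (trans (cong (λ z → not (α i) ∧ not z) (card-0 (isW ∘ role) sizeW i)) (Boolₚ.∧-identityʳ _))
  guard : ∀ i → hGuard (α i) (i == u₁) (i == u₂) (X₁ i) ≡ true
  guard i = ∧-intro (apart i u₁≢u₂) (∧-intro (at-vertex c (cong (not ∘ isA) ru₁) i) (∧-intro (at-vertex c (cong (not ∘ isA) ru₂) i)
    (guard-from X₁ α (λ i h → cong isA (X₁⊆ i h)) i)))
  form : ∀ i j → adj F i j ≡ hAdj (α i) (i == u₁) (i == u₂) (X₁ i) (α j) (j == u₁) (j == u₂) (X₁ j)
  form i j = trans (formula i j) (cong₂ (λ β β′ → hForm β β′ (α i) (i == u₁) (i == u₂) (X₁ i) (α j) (j == u₁) (j == u₂) (X₁ j)) (B≡ i) (B≡ j))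
  vec : (i j : Fin (suc m)) → Vec Bool 8
  vec i j = α i ∷ (i == u₁) ∷ (i == u₂) ∷ X₁ i ∷ α j ∷ (j == u₁) ∷ (j == u₂) ∷ X₁ j ∷ []
  guards : ∀ i j → hGuard₂ (α i) (i == u₁) (i == u₂) (X₁ i) (α j) (j == u₁) (j == u₂) (X₁ j) ≡ true
  guards i j = ∧-intro (guard i) (guard j)
  proper : ∀ {i j} → i ≢ u₁ → j ≢ u₁ → i ~ j → c i ≢ c j
  proper {i} {j} i≢ j≢ e = not-eqᵇ
    (bool⇒ 8 (λ α p q x A P Q X → hGuard₂ α p q x A P Q X ∧ (not p ∧ (not P ∧ hAdj α p q x A P Q X)))
      (λ α p q x A P Q X → not (eqᵇ (not α) (not A))) (vec i j)
      (∧-intro (guards i j) (∧-intro (cong not (≢⇒== i≢)) (∧-intro (cong not (≢⇒== j≢)) (trans (sym (form i j)) e)))))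
  open Split F u₁ c proper
  row : ∀ j → adj F u₁ j ≡ (j == u₂) ∨ X₁ j
  row j = trans (form u₁ j) (eqᵇ-true (bool⇒ 8 (λ α p q x A P Q X → hGuard₂ α p q x A P Q X ∧ p)
    (λ α p q x A P Q X → eqᵇ (hAdj α p q x A P Q X) (Q ∨ X)) (vec u₁ j) (∧-intro (guards u₁ j) (==-refl u₁))))
  Tʰ : Fin (suc m) → Fin (suc m) → Bool
  Tʰ i j = (i == u₂) ∧ X₁ j
  exact : ∀ i j → miss i j ≡ Tʰ i j
  exact i j = trans (cong (λ z → A i ∧ (B j ∧ not z)) (form i j)) (eqᵇ-true (bool⇒ 8 hGuard₂
    (λ α p q x A P Q X → eqᵇ ((not p ∧ not α) ∧ ((not P ∧ not (not A)) ∧ not (hAdj α p q x A P Q X))) (q ∧ X)) (vec i j) (guards i j)))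
  M≡ : M ≡ 1 * card X₁
  M≡ = trans (miss-total Tʰ exact) (trans (∑∑-product (_== u₂) X₁) (cong (_* card X₁) (card-single u₂)))
  A≡ : suc (card A) ≡ card (isB ∘ role)
  A≡ = sym (trans (card-∖ (isB ∘ role) u₁ (cong isB ru₁)) (cong suc (card-cong (λ i → trans (cong (_∧ not (i == u₁)) (B≡ i)) (Boolₚ.∧-comm (c i) _)))))
  B-size : card B ≡ card (isA ∘ role)
  B-size = card-cong (λ i → eqᵇ-true (bool⇒ 4 hGuard (λ α p q x → eqᵇ (not p ∧ not (not α)) α) (α i ∷ (i == u₁) ∷ (i == u₂) ∷ X₁ i ∷ []) (guard i)))
  P≡ : card P ≡ 1
  P≡ = trans (card-cong (λ i → trans (cong (_∧ c i) (row i)) (eqᵇ-true (bool⇒ 4 hGuard (λ α p q x → eqᵇ ((q ∨ x) ∧ not α) q) (α i ∷ (i == u₁) ∷ (i == u₂) ∷ X₁ i ∷ []) (guard i))))) (card-single u₂)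
  Q≡ : card Q ≡ card X₁
  Q≡ = card-cong (λ i → trans (cong (_∧ not (c i)) (row i)) (eqᵇ-true (bool⇒ 4 hGuard (λ α p q x → eqᵇ ((q ∨ x) ∧ not (not α)) x) (α i ∷ (i == u₁) ∷ (i == u₂) ∷ X₁ i ∷ []) (guard i))))
  count′ : edges F ≡ half² m + 1
  count′ = linear 7 (λ e M x ab p q h → e :+ M :≡ ab :+ (p :+ q) ∷ M :≡ # 1 :* x ∷ p :≡ # 1 ∷ q :≡ x ∷ ab :≡ h ∷ [] ⊢ e :≡ h :+ # 1)
    (edges F ∷ M ∷ card X₁ ∷ card A * card B ∷ card P ∷ card Q ∷ half² m ∷ []) count M≡ P≡ Q≡
    (InH-product m b b-ok (trans A≡ sizeB) (trans B-size sizeA))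
  at-u₁ : ∀ {i j} → u₁ ~ i → u₁ ~ j → i ~ j → ⊥
  at-u₁ {i} {j} wi wj ij = true≢false (trans (sym (trans (sym (form i j)) ij)) (not-true (bool⇒ 8
    (λ α p q x A P Q X → hGuard₂ α p q x A P Q X ∧ ((q ∨ x) ∧ (Q ∨ X)))
    (λ α p q x A P Q X → not (hAdj α p q x A P Q X)) (vec i j)
    (∧-intro (guards i j) (∧-intro (trans (sym (row i)) wi) (trans (sym (row j)) wj))))))
  no-triangle : ∀ {i j k} → i ~ j → i ~ k → j ~ k → ⊥
  no-triangle {i} {j} {k} ij ik jk with i Finₚ.≟ u₁ | j Finₚ.≟ u₁ | k Finₚ.≟ u₁
  ... | yes refl | _ | _ = at-u₁ ij ik jk
  ... | no _ | yes refl | _ = at-u₁ (~-sym ij) jk ik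
  ... | no _ | no _ | yes refl = at-u₁ (~-sym ik) (~-sym jk) ij
  ... | no i≢ | no j≢ | no k≢ = proper i≢ k≢ ik (≢-≢⇒≡ (proper i≢ j≢ ij) (proper j≢ k≢ jk))
  free : Free F (2 + suc (suc r′)) (thetaAdj 2 (suc (suc r′)))
  free (f , inj , hom) = no-triangle (E.g-step (s≤s (s≤s z≤n))) E.g-chord (E.g-step (s≤s (s≤s (s≤s z≤n))))
    where module E = Embedded F 0 r′ f inj hom
  pentagon : ¬ Bipartite F
  pentagon = through (pick (u₁ ∷ u₂ ∷ []) (isB ∘ role) (subst (2 <_) (sym sizeB) (ℕₚ.≤-trans (ℕₚ.⌈n/2⌉-mono n≥5) (ℕₚ.m≤m+n _ b))))
    where
    through : (∃[ y ] isB (role y) ≡ true × y ∉ (u₁ ∷ u₂ ∷ [])) → ¬ Bipartite F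
    through (y , By , y∉) = pentagon-odd-cycle F
        (trans (row u₂) (cong (_∨ X₁ u₂) (==-refl u₂)))
        (trans (form u₂ x₂) (bool⇒ 8 (λ α p q x A P Q X → hGuard₂ α p q x A P Q X ∧ (q ∧ (A ∧ not X))) hAdj (vec u₂ x₂)
          (∧-intro (guards u₂ x₂) (∧-intro (==-refl u₂) (∧-intro (cong isA rx₂) (cong not ¬X₁x₂))))))
        (to-y x₂ (cong isA rx₂)) (~-sym (to-y x₁ (cong isA (X₁⊆ x₁ X₁x₁))))
        (~-sym (trans (row x₁) (trans (cong ((x₁ == u₂) ∨_) X₁x₁) (Boolₚ.∨-zeroʳ _))))
      where
      to-y : ∀ x → α x ≡ true → x ~ y
      to-y x αx = trans (form x y) (bool⇒ 8 (λ α p q x A P Q X → hGuard₂ α p q x A P Q X ∧ (α ∧ (not A ∧ (not P ∧ not Q)))) hAdj (vec x y)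
        (∧-intro (guards x y) (∧-intro αx (∧-intro (trans (sym (B≡ y)) By) (∧-intro (cong not (≢⇒== (λ e → y∉ (here e)))) (cong not (≢⇒== (λ e → y∉ (there (here e))))))))))

tGuard : (α p q s x y : Bool) → Bool
tGuard α p q s x y = not (p ∧ q) ∧ (not (p ∧ s) ∧ (not (q ∧ s) ∧ (not (α ∧ (p ∨ q ∨ s)) ∧ ((not x ∨ α) ∧ (not y ∨ (not α ∧ not (p ∨ q ∨ s)))))))

tForm : (β ω β′ ω′ e α p q s x y A P Q S X Y : Bool) → Bool
tForm β ω β′ ω′ e α p q s x y A P Q S X Y = ((α ∧ β′) ∨ (β ∧ A)) ∨ (ω ∧ ω′ ∧ not e)
  ∨ (p ∧ A ∧ not X) ∨ (P ∧ α ∧ not x) ∨ (q ∧ β′ ∧ not Y) ∨ (Q ∧ β ∧ not y) ∨ (s ∧ (X ∨ Y)) ∨ (S ∧ (x ∨ y))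

tAdj : (e α p q s x y A P Q S X Y : Bool) → Bool
tAdj e α p q s x y A P Q S X Y = tForm (not α ∧ not (p ∨ q ∨ s)) (p ∨ q ∨ s) (not A ∧ not (P ∨ Q ∨ S)) (P ∨ Q ∨ S)
  e α p q s x y A P Q S X Y

tGuard₂ : (e α p q s x y A P Q S X Y : Bool) → Bool
tGuard₂ e α p q s x y A P Q S X Y = tGuard α p q s x y ∧ (tGuard A P Q S X Y ∧
  ((not (p ∧ P) ∨ e) ∧ ((not (q ∧ Q) ∨ e) ∧ ((not (s ∧ S) ∨ e) ∧ ((not e ∨ eqᵇ p P) ∧ ((not e ∨ eqᵇ q Q) ∧ (not e ∨ eqᵇ s S)))))))

sound-G : ∀ k (F : Graph (suc (suc (suc k)))) → InG (suc (suc (suc k))) F → Sound F 2 2 (half² (suc (suc k)) + 2)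
sound-G k F (role , w₁ , w₂ , w₃ , X₁ , Y₁ , sizes , sizeW , rw₁ , rw₂ , rw₃ , w₁≢w₂ , w₁≢w₃ , w₂≢w₃ , X₁⊆ , Y₁⊆ , product , formula) =
  free , triangle-odd-cycle F {w₃} {w₁} {w₂} w₃w₁ w₃w₂ w₁w₂ , count′ sizes
  where
  open Counting F
  n : ℕ
  n = suc (suc (suc k))
  α Ω c : Pred n
  α i = isA (role i)
  Ω i = isW (role i)
  -- The deleted vertex is w₃. Since w₁ is joined to X and w₂ to Y, the former is coloured with Y
  -- and the latter with X.
  c i = α i ∨ (i == w₂)
  W≡ : ∀ i → Ω i ≡ (i == w₁) ∨ (i == w₂) ∨ (i == w₃)
  W≡ i with i Finₚ.≟ w₁ | i Finₚ.≟ w₂ | i Finₚ.≟ w₃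
  ... | yes refl | _ | _ = cong isW rw₁
  ... | no _ | yes refl | _ = cong isW rw₂
  ... | no _ | no _ | yes refl = cong isW rw₃
  ... | no n₁ | no n₂ | no n₃ = ≢true (λ h → case exhaust (w₁ ∷ w₂ ∷ w₃ ∷ []) Ω
      (cong isW rw₁ , ∖-intro Ω (cong isW rw₂) (w₁≢w₂ ∘ sym) , ∖-intro (Ω ∖ w₁) (∖-intro Ω (cong isW rw₃) (w₁≢w₃ ∘ sym)) (w₂≢w₃ ∘ sym) , tt) sizeW h of λ where
    (here e) → n₁ e
    (there (here e)) → n₂ e
    (there (there (here e))) → n₃ e)
  B≡ : ∀ i → isB (role i) ≡ not (α i) ∧ not ((i == w₁) ∨ (i == w₂) ∨ (i == w₃))
  B≡ i = trans (isB-bits (role i)) (cong (λ z → not (α i) ∧ not z) (W≡ i))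
  guard : ∀ i → tGuard (α i) (i == w₁) (i == w₂) (i == w₃) (X₁ i) (Y₁ i) ≡ true
  guard i = ∧-intro (apart i w₁≢w₂) (∧-intro (apart i w₁≢w₃) (∧-intro (apart i w₂≢w₃)
    (∧-intro (trans (cong (λ z → not (α i ∧ z)) (sym (W≡ i))) (isA⇒¬isW (role i)))
      (∧-intro (guard-from X₁ α (λ i h → cong isA (X₁⊆ i h)) i)
        (guard-from Y₁ (λ i → not (α i) ∧ not ((i == w₁) ∨ (i == w₂) ∨ (i == w₃))) (λ i h → trans (sym (B≡ i)) (cong isB (Y₁⊆ i h))) i)))))
  form : ∀ i j → adj F i j ≡ tAdj (i == j) (α i) (i == w₁) (i == w₂) (i == w₃) (X₁ i) (Y₁ i) (α j) (j == w₁) (j == w₂) (j == w₃) (X₁ j) (Y₁ j)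
  form i j = trans (formula i j) (cong₄ (λ β ω β′ ω′ → tForm β ω β′ ω′ (i == j) (α i) (i == w₁) (i == w₂) (i == w₃) (X₁ i) (Y₁ i)
    (α j) (j == w₁) (j == w₂) (j == w₃) (X₁ j) (Y₁ j)) (B≡ i) (W≡ i) (B≡ j) (W≡ j))
  vec : (i j : Fin n) → Vec Bool 13
  vec i j = (i == j) ∷ α i ∷ (i == w₁) ∷ (i == w₂) ∷ (i == w₃) ∷ X₁ i ∷ Y₁ i ∷ α j ∷ (j == w₁) ∷ (j == w₂) ∷ (j == w₃) ∷ X₁ j ∷ Y₁ j ∷ []
  vec₁ : Fin n → Vec Bool 6
  vec₁ i = α i ∷ (i == w₁) ∷ (i == w₂) ∷ (i == w₃) ∷ X₁ i ∷ Y₁ i ∷ []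
  guards : ∀ i j → tGuard₂ (i == j) (α i) (i == w₁) (i == w₂) (i == w₃) (X₁ i) (Y₁ i) (α j) (j == w₁) (j == w₂) (j == w₃) (X₁ j) (Y₁ j) ≡ true
  guards i j = ∧-intro (guard i) (∧-intro (guard j) (∧-intro (both w₁ i j) (∧-intro (both w₂ i j) (∧-intro (both w₃ i j)
    (∧-intro (same-bit w₁ i j) (∧-intro (same-bit w₂ i j) (same-bit w₃ i j)))))))
  proper : ∀ {i j} → i ≢ w₃ → j ≢ w₃ → i ~ j → c i ≢ c j
  proper {i} {j} i≢ j≢ h = not-eqᵇ
    (bool⇒ 13 (λ e α p q s x y A P Q S X Y → tGuard₂ e α p q s x y A P Q S X Y ∧ (not s ∧ (not S ∧ tAdj e α p q s x y A P Q S X Y)))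
      (λ e α p q s x y A P Q S X Y → not (eqᵇ (α ∨ q) (A ∨ Q))) (vec i j)
      (∧-intro (guards i j) (∧-intro (cong not (≢⇒== i≢)) (∧-intro (cong not (≢⇒== j≢)) (trans (sym (form i j)) h)))))
  open Split F w₃ c proper
  near : Pred n
  near j = (j == w₁) ∨ (j == w₂) ∨ X₁ j ∨ Y₁ j
  row : ∀ j → adj F w₃ j ≡ near j
  row j = trans (form w₃ j) (eqᵇ-true (bool⇒ 13 (λ e α p q s x y A P Q S X Y → tGuard₂ e α p q s x y A P Q S X Y ∧ s)
    (λ e α p q s x y A P Q S X Y → eqᵇ (tAdj e α p q s x y A P Q S X Y) (P ∨ Q ∨ X ∨ Y)) (vec w₃ j) (∧-intro (guards w₃ j) (==-refl w₃))))
  w₃w₁ : w₃ ~ w₁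
  w₃w₁ = trans (row w₁) (cong (_∨ ((w₁ == w₂) ∨ X₁ w₁ ∨ Y₁ w₁)) (==-refl w₁))
  w₃w₂ : w₃ ~ w₂
  w₃w₂ = trans (row w₂) (bool⇒ 3 (λ x y z → y) (λ x y z → x ∨ y ∨ z) ((w₂ == w₁) ∷ (w₂ == w₂) ∷ (X₁ w₂ ∨ Y₁ w₂) ∷ []) (==-refl w₂))
  w₁w₂ : w₁ ~ w₂
  w₁w₂ = trans (form w₁ w₂) (bool⇒ 13 (λ e α p q s x y A P Q S X Y → tGuard₂ e α p q s x y A P Q S X Y ∧ (p ∧ Q))
    tAdj (vec w₁ w₂) (∧-intro (guards w₁ w₂) (∧-intro (==-refl w₁) (==-refl w₂))))
  Tᵍ : Fin n → Fin n → Bool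
  Tᵍ i j = ((i == w₂) ∧ Y₁ j) ∨ ((j == w₁) ∧ X₁ i)
  exact : ∀ i j → miss i j ≡ Tᵍ i j
  exact i j = trans (cong (λ z → A i ∧ (B j ∧ not z)) (form i j)) (eqᵇ-true (bool⇒ 13 tGuard₂
    (λ e α p q s x y A P Q S X Y → eqᵇ ((not s ∧ (α ∨ q)) ∧ ((not S ∧ not (A ∨ Q)) ∧ not (tAdj e α p q s x y A P Q S X Y))) ((q ∧ Y) ∨ (P ∧ x)))
    (vec i j) (guards i j)))
  M≡ : M ≡ card Y₁ + card X₁
  M≡ = trans (miss-total Tᵍ exact) (trans (∑-cong (λ i → trans (∑-cong (pt i)) (∑-+ (line i) (column i))))
      (trans (∑-+ (∑ ∘ line) (∑ ∘ column)) (cong₂ _+_ (∑∑-row w₂ (bit ∘ Y₁)) (∑∑-col w₁ (bit ∘ X₁)))))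
    where
    line column : Fin n → Fin n → ℕ
    line i j = if i == w₂ then bit (Y₁ j) else 0
    column i j = if j == w₁ then bit (X₁ i) else 0
    Y₁w₁ : Y₁ w₁ ≡ false
    Y₁w₁ = ≢true (λ h → case trans (sym (Y₁⊆ w₁ h)) rw₁ of λ ())
    X₁w₂ : X₁ w₂ ≡ false
    X₁w₂ = ≢true (λ h → case trans (sym (X₁⊆ w₂ h)) rw₂ of λ ())
    pt : ∀ i j → bit (Tᵍ i j) ≡ line i j + column i j
    pt i j with i Finₚ.≟ w₂ | j Finₚ.≟ w₁
    ... | yes refl | yes refl rewrite Y₁w₁ | X₁w₂ = refl
    ... | yes refl | no _ = trans (cong bit (Boolₚ.∨-identityʳ _)) (sym (ℕₚ.+-identityʳ _))
    ... | no _ | yes refl = refl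
    ... | no _ | no _ = refl
  A≡ : card A ≡ suc (card (isA ∘ role))
  A≡ = trans (card-∖ A w₂ (A-intro w₂≢w₃ (trans (cong (α w₂ ∨_) (==-refl w₂)) (Boolₚ.∨-zeroʳ _)))) (cong suc (card-cong {p = A ∖ w₂} {q = isA ∘ role} (λ i →
    eqᵇ-true (bool⇒ 6 tGuard (λ α p q s x y → eqᵇ ((not s ∧ (α ∨ q)) ∧ not q) α) (vec₁ i) (guard i)))))
  B-size : card B ≡ suc (card (isB ∘ role))
  B-size = trans (card-∖ B w₁ (B-intro w₁≢w₃ (trans (cong₂ (λ s t → isA s ∨ t) rw₁ (≢⇒== w₁≢w₂)) refl))) (cong suc (card-cong {p = B ∖ w₁} {q = isB ∘ role} (λ i →
    trans (eqᵇ-true (bool⇒ 6 tGuard (λ α p q s x y → eqᵇ ((not s ∧ not (α ∨ q)) ∧ not p) (not α ∧ not (p ∨ q ∨ s))) (vec₁ i) (guard i))) (sym (B≡ i)))))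
  P≡ : card P ≡ suc (card X₁)
  P≡ = trans (card-∖ P w₂ (∧-intro w₃w₂ (trans (cong (α w₂ ∨_) (==-refl w₂)) (Boolₚ.∨-zeroʳ _)))) (cong suc (card-cong {p = P ∖ w₂} {q = X₁} (λ i →
    trans (cong (λ z → (z ∧ c i) ∧ not (i == w₂)) (row i)) (eqᵇ-true (bool⇒ 6 tGuard (λ α p q s x y → eqᵇ (((p ∨ q ∨ x ∨ y) ∧ (α ∨ q)) ∧ not q) x) (vec₁ i) (guard i))))))
  Q≡ : card Q ≡ suc (card Y₁)
  Q≡ = trans (card-∖ Q w₁ (∧-intro w₃w₁ (cong₂ (λ s t → not (isA s ∨ t)) rw₁ (≢⇒== w₁≢w₂)))) (cong suc (card-cong {p = Q ∖ w₁} {q = Y₁} (λ i →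
    trans (cong (λ z → (z ∧ not (c i)) ∧ not (i == w₁)) (row i)) (eqᵇ-true (bool⇒ 6 tGuard (λ α p q s x y → eqᵇ (((p ∨ q ∨ x ∨ y) ∧ not (α ∨ q)) ∧ not p) y) (vec₁ i) (guard i))))))
  count″ : edges F ≡ suc (card (isA ∘ role)) * suc (card (isB ∘ role)) + 2
  count″ = linear 5 (λ e M x y ab → e :+ M :≡ ab :+ ((# 1 :+ x) :+ (# 1 :+ y)) ∷ M :≡ y :+ x ∷ [] ⊢ e :≡ ab :+ # 2)
    (edges F ∷ M ∷ card X₁ ∷ card Y₁ ∷ suc (card (isA ∘ role)) * suc (card (isB ∘ role)) ∷ [])
    (trans count (cong₄ (λ a b p q → a * b + (p + q)) A≡ B-size P≡ Q≡)) M≡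
  count′ : ((card (isA ∘ role) ≡ ⌈ k /2⌉ × card (isB ∘ role) ≡ ⌊ k /2⌋) ⊎ (card (isA ∘ role) ≡ ⌊ k /2⌋ × card (isB ∘ role) ≡ ⌈ k /2⌉)) →
    edges F ≡ half² (suc (suc k)) + 2
  count′ (inj₁ (e , f)) = trans count″ (cong₂ (λ a b → suc a * suc b + 2) e f)
  count′ (inj₂ (e , f)) = trans count″ (trans (cong₂ (λ a b → suc a * suc b + 2) e f) (cong (_+ 2) (ℕₚ.*-comm (suc ⌊ k /2⌋) (suc ⌈ k /2⌉))))

  -- Inside the neighbourhood of w₃ the edges are w₁w₂ and those between X₁ and Y₁.
  mate : (f g : (α p q s x y : Bool) → Bool) →
    {_ : T (tautology 13 (lift₂ 13 _⊃_ (λ e α p q s x y A P Q S X Y → tGuard₂ e α p q s x y A P Q S X Y ∧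
        (f α p q s x y ∧ ((P ∨ Q ∨ X ∨ Y) ∧ tAdj e α p q s x y A P Q S X Y)))
      (λ e α p q s x y A P Q S X Y → g A P Q S X Y)))} →
    ∀ {i j} → f (α i) (i == w₁) (i == w₂) (i == w₃) (X₁ i) (Y₁ i) ≡ true → w₃ ~ j → i ~ j → g (α j) (j == w₁) (j == w₂) (j == w₃) (X₁ j) (Y₁ j) ≡ true
  mate f g {t} {i} {j} fi wj ij = bool⇒ 13 (λ e α p q s x y A P Q S X Y → tGuard₂ e α p q s x y A P Q S X Y ∧
        (f α p q s x y ∧ ((P ∨ Q ∨ X ∨ Y) ∧ tAdj e α p q s x y A P Q S X Y)))
      (λ e α p q s x y A P Q S X Y → g A P Q S X Y) {t} (vec i j)
    (∧-intro (guards i j) (∧-intro fi (∧-intro (trans (sym (row j)) wj) (trans (sym (form i j)) ij))))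

  two-members : ∀ (p : Pred n) {i j} → p i ≡ true → p j ≡ true → i ≢ j → 2 ≤ card p
  two-members p {i} {j} pi pj ne = subst (2 ≤_) (sym (card-∖ p i pi)) (s≤s (card-pos (p ∖ i) (∖-intro p pj (ne ∘ sym))))

  -- Inside the neighbourhood of w₃, w₁ and w₂ have one neighbour each; any other vertex with two
  -- neighbours there would make |X₁||Y₁| at least 2.
  at-w₃ : ∀ {u y y′} → w₃ ~ u → w₃ ~ y → u ~ y → w₃ ~ y′ → u ~ y′ → y ≢ y′ → ⊥
  at-w₃ {u} {y} {y′} wu wy uy wy′ uy′ ne with ∨-case {u == w₁} (trans (sym (row u)) wu)
  ... | inj₁ h = ne (trans (==⇒≡ {i = y} (mate (λ α p q s x y → p) (λ α p q s x y → q) h wy uy)) (sym (==⇒≡ {i = y′} (mate (λ α p q s x y → p) (λ α p q s x y → q) h wy′ uy′))))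
  ... | inj₂ h with ∨-case {u == w₂} h
  ... | inj₁ h = ne (trans (==⇒≡ {i = y} (mate (λ α p q s x y → q) (λ α p q s x y → p) h wy uy)) (sym (==⇒≡ {i = y′} (mate (λ α p q s x y → q) (λ α p q s x y → p) h wy′ uy′))))
  ... | inj₂ h with ∨-case {X₁ u} h
  ... | inj₁ h = ℕₚ.<⇒≱ (ℕₚ.*-mono-≤ (card-pos X₁ h) (two-members Y₁ {y} {y′}
      (mate (λ α p q s x y → x) (λ α p q s x y → y) h wy uy) (mate (λ α p q s x y → x) (λ α p q s x y → y) h wy′ uy′) ne)) product
  ... | inj₂ h = ℕₚ.<⇒≱ (ℕₚ.*-mono-≤ (two-members X₁ {y} {y′}
      (mate (λ α p q s x y → y) (λ α p q s x y → x) h wy uy) (mate (λ α p q s x y → y) (λ α p q s x y → x) h wy′ uy′) ne) (card-pos Y₁ h)) product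

  triangle-hits : ∀ {u v x} → u ~ v → u ~ x → v ~ x → u ≢ w₃ → v ≢ w₃ → x ≡ w₃
  triangle-hits {u} {v} {x} uv ux vx u≢ v≢ with x Finₚ.≟ w₃
  ... | yes e = e
  ... | no x≢ = ⊥-elim (proper u≢ x≢ ux (≢-≢⇒≡ (proper u≢ v≢ uv) (proper v≢ x≢ vx)))

  -- Both triangles on the edge uu′ pass through w₃. If w₃ is no end of that edge, it is the third
  -- vertex of both.
  diamond-free : ∀ {u u′ y y′} → u ~ u′ → u ~ y → u′ ~ y → u ~ y′ → u′ ~ y′ → y ≢ y′ → ⊥
  diamond-free {u} {u′} {y} {y′} uu′ uy u′y uy′ u′y′ ne with u Finₚ.≟ w₃ | u′ Finₚ.≟ w₃
  ... | yes refl | _ = at-w₃ uu′ uy u′y uy′ u′y′ ne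
  ... | no _ | yes refl = at-w₃ (~-sym uu′) u′y uy u′y′ uy′ ne
  ... | no u≢ | no u′≢ = ne (trans (triangle-hits uu′ uy u′y u≢ u′≢) (sym (triangle-hits uu′ uy′ u′y′ u≢ u′≢)))

  free : Free F 4 (thetaAdj 2 2)
  free (f , inj , hom) = diamond-free E.g-chord (E.g-step (s≤s (s≤s z≤n))) (~-sym (E.g-step (s≤s (s≤s (s≤s z≤n))))) E.g-close (E.g-step (s≤s (s≤s (s≤s (s≤s z≤n)))))
      (E.g-distinct (s≤s (s≤s z≤n)) (s≤s (s≤s (s≤s (s≤s z≤n)))) (λ ()))
    where module E = Embedded F 0 0 f inj hom

-- Existence of members

card-below : ∀ {n} k → k ≤ n → card {n} (λ i → toℕ i <ᵇ k) ≡ k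
card-below {zero} zero _ = refl
card-below {suc n} zero _ = card-empty {suc n} (λ _ → refl)
card-below {suc n} (suc k) (s≤s le) = trans (∑-suc (λ (i : Fin (suc n)) → bit (toℕ i <ᵇ suc k))) (cong suc (card-below {n} k le))

<ᵇ-yes : ∀ {a b} → a < b → (a <ᵇ b) ≡ true
<ᵇ-yes h = T⇒≡ (ℕₚ.<⇒<ᵇ h)

<ᵇ-no : ∀ {a b} → b ≤ a → (a <ᵇ b) ≡ false
<ᵇ-no {a} {b} h = ≢true (λ e → ℕₚ.<⇒≱ (ℕₚ.<ᵇ⇒< a b (subst T (sym e) tt)) h)

layer : Bool → Bool → Side
layer p q = if p then sA else if q then sB else sW

module Layers (n s t : ℕ) (s+t≤n : s + t ≤ n) where

  role : Fin n → Side
  role i = layer (toℕ i <ᵇ s) (toℕ i <ᵇ s + t)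

  isA-layer : ∀ p q → isA (layer p q) ≡ p
  isA-layer true q = refl
  isA-layer false true = refl
  isA-layer false false = refl

  role-sizeA : card (isA ∘ role) ≡ s
  role-sizeA = trans (card-cong {n} (λ i → isA-layer (toℕ i <ᵇ s) (toℕ i <ᵇ s + t))) (card-below {n} s (ℕₚ.≤-trans (ℕₚ.m≤m+n s t) s+t≤n))

  nested : ∀ i → (toℕ {n} i <ᵇ s) ≡ true → (toℕ i <ᵇ s + t) ≡ true
  nested i h = <ᵇ-yes (ℕₚ.≤-trans (ℕₚ.<ᵇ⇒< (toℕ i) s (subst T (sym h) tt)) (ℕₚ.m≤m+n s t))

  layers : ∀ {p q} → (p ≡ true → q ≡ true) → bit (isA (layer p q)) + bit (isB (layer p q)) ≡ bit q
  layers {true} {true} h = refl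
  layers {true} {false} h = case h refl of λ ()
  layers {false} {true} h = refl
  layers {false} {false} h = refl

  all-layers : ∀ {p q} → (p ≡ true → q ≡ true) → bit q + bit (isW (layer p q)) ≡ 1
  all-layers {true} {true} h = refl
  all-layers {true} {false} h = case h refl of λ ()
  all-layers {false} {true} h = refl
  all-layers {false} {false} h = refl

  below : card {n} (λ i → toℕ i <ᵇ s + t) ≡ s + t
  below = card-below (s + t) s+t≤n

  role-sizeB : card (isB ∘ role) ≡ t
  role-sizeB = ℕₚ.+-cancelˡ-≡ s _ _ (trans (cong (_+ card (isB ∘ role)) (sym role-sizeA))
    (trans (cards≡ ((isA ∘ role) ∷ (isB ∘ role) ∷ []) ((λ i → toℕ i <ᵇ s + t) ∷ []) (λ i → layers (nested i))) below))

  role-sizeW : ∀ u → s + t + u ≡ n → card (isW ∘ role) ≡ u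
  role-sizeW u eq = ℕₚ.+-cancelˡ-≡ (s + t) _ _ (trans (cong (_+ card (isW ∘ role)) (sym below))
    (trans (cards≡ ((λ i → toℕ i <ᵇ s + t) ∷ (isW ∘ role) ∷ []) (all ∷ []) (λ i → all-layers (nested i))) (trans card-all (sym eq))))

  vertex : ∀ k → k < n → Fin n
  vertex k h = Fin.fromℕ< h

  in-A : ∀ {k} (h : k < n) → k < s → role (vertex k h) ≡ sA
  in-A h lt rewrite Finₚ.toℕ-fromℕ< h | <ᵇ-yes lt = refl

  in-B : ∀ {k} (h : k < n) → s ≤ k → k < s + t → role (vertex k h) ≡ sB
  in-B h le lt rewrite Finₚ.toℕ-fromℕ< h | <ᵇ-no le | <ᵇ-yes lt = refl

exactly-one : (α β ω : Bool) → Bool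
exactly-one α β ω = not (α ∧ β) ∧ (not (α ∧ ω) ∧ not (β ∧ ω))

exactly-one-side : ∀ s → exactly-one (isA s) (isB s) (isW s) ≡ true
exactly-one-side sA = refl
exactly-one-side sB = refl
exactly-one-side sW = refl

bullet-exists : ∀ n s t → 1 ≤ s → 1 ≤ t → suc (s + t) ≡ n → Σ (Graph n) (IsBullet s t)
bullet-exists n s t s≥1 t≥1 eq = graph , role , x , y , role-sizeA , role-sizeB , role-sizeW 1 (trans (ℕₚ.+-comm (s + t) 1) eq) , rx , ry , λ i j → refl
  where
  s+t≤n : s + t ≤ n
  s+t≤n = subst (s + t ≤_) eq (ℕₚ.n≤1+n _)
  open Layers n s t s+t≤n
  0<n : 0 < n
  0<n = ℕₚ.≤-trans s≥1 (ℕₚ.≤-trans (ℕₚ.m≤m+n s t) s+t≤n)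
  s<n : s < n
  s<n = ℕₚ.≤-trans (ℕₚ.m<m+n s t≥1) s+t≤n
  x y : Fin n
  x = vertex 0 0<n
  y = vertex s s<n
  rx : role x ≡ sA
  rx = in-A 0<n s≥1
  ry : role y ≡ sB
  ry = in-B s<n ℕₚ.≤-refl (ℕₚ.m<m+n s t≥1)
  graph : Graph n
  graph = record
    { adj = λ i j → bForm (isB (role i)) (isW (role i)) (isB (role j)) (isW (role j)) (isA (role i)) (i == x) (i == y) (isA (role j)) (j == x) (j == y)
    ; sym = λ i j → bool≡ 10 (λ β ω B O α x y A X Y → bForm β ω B O α x y A X Y) (λ β ω B O α x y A X Y → bForm B O β ω A X Y α x y)
        (isB (role i) ∷ isW (role i) ∷ isB (role j) ∷ isW (role j) ∷ isA (role i) ∷ (i == x) ∷ (i == y) ∷ isA (role j) ∷ (j == x) ∷ (j == y) ∷ [])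
    ; irrefl = λ i → not-true (bool⇒ 5 (λ α β ω x y → exactly-one α β ω ∧ ((not x ∨ α) ∧ (not y ∨ β))) (λ α β ω x y → not (bForm β ω β ω α x y α x y))
        (isA (role i) ∷ isB (role i) ∷ isW (role i) ∷ (i == x) ∷ (i == y) ∷ [])
        (∧-intro (exactly-one-side (role i)) (∧-intro (at-vertex (isA ∘ role) (cong isA rx) i) (at-vertex (isB ∘ role) (cong isB ry) i)))) }

circ-exists : ∀ n s t → 1 ≤ t → suc (suc (s + t)) ≡ n → Σ (Graph n) (IsCirc s t)
circ-exists n s t t≥1 eq = graph , role , z , role-sizeA , role-sizeB , role-sizeW 2 (trans (ℕₚ.+-comm (s + t) 2) eq) , rz , λ i j → refl
  where
  s+t≤n : s + t ≤ n
  s+t≤n = subst (s + t ≤_) eq (ℕₚ.m≤n+m (s + t) 2)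
  open Layers n s t s+t≤n
  s<n : s < n
  s<n = ℕₚ.≤-trans (ℕₚ.m<m+n s t≥1) s+t≤n
  z : Fin n
  z = vertex s s<n
  rz : role z ≡ sB
  rz = in-B s<n ℕₚ.≤-refl (ℕₚ.m<m+n s t≥1)
  graph : Graph n
  graph = record
    { adj = λ i j → cForm (isB (role i)) (isW (role i)) (isB (role j)) (isW (role j)) (i == j) (isA (role i)) (i == z) (isA (role j)) (j == z)
    ; sym = λ i j → trans (cong (λ e → cForm (isB (role i)) (isW (role i)) (isB (role j)) (isW (role j)) e (isA (role i)) (i == z) (isA (role j)) (j == z)) (==-sym i j))
        (bool≡ 9 (λ β ω B O e α z A Z → cForm β ω B O e α z A Z) (λ β ω B O e α z A Z → cForm B O β ω e A Z α z)
        (isB (role i) ∷ isW (role i) ∷ isB (role j) ∷ isW (role j) ∷ (j == i) ∷ isA (role i) ∷ (i == z) ∷ isA (role j) ∷ (j == z) ∷ []))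
    ; irrefl = λ i → not-true (bool⇒ 5 (λ α β ω e z → exactly-one α β ω ∧ (e ∧ (not z ∨ β))) (λ α β ω e z → not (cForm β ω β ω e α z α z))
        (isA (role i) ∷ isB (role i) ∷ isW (role i) ∷ (i == i) ∷ (i == z) ∷ [])
        (∧-intro (exactly-one-side (role i)) (∧-intro (==-refl i) (at-vertex (isB ∘ role) (cong isB rz) i)))) }

H-exists : ∀ m → 5 ≤ suc m → Σ (Graph (suc m)) (InH (suc m))
H-exists m n≥5 = graph , 0 , inj₁ refl , role , u₁ , u₂ , (_== x₁) , trans role-sizeB (sym (ℕₚ.+-identityʳ t)) , role-sizeA ,
    role-sizeW 0 (trans (ℕₚ.+-identityʳ _) total) , ru₁ , ru₂ , u₁≢u₂ , (λ i h → trans (cong role (==⇒≡ {i = i} h)) rx₁) , (x₁ , ==-refl x₁) ,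
    (x₂ , rx₂ , ≢⇒== (λ e → vertex-distinct 1<n 0<n (λ ()) e)) , λ i j → refl
  where
  n s t : ℕ
  n = suc m
  s = ⌊ n /2⌋
  t = ⌈ n /2⌉
  total : s + t ≡ n
  total = proj₁ (halves n)
  s≥2 : 2 ≤ s
  s≥2 = ℕₚ.⌊n/2⌋-mono n≥5
  t≥3 : 3 ≤ t
  t≥3 = ℕₚ.⌈n/2⌉-mono n≥5
  open Layers n s t (ℕₚ.≤-reflexive total)
  vertex-distinct : ∀ {k l} (h : k < n) (h′ : l < n) → k ≢ l → vertex k h ≢ vertex l h′
  vertex-distinct h h′ ne e = ne (trans (sym (Finₚ.toℕ-fromℕ< h)) (trans (cong toℕ e) (Finₚ.toℕ-fromℕ< h′)))
  0<n : 0 < n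
  0<n = s≤s z≤n
  1<n : 1 < n
  1<n = ℕₚ.≤-trans (s≤s (s≤s z≤n)) n≥5
  s<n : s < n
  s<n = linear 3 (λ s t n → s :+ t :≡ n ∷ # 3 :≤ t ∷ [] ⊢ s :< n) (s ∷ t ∷ n ∷ []) total t≥3
  s+1<n : suc s < n
  s+1<n = linear 3 (λ s t n → s :+ t :≡ n ∷ # 3 :≤ t ∷ [] ⊢ # 1 :+ s :< n) (s ∷ t ∷ n ∷ []) total t≥3
  x₁ x₂ u₁ u₂ : Fin n
  x₁ = vertex 0 0<n
  x₂ = vertex 1 1<n
  u₁ = vertex s s<n
  u₂ = vertex (suc s) s+1<n
  rx₁ : role x₁ ≡ sA
  rx₁ = in-A 0<n (ℕₚ.≤-trans (s≤s z≤n) s≥2)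
  rx₂ : role x₂ ≡ sA
  rx₂ = in-A 1<n s≥2
  ru₁ : role u₁ ≡ sB
  ru₁ = in-B s<n ℕₚ.≤-refl (subst (s <_) (sym total) s<n)
  ru₂ : role u₂ ≡ sB
  ru₂ = in-B s+1<n (ℕₚ.n≤1+n s) (subst (suc s <_) (sym total) s+1<n)
  u₁≢u₂ : u₁ ≢ u₂
  u₁≢u₂ = vertex-distinct s<n s+1<n (λ e → ℕₚ.1+n≢n (sym e))
  graph : Graph n
  graph = record
    { adj = λ i j → hForm (isB (role i)) (isB (role j)) (isA (role i)) (i == u₁) (i == u₂) (i == x₁) (isA (role j)) (j == u₁) (j == u₂) (j == x₁)
    ; sym = λ i j → bool≡ 10 (λ β B α p q x A P Q X → hForm β B α p q x A P Q X) (λ β B α p q x A P Q X → hForm B β A P Q X α p q x)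
        (isB (role i) ∷ isB (role j) ∷ isA (role i) ∷ (i == u₁) ∷ (i == u₂) ∷ (i == x₁) ∷ isA (role j) ∷ (j == u₁) ∷ (j == u₂) ∷ (j == x₁) ∷ [])
    ; irrefl = λ i → not-true (bool⇒ 6 (λ α β ω p q x → exactly-one α β ω ∧ not (p ∧ q)) (λ α β ω p q x → not (hForm β β α p q x α p q x))
        (isA (role i) ∷ isB (role i) ∷ isW (role i) ∷ (i == u₁) ∷ (i == u₂) ∷ (i == x₁) ∷ [])
        (∧-intro (exactly-one-side (role i)) (apart i u₁≢u₂))) }

-- From edge counts and recognition to the four cases

≅-refl : ∀ {n} (G : Graph n) → G ≅ G
≅-refl G = Perm.id , λ i j → refl

-- The witness shows that N is attained, so extremal graphs have at least N edges and are members.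
-- Conversely, an admissible graph with at least N edges is a member and hence has exactly N edges.
-- The witness is not asked to be a member; completeness makes it one.
characterise : ∀ {n q r} (P : Graph n → Set) N → (∀ F → P F → Sound F q r N) →
  (∀ G → Free G (q + r) (thetaAdj q r) → ¬ Bipartite G → N ≤ edges G → P G) →
  Σ (Graph n) (λ F → Sound F q r N) → EX3θ-is n q r P
characterise P N sound complete (F₀ , free₀ , nonbip₀ , count₀) =
  (λ G (free , nonbip , best) → G , complete G free nonbip (subst (_≤ edges G) count₀ (best F₀ free₀ nonbip₀)) , ≅-refl G) ,
  (λ F PF → F , (proj₁ (sound F PF) , proj₁ (proj₂ (sound F PF)) , optimal F PF) , ≅-refl F)
  where
  optimal : ∀ F → P F → ∀ G → Free G _ _ → ¬ Bipartite G → edges G ≤ edges F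
  optimal F PF G free nonbip with ℕₚ.≤-total (edges G) N
  ... | inj₁ le = subst (edges G ≤_) (sym (proj₂ (proj₂ (sound F PF)))) le
  ... | inj₂ ge = ℕₚ.≤-reflexive (trans (proj₂ (proj₂ (sound G (complete G free nonbip ge)))) (sym (proj₂ (proj₂ (sound F PF)))))

parity? : ∀ r → (∃[ b ] r ≡ b * 2) ⊎ (∃[ b ] r ≡ suc (b * 2))
parity? zero = inj₁ (0 , refl)
parity? (suc r) with parity? r
... | inj₁ (b , e) = inj₂ (b , cong suc e)
... | inj₂ (b , e) = inj₁ (suc b , cong suc e)

odd-form : ∀ r → 2 ≤ r → ¬ 2 ∣ r → ∃[ b ] r ≡ suc (suc b * 2)
odd-form r r≥2 not-even with parity? r
... | inj₁ (b , e) = ⊥-elim (not-even (divides b e))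
... | inj₂ (suc b , e) = b , e
odd-form .1 (s≤s ()) not-even | inj₂ (zero , refl)

module Cases (K k : ℕ) (n-large : threshold K ≤ suc (suc (suc k))) where

  n m : ℕ
  n = suc (suc (suc k))
  m = suc (suc k)

  n≥5 : 5 ≤ n
  n≥5 = linear 3 (λ m k n → m :+ # 100 :+ # 100000 :+ # 200 :* k :≤ n ∷ [] ⊢ # 5 :≤ n) (turán₀ K ∷ K ∷ n ∷ []) n-large

  halves-sum : ∀ m → ⌈ m /2⌉ + ⌊ m /2⌋ ≡ m
  halves-sum m = trans (ℕₚ.+-comm ⌈ m /2⌉ ⌊ m /2⌋) (proj₁ (halves m))

  -- Also serves for q = r = 2, where this graph attains the maximum, so that no member of 𝓖(n) has
  -- to be constructed.
  a-bullet : ∀ a b → Σ (Graph n) (λ F → Sound F (suc a * 2) (suc b * 2) (half² m + 2))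
  a-bullet a b = let F , member = bullet-exists n ⌈ m /2⌉ ⌊ m /2⌋ (s≤s z≤n) (s≤s z≤n) (cong suc (halves-sum m)) in
    F , sound-bullet a b ⌈ m /2⌉ ⌊ m /2⌋ F member

  case-G : 14 ≤ K → EX3θ-is n 2 2 (InG n)
  case-G K-large = characterise (InG n) (half² m + 2) (sound-G k)
    (λ G → complete-G 2 2 0 refl refl refl K K-large k G n-large) (a-bullet 0 0)

  case-bullet : ∀ a b → suc a * 2 + suc (suc b) * 2 + 10 ≤ K → EX3θ-is n (suc a * 2) (suc (suc b) * 2) (InBullet n)
  case-bullet a b K-large = characterise (InBullet n) (half² m + 2) (sound-bullet a (suc b) ⌈ m /2⌉ ⌊ m /2⌋)
    (λ G → complete-bullet (suc a * 2) (suc (suc b) * 2) a refl b refl K K-large m G n-large) (a-bullet a (suc b))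

  case-H : ∀ b → 2 + suc (suc b * 2) + 10 ≤ K → EX3θ-is n 2 (suc (suc b * 2)) (InH n)
  case-H b K-large = characterise (InH n) (half² m + 1) sound
    (λ G → complete-H 2 (suc (suc b * 2)) 0 refl refl b refl K K-large m G n-large) (proj₁ (H-exists m n≥5) , sound (proj₁ (H-exists m n≥5)) (proj₂ (H-exists m n≥5)))
    where
    sound : ∀ F → InH n F → Sound F 2 (suc (suc b * 2)) (half² m + 1)
    sound F = sound-H (suc (b * 2)) m F n≥5

  case-circ : ∀ a b → suc (suc a) * 2 + suc (suc b * 2) + 10 ≤ K → EX3θ-is n (suc (suc a) * 2) (suc (suc b * 2)) (InCirc n)
  case-circ a b K-large = characterise (InCirc n) (half² (suc k) + 3) sound
    (λ G → complete-circ (suc (suc a) * 2) (suc (suc b * 2)) (suc a) refl a refl b refl K K-large (suc k) G n-large)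
    (proj₁ example , sound (proj₁ example) (inj₁ (proj₂ example)))
    where
    sound : ∀ F → InCirc n F → Sound F (suc (suc a) * 2) (suc (suc b * 2)) (half² (suc k) + 3)
    sound F (inj₁ member) = sound-circ (suc a) (suc (b * 2)) ⌈ suc k /2⌉ ⌊ suc k /2⌋ F member
    sound F (inj₂ member) = subst (λ N → Sound F (suc (suc a) * 2) (suc (suc b * 2)) (N + 3)) (ℕₚ.*-comm ⌊ suc k /2⌋ ⌈ suc k /2⌉)
      (sound-circ (suc a) (suc (b * 2)) ⌊ suc k /2⌋ ⌈ suc k /2⌉ F member)
    example : Σ (Graph n) (IsCirc ⌈ suc k /2⌉ ⌊ suc k /2⌋)
    example = circ-exists n ⌈ suc k /2⌉ ⌊ suc k /2⌋ (ℕₚ.⌊n/2⌋-mono k≥1) (cong (λ z → suc (suc z)) (halves-sum (suc k)))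
      where
      k≥1 : 2 ≤ suc k
      k≥1 = linear 1 (λ k → # 5 :≤ # 3 :+ k ∷ [] ⊢ # 2 :≤ # 1 :+ k) (k ∷ []) n≥5

theorem1p2 : ∀ (q r : ℕ) → 2 ≤ q → 2 ≤ r → 2 ∣ q →
    ∃[ n₀ ] ∀ (n : ℕ) → n₀ ≤ n →
    ((q ≡ 2 → r ≡ 2 → EX3θ-is n q r (InG n)) ×
    (4 ≤ r → 2 ∣ r → EX3θ-is n q r (InBullet n)) ×
    (q ≡ 2 → ¬ 2 ∣ r → EX3θ-is n q r (InH n)) ×
    (4 ≤ q → ¬ 2 ∣ r → EX3θ-is n q r (InCirc n)))
theorem1p2 q r q≥2 r≥2 2∣q = threshold K , λ n n-large → at n n-large
    (linear 3 (λ m k n → m :+ # 100 :+ # 100000 :+ # 200 :* k :≤ n ∷ [] ⊢ # 3 :≤ n) (turán₀ K ∷ K ∷ n ∷ []) n-large)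
  where
  K : ℕ
  K = q + r + 10
  at : ∀ n → threshold K ≤ n → 3 ≤ n →
    ((q ≡ 2 → r ≡ 2 → EX3θ-is n q r (InG n)) ×
    (4 ≤ r → 2 ∣ r → EX3θ-is n q r (InBullet n)) ×
    (q ≡ 2 → ¬ 2 ∣ r → EX3θ-is n q r (InH n)) ×
    (4 ≤ q → ¬ 2 ∣ r → EX3θ-is n q r (InCirc n)))
  at (suc (suc (suc k))) n-large (s≤s (s≤s (s≤s z≤n))) = books , bullets 2∣q , blow-ups , pendants 2∣q
    where
    n : ℕ
    n = suc (suc (suc k))
    open Cases K k n-large hiding (n)
    books : q ≡ 2 → r ≡ 2 → EX3θ-is n q r (InG n)
    books q≡2 r≡2 = subst₂ (λ q r → EX3θ-is n q r (InG n)) (sym q≡2) (sym r≡2) (case-G (ℕₚ.≤-reflexive (sym (cong₂ (λ q r → q + r + 10) q≡2 r≡2))))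
    bullets : 2 ∣ q → 4 ≤ r → 2 ∣ r → EX3θ-is n q r (InBullet n)
    bullets (divides zero refl) _ _ = case q≥2 of λ ()
    bullets (divides (suc a) q≡) r≥4 (divides zero refl) = case r≥2 of λ ()
    bullets (divides (suc a) q≡) r≥4 (divides (suc zero) refl) = case r≥4 of λ { (s≤s (s≤s ())) }
    bullets (divides (suc a) q≡) r≥4 (divides (suc (suc b)) r≡) = subst₂ (λ q r → EX3θ-is n q r (InBullet n)) (sym q≡) (sym r≡)
      (case-bullet a b (ℕₚ.≤-reflexive (sym (cong₂ (λ q r → q + r + 10) q≡ r≡))))
    blow-ups : q ≡ 2 → ¬ 2 ∣ r → EX3θ-is n q r (InH n)
    blow-ups q≡2 r-odd = let b , r≡ = odd-form r r≥2 r-odd in subst₂ (λ q r → EX3θ-is n q r (InH n)) (sym q≡2) (sym r≡)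
      (case-H b (ℕₚ.≤-reflexive (sym (cong₂ (λ q r → q + r + 10) q≡2 r≡))))
    pendants : 2 ∣ q → 4 ≤ q → ¬ 2 ∣ r → EX3θ-is n q r (InCirc n)
    pendants (divides zero refl) _ _ = case q≥2 of λ ()
    pendants (divides (suc zero) refl) q≥4 _ = case q≥4 of λ { (s≤s (s≤s ())) }
    pendants (divides (suc (suc a)) q≡) _ r-odd = let b , r≡ = odd-form r r≥2 r-odd in subst₂ (λ q r → EX3θ-is n q r (InCirc n)) (sym q≡) (sym r≡)
      (case-circ a b (ℕₚ.≤-reflexive (sym (cong₂ (λ q r → q + r + 10) q≡ r≡))))
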